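{- Let $m\geq 2$ be an integer. There exists an integer $n_0$ such that the following holds. Suppose that $H$ is a $3$-graph on $n\geq n_0$ vertices with $n$ divisible by $3m$. If $\delta_2(H)\geq n/2+m^{1/m}n^{1-1/m}$, then $H$ contains a $K^3(m)$-factor.
   Context: A $3$-graph is a pair $(V,E)$ with $E$ a set of $3$-element subsets of $V$. For a set $S$ of two vertices, $d_H(S)$ is the number of edges of $H$ containing $S$, and $\delta_2(H)$ is the minimum of $d_H(S)$ over all $2$-element subsets $S\subseteq V(H)$. $K^3(m)$ denotes the complete $3$-partite $3$-graph with three vertex classes each of size $m$ (edges: all triples meeting each class in exactly one vertex). For a $3$-graph $F$, an $F$-factor (perfect $F$-tiling) of $H$ is a collection of vertex-disjoint copies of $F$ in $H$ covering all vertices of $H$. -}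

module Defs where

open import Data.Nat using (ℕ; zero; suc; _+_; _*_; _∸_; _^_; _≤_)
open import Data.Bool using (Bool; true; false; if_then_else_)
open import Data.Fin using (Fin) renaming (zero to f0; suc to fs)
open import Data.List using (List; map; allFin)
open import Data.Nat.ListAction using (sum)
open import Data.Product using (Σ; ∃; _×_; _,_)
open import Relation.Binary.PropositionalEquality using (_≡_; _≢_)

-- A 3-graph on vertex set Fin n.  edge x y z = true iff {x,y,z} is an edge.
-- The predicate is symmetric and false on degenerate triples, so it encodes
-- exactly a set of 3-element subsets of Fin n.
record ThreeGraph (n : ℕ) : Set where
  field
    edge   : Fin n → Fin n → Fin n → Bool
    sym₁₂  : ∀ x y z → edge x y z ≡ edge y x z
    sym₂₃  : ∀ x y z → edge x y z ≡ edge x z y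
    degen  : ∀ x z → edge x x z ≡ false
open ThreeGraph public

codeg : ∀ {n} → ThreeGraph n → Fin n → Fin n → ℕ
codeg {n} H x y = sum (map (λ z → if edge H x y z then 1 else 0) (allFin n))

MinCodegAtLeast : ∀ {n} → ThreeGraph n → ℕ → Set
MinCodegAtLeast {n} H d = ∀ (x y : Fin n) → x ≢ y → d ≤ codeg H x y

-- The real inequality  δ₂(H) ≥ n/2 + m^{1/m} n^{1-1/m}, cleared of roots:
-- every pair has codegree d with 2d ≥ n and (2d - n)^m ≥ 2^m · m · n^(m-1).
CodegCondition : ∀ {n} → ℕ → ThreeGraph n → Set
CodegCondition {n} m H = ∀ (x y : Fin n) → x ≢ y →
  (n ≤ 2 * codeg H x y) × (2 ^ m * m * n ^ (m ∸ 1) ≤ (2 * codeg H x y ∸ n) ^ m)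

c0 c1 c2 : Fin 3
c0 = f0
c1 = fs f0
c2 = fs (fs f0)

-- A K³(m)-factor: k copies φ i : Fin 3 → Fin m → Fin n of K³(m) (each a
-- subgraph copy: every transversal triple is an edge), jointly injective
-- (vertex-disjoint copies, each embedded injectively) and covering V(H).
HasK3Factor : ∀ {n} → ℕ → ThreeGraph n → Set
HasK3Factor {n} m H =
  Σ ℕ λ k → Σ (Fin k → Fin 3 → Fin m → Fin n) λ φ →
    (∀ i c a j c' a' → φ i c a ≡ φ j c' a' → (i ≡ j) × (c ≡ c') × (a ≡ a'))
    × (∀ v → ∃ λ i → ∃ λ c → ∃ λ a → φ i c a ≡ v)
    × (∀ i a b c → edge H (φ i c0 a) (φ i c1 b) (φ i c2 c) ≡ true)

{-# OPTIONS --safe #-}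
module Submission where

-- Link graphs: D x y counts the pairs p q such that x p q and y p q are both edges.  Since each pair has
-- codegree at least n/2, among any three vertices two share a positive proportion of their links, and such
-- vertices can be exchanged in tiles.  Chains of three exchanges either join all pairs of vertices with positive
-- density, or split V into two classes A, B, closed under exchange, with almost disjoint links; in the second
-- case, up to swapping the classes, almost all triples are edges exactly if they meet B in an even number of
-- vertices, and |A|, |B| ≈ n/2.
--
-- Absorption: a unit is an edge together with chains from its vertices to given target vertices, all blown up by
-- the box lemma.  Choosing units greedily, O(log n) of them absorb every possible 3m-tuple (of class pattern AAA
-- or ABB), so a bounded number of rounds absorbs any bounded set of vertices.
--
-- A maximum tiling of the remaining vertices misses only boundedly many: let U be the uncovered set, and call a
-- covered vertex good if its link in U is dense.  On average more than m of the 3m vertices of a tile are good,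
-- so many tiles have m + 1 good vertices, and by the box lemma m such tiles can be replaced by m + 1 tiles, each
-- taking one good vertex from every old tile and 2m vertices from U.
--
-- In the two-class case the number of B-vertices left over must become divisible by 2m.  Let Z be the class with
-- at most n/2 vertices.  A pair in A × Z has d ≈ m^(1/m) n^(1-1/m) neighbours outside Z, and nearly all of Z is
-- in its neighbourhood, so the Kővári–Sós–Turán argument gives tiles with 1 or 2m - 1 vertices in B.  Reserve 2m
-- of them and take apart as many as the residue requires.

open import Defs
open import Data.Nat
open import Data.Nat.Properties
open import Algebra.Properties.CommutativeSemigroup *-commutativeSemigroup using () renaming (x∙yz≈y∙xz to *-exchange)
open import Data.Nat.Tactic.RingSolver using (solve-∀)
open import Data.Nat.DivMod using (_/_; _%_; m≡m%n+[m/n]*n; m%n<n)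
open import Data.Nat.Divisibility using (_∣_; divides; ∣m+n∣m⇒∣n)
open import Data.Nat.ListAction using (sum)
open import Data.Bool using (Bool; true; false; if_then_else_; _∧_; _∨_; not; _xor_; T)
open import Data.Bool.ListAction using (all)
open import Data.Bool.Properties using (xor-comm; not-involutive; not-injective)
open import Data.Bool.Solver using (module xor-∧-Solver)
open import Data.Fin using (Fin) renaming (_≟_ to _≟ᶠ_)
open import Data.Fin.Properties using (all?; ¬∀⟶∃¬)
open import Data.List using (List; []; _∷_; map; length; _++_; concat; filterᵇ; cartesianProduct; allFin; take; drop; lookup)
open import Data.List.Properties using (length-++; length-map; map-cong; map-∘; ++-assoc; take++drop≡id; length-take; length-tabulate; map-id; ++-identityʳ)
open import Data.List.Membership.Propositional using (_∈_)
open import Data.List.Membership.Propositional.Properties using (∈-∃++; ∈-++⁺ˡ; ∈-++⁺ʳ; ∈-++⁻; ∈-map⁺; ∈-map⁻; ∈-allFin; ∈-lookup; ∈-cartesianProduct⁺; ∈-cartesianProduct⁻)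
open import Data.List.Relation.Unary.Any using (here; there; index)
open import Data.List.Relation.Unary.Any.Properties using (lookup-index)
open import Data.List.Relation.Unary.All as All using (All; []; _∷_)
open import Data.List.Relation.Unary.All.Properties as AllP using ()
open import Data.List.Relation.Unary.Unique.Propositional using (Unique)
open import Data.List.Relation.Unary.AllPairs using ([]; _∷_)
open import Data.List.Relation.Unary.Unique.Propositional.Properties using (allFin⁺)
open import Data.List.Relation.Binary.Permutation.Propositional using (_↭_; prep; swap; ↭-sym; ↭-reflexive; module PermutationReasoning) renaming (refl to prefl; trans to ptrans)
open import Data.List.Relation.Binary.Permutation.Propositional.Properties using (↭-length; ∈-resp-↭; All-resp-↭; shift; ++⁺; ++⁺ˡ; ++⁺ʳ; ++-comm; ++-commutativeMonoid)
open import Data.Product using (Σ; ∃; _×_; _,_; proj₁; proj₂)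
open import Data.Sum using (_⊎_; inj₁; inj₂)
open import Data.Unit using (⊤; tt)
open import Data.Empty using (⊥; ⊥-elim)
open import Function using (_∘_; id)
open import Relation.Nullary using (¬_; Dec; yes; no; does)
open import Relation.Binary.PropositionalEquality

-- The obstacle is parity. If the edges are exactly the triples meeting B in an even number of
-- vertices, then two vertices in the same part of a tile lie in the same class, so every tile has 0
-- or 2m vertices in B, and exchanges inside the classes never change |B| modulo 2m. The term
-- m^(1/m) n^(1-1/m) enters only to build tiles that break this pattern. The residue to be corrected
-- is known only after the almost perfect tiling, so the correcting tiles are set aside before
-- anything else.
--
-- Two classes arise because among any three vertices two have links that overlap well. If few
-- chains join a and b, the vertices far from b therefore overlap pairwise, and so do those far from
-- a; these two sets are the cores of the classes.
--
-- Parity arises because almost disjoint links across the classes push the neighbourhood of a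
-- typical pair into one class. The edge indicator, corrected by the classes of its three vertices,
-- is then nearly a function of two of three symmetric arguments, hence nearly constant.

private variable
  A B C : Set

-- A certificate for linear arithmetic: l ≤ r combines the hypotheses, and the equation is a semiring identity.
by-slack : ∀ {l r L R} s → l ≤ r → L + r + s ≡ R + l → L ≤ R
by-slack {l} {r} {L} {R} s l≤r eq = +-cancelʳ-≤ r L R (begin
  L + r      ≤⟨ m≤m+n (L + r) s ⟩
  L + r + s  ≡⟨ eq ⟩
  R + l      ≤⟨ +-monoʳ-≤ R l≤r ⟩
  R + r      ∎)
  where open ≤-Reasoning

-- Sums and counts over lists

⟦_⟧ : Bool → ℕ
⟦ b ⟧ = if b then 1 else 0

∑ : List A → (A → ℕ) → ℕ
∑ xs f = sum (map f xs)

∑-mono∈ : (xs : List A) {f g : A → ℕ} → (∀ {x} → x ∈ xs → f x ≤ g x) → ∑ xs f ≤ ∑ xs g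
∑-mono∈ []       h = z≤n
∑-mono∈ (x ∷ xs) h = +-mono-≤ (h (here refl)) (∑-mono∈ xs (h ∘ there))

∑-mono : (xs : List A) {f g : A → ℕ} → (∀ x → f x ≤ g x) → ∑ xs f ≤ ∑ xs g
∑-mono xs h = ∑-mono∈ xs (λ {x} _ → h x)

∑-cong : (xs : List A) {f g : A → ℕ} → (∀ x → f x ≡ g x) → ∑ xs f ≡ ∑ xs g
∑-cong xs h = cong sum (map-cong h xs)

∑-+ : (xs : List A) (f g : A → ℕ) → ∑ xs (λ x → f x + g x) ≡ ∑ xs f + ∑ xs g
∑-+ []       f g = refl
∑-+ (x ∷ xs) f g = trans (cong (f x + g x +_) (∑-+ xs f g)) (shuffle (f x) (g x) _ _)
  where
  shuffle : ∀ a b c d → a + b + (c + d) ≡ a + c + (b + d)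
  shuffle = solve-∀

∑-*ˡ : (xs : List A) (k : ℕ) (f : A → ℕ) → ∑ xs (λ x → k * f x) ≡ k * ∑ xs f
∑-*ˡ []       k f = sym (*-zeroʳ k)
∑-*ˡ (x ∷ xs) k f = trans (cong (k * f x +_) (∑-*ˡ xs k f)) (sym (*-distribˡ-+ k (f x) _))

∑-*ʳ : (xs : List A) (k : ℕ) (f : A → ℕ) → ∑ xs (λ x → f x * k) ≡ ∑ xs f * k
∑-*ʳ xs k f = trans (∑-cong xs (λ x → *-comm (f x) k)) (trans (∑-*ˡ xs k f) (*-comm k _))

∑-const : (xs : List A) (k : ℕ) → ∑ xs (λ _ → k) ≡ length xs * k
∑-const []       k = refl
∑-const (x ∷ xs) k = cong (k +_) (∑-const xs k)

∑-≤const : (xs : List A) {f : A → ℕ} (k : ℕ) → (∀ x → f x ≤ k) → ∑ xs f ≤ length xs * k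
∑-≤const xs k h = ≤-trans (∑-mono xs h) (≤-reflexive (∑-const xs k))

∑-≥const : (xs : List A) {f : A → ℕ} (k : ℕ) → (∀ x → k ≤ f x) → length xs * k ≤ ∑ xs f
∑-≥const xs k h = ≤-trans (≤-reflexive (sym (∑-const xs k))) (∑-mono xs h)

∑-swap : (xs : List A) (ys : List B) (f : A → B → ℕ) →
         ∑ xs (λ x → ∑ ys (f x)) ≡ ∑ ys (λ y → ∑ xs (λ x → f x y))
∑-swap []       ys f = sym (trans (∑-const ys 0) (*-zeroʳ (length ys)))
∑-swap (x ∷ xs) ys f = trans (cong (∑ ys (f x) +_) (∑-swap xs ys f)) (sym (∑-+ ys (f x) _))

∑-++ : (xs ys : List A) (f : A → ℕ) → ∑ (xs ++ ys) f ≡ ∑ xs f + ∑ ys f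
∑-++ []       ys f = refl
∑-++ (x ∷ xs) ys f = trans (cong (f x +_) (∑-++ xs ys f)) (sym (+-assoc (f x) _ _))

∑-↭ : {xs ys : List A} (f : A → ℕ) → xs ↭ ys → ∑ xs f ≡ ∑ ys f
∑-↭ f prefl = refl
∑-↭ f (prep x p) = cong (f x +_) (∑-↭ f p)
∑-↭ f (swap x y p) = trans (cong (λ s → f x + (f y + s)) (∑-↭ f p)) (exch (f x) (f y) _)
  where
  exch : ∀ a b c → a + (b + c) ≡ b + (a + c)
  exch = solve-∀
∑-↭ f (ptrans p q) = trans (∑-↭ f p) (∑-↭ f q)

∑-map : (g : A → B) (xs : List A) (f : B → ℕ) → ∑ (map g xs) f ≡ ∑ xs (f ∘ g)
∑-map g xs f = cong sum (sym (map-∘ xs))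

∑-concat : (xss : List (List A)) (f : A → ℕ) → ∑ (concat xss) f ≡ ∑ xss (λ xs → ∑ xs f)
∑-concat []         f = refl
∑-concat (xs ∷ xss) f = trans (∑-++ xs (concat xss) f) (cong (∑ xs f +_) (∑-concat xss f))

∑-product : (xs : List A) (ys : List B) (f : A × B → ℕ) →
            ∑ (cartesianProduct xs ys) f ≡ ∑ xs (λ x → ∑ ys (λ y → f (x , y)))
∑-product []       ys f = refl
∑-product (x ∷ xs) ys f = trans (∑-++ (map (x ,_) ys) _ f)
                          (cong₂ _+_ (∑-map (x ,_) ys f) (∑-product xs ys f))

∑-filter : (p : A → Bool) (xs : List A) (f : A → ℕ) → ∑ (filterᵇ p xs) f ≡ ∑ xs (λ x → ⟦ p x ⟧ * f x)
∑-filter p []       f = refl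
∑-filter p (x ∷ xs) f with p x
... | true  = cong₂ _+_ (sym (+-identityʳ (f x))) (∑-filter p xs f)
... | false = ∑-filter p xs f

∑-1 : (xs : List A) → ∑ xs (λ _ → 1) ≡ length xs
∑-1 xs = trans (∑-const xs 1) (*-identityʳ _)

length-filter : (p : A → Bool) (xs : List A) → length (filterᵇ p xs) ≡ ∑ xs (λ x → ⟦ p x ⟧)
length-filter p xs = trans (sym (∑-1 (filterᵇ p xs))) (trans (∑-filter p xs _) (∑-cong xs (λ x → *-identityʳ _)))

length-product : (xs : List A) (ys : List B) → length (cartesianProduct xs ys) ≡ length xs * length ys
length-product xs ys = trans (sym (∑-1 (cartesianProduct xs ys)))
  (trans (∑-product xs ys _) (trans (∑-cong xs (λ _ → ∑-1 ys)) (∑-const xs (length ys))))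

∑-avg : (xs : List A) (f : A → ℕ) → 1 ≤ length xs → ∃ λ x → x ∈ xs × ∑ xs f ≤ length xs * f x
∑-avg (x ∷ [])     f _ = x , here refl , ≤-refl
∑-avg (x ∷ y ∷ ys) f _ with ∑-avg (y ∷ ys) f (s≤s z≤n)
... | z , z∈ , h with ≤-total (f x) (f z)
...   | inj₁ fx≤fz = z , there z∈ , +-mono-≤ fx≤fz h
...   | inj₂ fz≤fx = x , here refl , +-monoʳ-≤ (f x) (≤-trans h (*-monoʳ-≤ (suc (length ys)) fz≤fx))

filter-∈ : (p : A → Bool) (xs : List A) {x : A} → x ∈ filterᵇ p xs → x ∈ xs × p x ≡ true
filter-∈ p (y ∷ xs) x∈ with p y in eq
filter-∈ p (y ∷ xs) (here refl) | true = here refl , eq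
filter-∈ p (y ∷ xs) (there x∈)  | true = let (q , r) = filter-∈ p xs x∈ in there q , r
filter-∈ p (y ∷ xs) x∈          | false = let (q , r) = filter-∈ p xs x∈ in there q , r

filter-split : (p : A → Bool) (xs : List A) → xs ↭ filterᵇ p xs ++ filterᵇ (not ∘ p) xs
filter-split p [] = prefl
filter-split p (x ∷ xs) with p x
... | true  = prep x (filter-split p xs)
... | false = ptrans (prep x (filter-split p xs)) (↭-sym (shift x (filterᵇ p xs) _))

pick : {x : A} {xs : List A} → x ∈ xs → ∃ λ ys → xs ↭ x ∷ ys
pick {x = x} x∈ with ∈-∃++ x∈
... | as , bs , refl = as ++ bs , shift x as bs

⟦∧⟧ : ∀ a b → ⟦ a ∧ b ⟧ ≡ ⟦ a ⟧ * ⟦ b ⟧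
⟦∧⟧ true  b = sym (+-identityʳ _)
⟦∧⟧ false b = refl

⟦⟧≤1 : ∀ a → ⟦ a ⟧ ≤ 1
⟦⟧≤1 true  = ≤-refl
⟦⟧≤1 false = z≤n

count≤length : (xs : List A) (p : A → Bool) → ∑ xs (λ x → ⟦ p x ⟧) ≤ length xs
count≤length xs p = ≤-trans (∑-≤const xs 1 (λ x → ⟦⟧≤1 (p x))) (≤-reflexive (*-identityʳ _))

-- Power means

rearrange : ∀ t a b → a * b ^ t + b * a ^ t ≤ a * a ^ t + b * b ^ t
rearrange t a b with ≤-total a b
... | inj₁ a≤b = go a b a≤b
  where
  go : ∀ a b → a ≤ b → a * b ^ t + b * a ^ t ≤ a * a ^ t + b * b ^ t
  go a b a≤b with m≤n⇒∃[o]m+o≡n a≤b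
  ... | d , refl = by-slack 0 (*-monoʳ-≤ d (^-monoˡ-≤ t a≤b)) (ident a d (a ^ t) ((a + d) ^ t))
    where
    ident : ∀ a d x y → a * y + (a + d) * x + d * y + 0 ≡ a * x + (a + d) * y + d * x
    ident = solve-∀
... | inj₂ b≤a with m≤n⇒∃[o]m+o≡n b≤a
...   | d , refl = by-slack 0 (*-monoʳ-≤ d (^-monoˡ-≤ t b≤a)) (ident b d (b ^ t) ((b + d) ^ t))
    where
    ident : ∀ a d x y → (a + d) * x + a * y + d * y + 0 ≡ (a + d) * y + a * x + d * x
    ident = solve-∀

-- The rearrangement inequality summed over all pairs.
chebyshev : ∀ t (xs : List A) f → ∑ xs f * ∑ xs (λ x → f x ^ t) ≤ length xs * ∑ xs (λ x → f x ^ suc t)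
chebyshev t xs f = *-cancelˡ-≤ 2 (begin
  2 * (∑ xs f * ∑ xs ft)
    ≡⟨ dbl (∑ xs f * ∑ xs ft) ⟩
  ∑ xs f * ∑ xs ft + ∑ xs f * ∑ xs ft
    ≡⟨ cong₂ _+_ (sym (trans (∑-cong xs (λ x → ∑-*ˡ xs (f x) ft)) (∑-*ʳ xs (∑ xs ft) f)))
                 (trans (*-comm (∑ xs f) (∑ xs ft)) (sym (trans (∑-cong xs (λ x → ∑-*ʳ xs (ft x) f))
                    (trans (∑-*ˡ xs (∑ xs f) ft) (*-comm (∑ xs f) _))))) ⟩
  ∑ xs (λ x → ∑ xs (λ y → f x * ft y)) + ∑ xs (λ x → ∑ xs (λ y → f y * ft x))
    ≡⟨ sym (trans (∑-cong xs (λ x → ∑-+ xs _ _)) (∑-+ xs _ _)) ⟩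
  ∑ xs (λ x → ∑ xs (λ y → f x * ft y + f y * ft x))
    ≤⟨ ∑-mono xs (λ x → ∑-mono xs (λ y → rearrange t (f x) (f y))) ⟩
  ∑ xs (λ x → ∑ xs (λ y → f x * ft x + f y * ft y))
    ≡⟨ trans (∑-cong xs (λ x → trans (∑-+ xs _ _) (cong (_+ S) (∑-const xs (f x * ft x))))) (∑-+ xs _ _) ⟩
  ∑ xs (λ x → length xs * (f x * ft x)) + ∑ xs (λ x → S)
    ≡⟨ cong₂ _+_ (∑-*ˡ xs (length xs) _) (∑-const xs S) ⟩
  length xs * S + length xs * S
    ≡⟨ sym (dbl (length xs * S)) ⟩
  2 * (length xs * S) ∎)
  where
  open ≤-Reasoning
  ft = λ x → f x ^ t
  S = ∑ xs (λ x → f x ^ suc t)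
  dbl : ∀ a → 2 * a ≡ a + a
  dbl = solve-∀

-- Each step of the induction trades one factor `∑ xs f` for a factor `length xs` by `chebyshev`.
power-mean : ∀ t (xs : List A) f → ∑ xs f ^ suc t ≤ length xs ^ t * ∑ xs (λ x → f x ^ suc t)
power-mean zero xs f = ≤-reflexive (trans (*-identityʳ _)
  (trans (∑-cong xs (λ x → sym (*-identityʳ (f x)))) (sym (+-identityʳ _))))
power-mean (suc t) xs f = begin
  ∑ xs f * ∑ xs f ^ suc t                               ≤⟨ *-monoʳ-≤ (∑ xs f) (power-mean t xs f) ⟩
  ∑ xs f * (N ^ t * ∑ xs (λ x → f x ^ suc t))           ≡⟨ *-exchange (∑ xs f) (N ^ t) _ ⟩
  N ^ t * (∑ xs f * ∑ xs (λ x → f x ^ suc t))           ≤⟨ *-monoʳ-≤ (N ^ t) (chebyshev (suc t) xs f) ⟩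
  N ^ t * (N * ∑ xs (λ x → f x ^ suc (suc t)))          ≡⟨ assoc N (N ^ t) _ ⟩
  N * N ^ t * ∑ xs (λ x → f x ^ suc (suc t))            ∎
  where
  open ≤-Reasoning
  N = length xs
  assoc : ∀ a b c → b * (a * c) ≡ a * b * c
  assoc = solve-∀

-- Choosing sets with many common neighbours

∑-∸ : (xs : List A) (f : A → ℕ) (d : ℕ) → ∑ xs f ≤ ∑ xs (λ x → f x ∸ d) + length xs * d
∑-∸ xs f d = ≤-trans (∑-mono xs (λ x → ≤-trans (m≤n+m∸n (f x) d) (≤-reflexive (+-comm d _))))
  (≤-reflexive (trans (∑-+ xs _ _) (cong (∑ xs (λ x → f x ∸ d) +_) (∑-const xs d))))

-- X ↭ S ++ R says that the elements of S sit at distinct positions of X.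
select : ∀ k (X : List A) (Y : List B) (E : A → B → Bool) → k ≤ length X →
  Σ (List A) λ S → Σ (List A) λ R → X ↭ S ++ R × length S ≡ k ×
  ∑ Y (λ y → (∑ X (λ x → ⟦ E x y ⟧) ∸ k) ^ k) ≤ length X ^ k * ∑ Y (λ y → ⟦ all (λ x → E x y) S ⟧)
select zero X Y E _ = [] , X , prefl , refl , ≤-reflexive (sym (+-identityʳ _))
-- One element x of `S` is chosen by averaging, each neighbour y of x being weighted by
-- `(deg y ∸ suc k) ^ k`. Deleting x from `X` lowers the degree of such a y by exactly one, and this
-- is what the change of offset from `suc k` to `k` pays for.
select {A} {B} (suc k) X Y E k<X with ∑-avg X (λ x → ∑ Y (λ y → ⟦ E x y ⟧ * (∑ X (λ x → ⟦ E x y ⟧) ∸ suc k) ^ k)) (≤-trans (s≤s z≤n) k<X)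
... | x , x∈ , avg with pick x∈
...   | X′ , X↭ with select k X′ (filterᵇ (E x) Y) E (≤-pred (≤-trans k<X (≤-reflexive (↭-length X↭))))
...     | S , R , X′↭ , lS , IH = x ∷ S , R , ptrans X↭ (prep x X′↭) , cong suc lS , (begin
  ∑ Y (λ y → (deg y ∸ suc k) * (deg y ∸ suc k) ^ k)
    ≤⟨ ∑-mono Y (λ y → *-monoˡ-≤ ((deg y ∸ suc k) ^ k) (m∸n≤m (deg y) (suc k))) ⟩
  ∑ Y (λ y → deg y * (deg y ∸ suc k) ^ k)
    ≡⟨ ∑-cong Y (λ y → sym (∑-*ʳ X ((deg y ∸ suc k) ^ k) (λ x → ⟦ E x y ⟧))) ⟩
  ∑ Y (λ y → ∑ X (λ x → ⟦ E x y ⟧ * (deg y ∸ suc k) ^ k))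
    ≡⟨ ∑-swap Y X _ ⟩
  ∑ X (λ x → ∑ Y (λ y → ⟦ E x y ⟧ * (deg y ∸ suc k) ^ k))
    ≤⟨ avg ⟩
  N * ∑ Y (λ y → ⟦ E x y ⟧ * (deg y ∸ suc k) ^ k)
    ≡⟨ cong (N *_) (sym (∑-filter (E x) Y _)) ⟩
  N * ∑ (filterᵇ (E x) Y) (λ y → (deg y ∸ suc k) ^ k)
    ≤⟨ *-monoʳ-≤ N (∑-mono∈ (filterᵇ (E x) Y) (λ {y} y∈ → ^-monoˡ-≤ k (dropped y (proj₂ (filter-∈ (E x) Y y∈))))) ⟩
  N * ∑ (filterᵇ (E x) Y) (λ y → (∑ X′ (λ x → ⟦ E x y ⟧) ∸ k) ^ k)
    ≤⟨ *-monoʳ-≤ N IH ⟩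
  N * (length X′ ^ k * ∑ (filterᵇ (E x) Y) (λ y → ⟦ all (λ x → E x y) S ⟧))
    ≤⟨ *-monoʳ-≤ N (*-monoˡ-≤ (∑ (filterᵇ (E x) Y) (λ y → ⟦ all (λ x → E x y) S ⟧))
         (^-monoˡ-≤ k (≤-trans (n≤1+n _) (≤-reflexive (sym (↭-length X↭)))))) ⟩
  N * (N ^ k * ∑ (filterᵇ (E x) Y) (λ y → ⟦ all (λ x → E x y) S ⟧))
    ≡⟨ sym (*-assoc N (N ^ k) _) ⟩
  N * N ^ k * ∑ (filterᵇ (E x) Y) (λ y → ⟦ all (λ x → E x y) S ⟧)
    ≡⟨ cong (N * N ^ k *_) (trans (∑-filter (E x) Y _) (∑-cong Y (λ y → sym (⟦∧⟧ (E x y) _)))) ⟩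
  N * N ^ k * ∑ Y (λ y → ⟦ all (λ x → E x y) (x ∷ S) ⟧) ∎)
  where
  open ≤-Reasoning
  N = length X
  deg : B → ℕ
  deg y = ∑ X (λ x → ⟦ E x y ⟧)
  dropped : ∀ y → E x y ≡ true → deg y ∸ suc k ≤ ∑ X′ (λ x → ⟦ E x y ⟧) ∸ k
  dropped y e = ≤-reflexive (cong (_∸ suc k) (trans (∑-↭ (λ x → ⟦ E x y ⟧) X↭) (cong (λ b → ⟦ b ⟧ + ∑ X′ (λ x → ⟦ E x y ⟧)) e)))

∧-true : ∀ {a b} → a ∧ b ≡ true → a ≡ true × b ≡ true
∧-true {true} e = refl , e

all-∈ : (p : A → Bool) (xs : List A) → all p xs ≡ true → ∀ {x} → x ∈ xs → p x ≡ true
all-∈ p (x ∷ xs) e (here refl) = proj₁ (∧-true e)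
all-∈ p (x ∷ xs) e (there x∈)  = all-∈ p xs (proj₂ (∧-true {p x} e)) x∈

^-distribʳ : ∀ k a b → (a * b) ^ k ≡ a ^ k * b ^ k
^-distribʳ zero a b = refl
^-distribʳ (suc k) a b = trans (cong (a * b *_) (^-distribʳ k a b)) (exch a b (a ^ k) (b ^ k))
  where
  exch : ∀ a b c d → a * b * (c * d) ≡ a * c * (b * d)
  exch = solve-∀

≤-cancel-^ : ∀ t N {a b} → 1 ≤ N → N ^ t * a ≤ N ^ t * b → a ≤ b
≤-cancel-^ t (suc N) {a} {b} _ h = *-cancelˡ-≤ (suc N ^ t) {{m^n≢0 (suc N) t}} h

-- Lowering every degree by d costs at most half of the total, since d is at most `length X` divided
-- by 2c.
dense-degrees : ∀ c d (X : List A) (Y : List B) (f : B → ℕ) → 2 * c * d ≤ length X →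
                length X * length Y ≤ c * ∑ Y f → length X * length Y ≤ 2 * c * ∑ Y (λ y → f y ∸ d)
dense-degrees c d X Y f d≤ h = by-slack 0
  (+-mono-≤ (*-monoʳ-≤ 2 h) (+-mono-≤ (*-monoʳ-≤ (2 * c) (∑-∸ Y f d)) (*-monoˡ-≤ (length Y) d≤)))
  (ident (length X) (length Y) c d (∑ Y f) (∑ Y (λ y → f y ∸ d)))
  where
  ident : ∀ x y c d s g → x * y + (2 * (c * s) + (2 * c * (g + y * d) + x * y)) + 0
        ≡ 2 * c * g + (2 * (x * y) + (2 * c * s + 2 * c * d * y))
  ident = solve-∀

∑-power-≥ : ∀ k N c (Y : List B) (g : B → ℕ) → N * length Y ≤ c * ∑ Y g →
            N ^ suc k * length Y ≤ c ^ suc k * ∑ Y (λ y → g y ^ suc k)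
∑-power-≥ k N c []       g h = ≤-trans (≤-reflexive (*-zeroʳ (N ^ suc k))) z≤n
∑-power-≥ k N c Y@(_ ∷ _) g h = ≤-cancel-^ k (length Y) (s≤s z≤n) (begin
  M ^ k * (N ^ suc k * M)                    ≡⟨ exch (M ^ k) (N ^ suc k) M ⟩
  N ^ suc k * M ^ suc k                      ≡⟨ sym (^-distribʳ (suc k) N M) ⟩
  (N * M) ^ suc k                            ≤⟨ ^-monoˡ-≤ (suc k) h ⟩
  (c * ∑ Y g) ^ suc k                        ≡⟨ ^-distribʳ (suc k) c (∑ Y g) ⟩
  c ^ suc k * ∑ Y g ^ suc k                  ≤⟨ *-monoʳ-≤ (c ^ suc k) (power-mean k Y g) ⟩
  c ^ suc k * (M ^ k * ∑ Y (λ y → g y ^ suc k)) ≡⟨ *-exchange (c ^ suc k) (M ^ k) _ ⟩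
  M ^ k * (c ^ suc k * ∑ Y (λ y → g y ^ suc k)) ∎)
  where
  open ≤-Reasoning
  M = length Y
  exch : ∀ a b m → a * (b * m) ≡ b * (m * a)
  exch = solve-∀

Selected : ℕ → ℕ → List A → List B → (A → B → Bool) → Set _
Selected {A} k d rest Y E = Σ (List A) λ S → Σ (List A) λ R → rest ↭ S ++ R × length S ≡ suc k ×
  length Y ≤ d * ∑ Y (λ y → ⟦ all (λ x → E x y) S ⟧)

-- Used elements lower each degree by at most `length used`, and the offset in `select` lowers it by
-- `suc k` more. Halving the density pays for both, so that density may always be measured against
-- the full list `X`, whatever has been used up.
select-dense : ∀ k c (X used rest : List A) (Y : List B) (E : A → B → Bool) → X ↭ used ++ rest →
  2 * suc c * (length used + suc k) ≤ length X →
  length X * length Y ≤ suc c * ∑ X (λ x → ∑ Y (λ y → ⟦ E x y ⟧)) →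
  Selected k ((2 * suc c) ^ suc k) rest Y E
select-dense {A} {B} k c X used rest Y E X↭ big dense = finish (select (suc k) rest Y E k<rest)
  where
  open ≤-Reasoning
  N = length X
  N≡ : N ≡ length used + length rest
  N≡ = trans (↭-length X↭) (length-++ used)
  expand : ∀ c d → d + (1 + 2 * c) * d ≡ 2 * suc c * d
  expand = solve-∀
  k<rest : suc k ≤ length rest
  k<rest = +-cancelˡ-≤ (length used) _ _ (≤-trans (≤-trans (m≤m+n _ _)
             (≤-reflexive (expand c (length used + suc k)))) (≤-trans big (≤-reflexive N≡)))
  rest≤N : length rest ≤ N
  rest≤N = ≤-trans (m≤n+m _ (length used)) (≤-reflexive (sym N≡))
  degX degR : B → ℕ
  degX y = ∑ X (λ x → ⟦ E x y ⟧)
  degR y = ∑ rest (λ x → ⟦ E x y ⟧)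
  degX≤ : ∀ y → degX y ∸ length used ≤ degR y
  degX≤ y = begin
    degX y ∸ length used               ≡⟨ cong (_∸ length used) (trans (∑-↭ (λ x → ⟦ E x y ⟧) X↭) (∑-++ used rest (λ x → ⟦ E x y ⟧))) ⟩
    ∑ used (λ x → ⟦ E x y ⟧) + degR y ∸ length used
      ≤⟨ ∸-monoˡ-≤ (length used) (+-monoˡ-≤ (degR y) (count≤length used (λ x → E x y))) ⟩
    length used + degR y ∸ length used ≡⟨ m+n∸m≡n (length used) (degR y) ⟩
    degR y ∎
  deg-≤ : ∀ y → degX y ∸ (length used + suc k) ≤ degR y ∸ suc k
  deg-≤ y = ≤-trans (≤-reflexive (sym (∸-+-assoc (degX y) (length used) (suc k)))) (∸-monoˡ-≤ (suc k) (degX≤ y))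
  sums : N ^ suc k * length Y ≤ (2 * suc c) ^ suc k * ∑ Y (λ y → (degR y ∸ suc k) ^ suc k)
  sums = ∑-power-≥ k N (2 * suc c) Y (λ y → degR y ∸ suc k)
    (≤-trans (dense-degrees (suc c) (length used + suc k) X Y degX big
        (≤-trans dense (*-monoʳ-≤ (suc c) (≤-reflexive (∑-swap X Y (λ x y → ⟦ E x y ⟧))))))
      (*-monoʳ-≤ (2 * suc c) (∑-mono Y deg-≤)))
  finish : (Σ (List A) λ S → Σ (List A) λ R → rest ↭ S ++ R × length S ≡ suc k ×
             ∑ Y (λ y → (degR y ∸ suc k) ^ suc k) ≤ length rest ^ suc k * ∑ Y (λ y → ⟦ all (λ x → E x y) S ⟧)) →
           Selected k ((2 * suc c) ^ suc k) rest Y E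
  finish (S , R , r↭ , lS , h) = S , R , r↭ , lS , ≤-cancel-^ (suc k) N (≤-trans (≤-trans (s≤s z≤n) k<rest) rest≤N) (begin
    N ^ suc k * length Y
      ≤⟨ sums ⟩
    D * ∑ Y (λ y → (degR y ∸ suc k) ^ suc k)
      ≤⟨ *-monoʳ-≤ D (≤-trans h (*-monoˡ-≤ cnt (^-monoˡ-≤ (suc k) rest≤N))) ⟩
    D * (N ^ suc k * cnt)
      ≡⟨ *-exchange D (N ^ suc k) cnt ⟩
    N ^ suc k * (D * cnt) ∎)
    where
    cnt = ∑ Y (λ y → ⟦ all (λ x → E x y) S ⟧)
    D = (2 * suc c) ^ suc k

-- Configurations and clones

infixr 5 _⊗_

-- A shape lists the coordinates of a configuration; the coordinate pt k is to be replaced by suc k clones.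
data Shape : Set where
  unit : Shape
  pt   : ℕ → Shape
  _⊗_  : Shape → Shape → Shape

Config : Shape → Set → Set
Config unit    A = ⊤
Config (pt _)  A = A
Config (s ⊗ t) A = Config s A × Config t A

dim clones : Shape → ℕ
dim unit    = 0
dim (pt _)  = 1
dim (s ⊗ t) = dim s + dim t
clones unit    = 0
clones (pt k)  = suc k
clones (s ⊗ t) = clones s + clones t

configs : ∀ s → List A → List (Config s A)
configs unit    X = tt ∷ []
configs (pt _)  X = X
configs (s ⊗ t) X = cartesianProduct (configs s X) (configs t X)

length-configs : ∀ s (X : List A) → length (configs s X) ≡ length X ^ dim s
length-configs unit    X = refl
length-configs (pt _)  X = sym (*-identityʳ _)
length-configs (s ⊗ t) X = trans (length-product (configs s X) (configs t X))
  (trans (cong₂ _*_ (length-configs s X) (length-configs t X)) (sym (^-distribˡ-+-* (length X) (dim s) (dim t))))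

flat : ∀ s → Config s (List A) → List A
flat unit    _       = []
flat (pt _)  l       = l
flat (s ⊗ t) (l , m) = flat s l ++ flat t m

Sized : ∀ s → Config s (List A) → Set
Sized unit    _       = ⊤
Sized (pt k)  l       = length l ≡ suc k
Sized (s ⊗ t) (l , m) = Sized s l × Sized t m

length-flat : ∀ s (l : Config s (List A)) → Sized s l → length (flat s l) ≡ clones s
length-flat unit    _       _       = refl
length-flat (pt _)  l       e       = e
length-flat (s ⊗ t) (l , m) (e , f) = trans (length-++ (flat s l)) (cong₂ _+_ (length-flat s l e) (length-flat t m f))

Choice : ∀ s → Config s A → Config s (List A) → Set
Choice unit    _       _       = ⊤
Choice (pt _)  x       l       = x ∈ l
Choice (s ⊗ t) (x , y) (l , m) = Choice s x l × Choice t y m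

-- The coordinates of `t` are quantified outermost because `box` clones `s` before `t`; the result
-- of its second call then has this form by definition.
allChoices : ∀ s → Config s (List A) → (Config s A → Bool) → Bool
allChoices unit    _       p = p tt
allChoices (pt _)  l       p = all p l
allChoices (s ⊗ t) (l , m) p = allChoices t m (λ y → allChoices s l (λ x → p (x , y)))

allChoices-∈ : ∀ s (l : Config s (List A)) p → allChoices s l p ≡ true → ∀ {x} → Choice s x l → p x ≡ true
allChoices-∈ unit    _       p e c       = e
allChoices-∈ (pt _)  l       p e c       = all-∈ p l e c
allChoices-∈ (s ⊗ t) (l , m) p e (c , d) = allChoices-∈ s l _ (allChoices-∈ t m _ e d) c

abstract
  -- Densities have the form 1 / suc c, so the loss is stored as a predecessor. It is opaque because
  -- its iterates along a shape are far too large to be evaluated.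
  loss₁ : ℕ → ℕ → ℕ
  loss₁ k c = pred ((2 * suc c) ^ suc k)

  need₁ : ℕ → ℕ
  need₁ c = 2 * suc c

  suc-loss₁ : ∀ k c → (2 * suc c) ^ suc k ≡ suc (loss₁ k c)
  suc-loss₁ k c = sym (suc-pred ((2 * suc c) ^ suc k) {{m^n≢0 (2 * suc c) (suc k)}})

  need₁≡ : ∀ c → 2 * suc c ≡ need₁ c
  need₁≡ c = refl

loss : Shape → ℕ → ℕ
loss unit    c = c
loss (pt k)  c = loss₁ k c
loss (s ⊗ t) c = loss t (loss s c)

need : Shape → ℕ → ℕ
need unit    c = 0
need (pt k)  c = need₁ c
need (s ⊗ t) c = need s c + need t (loss s c)

Boxed : ∀ s → ℕ → List A → List B → (Config s A → B → Bool) → Set _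
Boxed {A} s c rest Y E = Σ (Config s (List A)) λ l → Σ (List A) λ R → rest ↭ flat s l ++ R × Sized s l ×
  length Y ≤ suc (loss s c) * ∑ Y (λ y → ⟦ allChoices s l (λ x → E x y) ⟧)

box₁ : ∀ k c (X used rest : List A) (Y : List B) (E : A → B → Bool) → X ↭ used ++ rest →
  need₁ c * (length used + suc k) ≤ length X →
  length X ^ 1 * length Y ≤ suc c * ∑ X (λ x → ∑ Y (λ y → ⟦ E x y ⟧)) → Boxed (pt k) c rest Y E
box₁ k c X used rest Y E X↭ big dense = convert (select-dense k c X used rest Y E X↭
    (≤-trans (*-monoˡ-≤ (length used + suc k) (≤-reflexive (need₁≡ c))) big)
    (≤-trans (*-monoˡ-≤ (length Y) (≤-reflexive (sym (*-identityʳ (length X))))) dense))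
  where
  convert : Selected k ((2 * suc c) ^ suc k) rest Y E → Boxed (pt k) c rest Y E
  convert (S , R , r↭ , lS , h) = S , R , r↭ , lS ,
    ≤-trans h (*-monoˡ-≤ (∑ Y (λ y → ⟦ all (λ x → E x y) S ⟧)) (≤-reflexive (suc-loss₁ k c)))

-- Erdős's box lemma.  The density is 1 / suc c, and the clones avoid the entries of used.
box : ∀ s c (X used rest : List A) (Y : List B) (E : Config s A → B → Bool) → X ↭ used ++ rest →
  need s c * (length used + clones s) ≤ length X →
  length X ^ dim s * length Y ≤ suc c * ∑ (configs s X) (λ x → ∑ Y (λ y → ⟦ E x y ⟧)) →
  Boxed s c rest Y E
box unit c X used rest Y E X↭ big dense = tt , rest , prefl , tt ,
  ≤-trans (≤-reflexive (sym (+-identityʳ _))) (≤-trans dense (*-monoʳ-≤ (suc c) (≤-reflexive (+-identityʳ _))))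
box (pt k) c X used rest Y E X↭ big dense = box₁ k c X used rest Y E X↭ big dense
box {A} {B} (s ⊗ t) c X used rest Y E X↭ big dense = go₁ (box s c X used rest Y₁ E₁ X↭ big₁ dense₁)
  where
  open ≤-Reasoning
  -- While `s` is cloned, the coordinates of `t` count as part of the right-hand side. The density
  -- of the pairs that survive is the hypothesis needed to clone `t`.
  Y₁ : List (Config t A × B)
  Y₁ = cartesianProduct (configs t X) Y
  E₁ : Config s A → Config t A × B → Bool
  E₁ x (y , b) = E (x , y) b
  c′ = loss s c
  n₁ = need s c
  n₂ = need t c′
  u = length used
  big₁ : n₁ * (u + clones s) ≤ length X
  big₁ = ≤-trans (*-mono-≤ (m≤m+n n₁ n₂) (+-monoʳ-≤ u (m≤m+n (clones s) (clones t)))) big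
  dense₁ : length X ^ dim s * length Y₁ ≤ suc c * ∑ (configs s X) (λ x → ∑ Y₁ (λ y → ⟦ E₁ x y ⟧))
  dense₁ = begin
    length X ^ dim s * length Y₁
      ≡⟨ cong (length X ^ dim s *_) (trans (length-product (configs t X) Y) (cong (_* length Y) (length-configs t X))) ⟩
    length X ^ dim s * (length X ^ dim t * length Y)
      ≡⟨ sym (*-assoc (length X ^ dim s) _ _) ⟩
    length X ^ dim s * length X ^ dim t * length Y
      ≡⟨ cong (_* length Y) (sym (^-distribˡ-+-* (length X) (dim s) (dim t))) ⟩
    length X ^ (dim s + dim t) * length Y
      ≤⟨ dense ⟩
    suc c * ∑ (configs (s ⊗ t) X) (λ x → ∑ Y (λ y → ⟦ E x y ⟧))
      ≡⟨ cong (suc c *_) (trans (∑-product (configs s X) (configs t X) _)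
           (∑-cong (configs s X) (λ x → sym (∑-product (configs t X) Y _)))) ⟩
    suc c * ∑ (configs s X) (λ x → ∑ Y₁ (λ y → ⟦ E₁ x y ⟧)) ∎
  go₁ : Boxed s c rest Y₁ E₁ → Boxed (s ⊗ t) c rest Y E
  go₁ (l , R , r↭ , szl , h) = go₂ (box t c′ X (used ++ flat s l) R Y (λ y b → allChoices s l (λ x → E (x , y) b)) X↭′ big₂ dense₂)
    where
    X↭′ : X ↭ (used ++ flat s l) ++ R
    X↭′ = ptrans X↭ (ptrans (++⁺ˡ used r↭) (↭-reflexive (sym (++-assoc used (flat s l) R))))
    big₂ : n₂ * (length (used ++ flat s l) + clones t) ≤ length X
    big₂ = ≤-trans (*-mono-≤ (m≤n+m n₂ n₁) (≤-reflexive (trans (cong (_+ clones t)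
      (trans (length-++ used) (cong (u +_) (length-flat s l szl)))) (+-assoc u (clones s) (clones t))))) big
    dense₂ : length X ^ dim t * length Y ≤ suc c′ * ∑ (configs t X) (λ y → ∑ Y (λ b → ⟦ allChoices s l (λ x → E (x , y) b) ⟧))
    dense₂ = ≤-trans (≤-reflexive (sym (trans (length-product (configs t X) Y) (cong (_* length Y) (length-configs t X)))))
      (≤-trans h (*-monoʳ-≤ (suc c′) (≤-reflexive (∑-product (configs t X) Y _))))
    go₂ : Boxed t c′ R Y (λ y b → allChoices s l (λ x → E (x , y) b)) → Boxed (s ⊗ t) c rest Y E
    go₂ (m , R′ , r↭′ , szm , h′) = (l , m) , R′ ,
      ptrans r↭ (ptrans (++⁺ˡ (flat s l) r↭′) (↭-reflexive (sym (++-assoc (flat s l) (flat t m) R′)))) ,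
      (szl , szm) , h′

-- Rearranging lists and counting distinct vertices

length-allFin : ∀ n → length (allFin n) ≡ n
length-allFin n = length-tabulate {n = n} id

⟦≤ᵇ⟧ : ∀ a b → (a ≤ b × (a ≤ᵇ b) ≡ true) ⊎ (b ≤ a × (a ≤ᵇ b) ≡ false)
⟦≤ᵇ⟧ a b with a ≤ᵇ b in eq
... | true  = inj₁ (≤ᵇ⇒≤ a b (subst T (sym eq) tt) , refl)
... | false = inj₂ (<⇒≤ (≰⇒> (λ le → subst T eq (≤⇒≤ᵇ le))) , refl)

∑-sub : {X S R : List A} (f : A → ℕ) → X ↭ S ++ R → ∑ R f ≤ ∑ X f
∑-sub {S = S} {R} f p = ≤-trans (m≤n+m _ (∑ S f)) (≤-reflexive (sym (trans (∑-↭ f p) (∑-++ S R f))))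

length-concat : ∀ k (xss : List (List A)) → All (λ xs → length xs ≡ k) xss → length (concat xss) ≡ length xss * k
length-concat k []         []       = refl
length-concat k (xs ∷ xss) (e ∷ es) = trans (length-++ xs) (cong₂ _+_ e (length-concat k xss es))

concat-++ : (xss yss : List (List A)) → concat (xss ++ yss) ≡ concat xss ++ concat yss
concat-++ []         yss = refl
concat-++ (xs ∷ xss) yss = trans (cong (xs ++_) (concat-++ xss yss)) (sym (++-assoc xs (concat xss) (concat yss)))

concat-↭ : {xss yss : List (List A)} → xss ↭ yss → concat xss ↭ concat yss
concat-↭ prefl = prefl
concat-↭ (prep xs p) = ++⁺ˡ xs (concat-↭ p)
concat-↭ (swap {xss} {yss} xs ys p) = ptrans (↭-reflexive (sym (++-assoc xs ys (concat xss))))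
  (ptrans (++⁺ (++-comm xs ys) (concat-↭ p)) (↭-reflexive (++-assoc ys xs (concat yss))))
concat-↭ (ptrans p q) = ptrans (concat-↭ p) (concat-↭ q)

++-exchange : (a b c d : List A) → (a ++ b) ++ (c ++ d) ↭ (a ++ c) ++ (b ++ d)
++-exchange a b c d = begin
  (a ++ b) ++ (c ++ d) ≡⟨ ++-assoc a b (c ++ d) ⟩
  a ++ (b ++ (c ++ d)) ≡⟨ cong (a ++_) (sym (++-assoc b c d)) ⟩
  a ++ ((b ++ c) ++ d) ↭⟨ ++⁺ˡ a (++⁺ʳ d (++-comm b c)) ⟩
  a ++ ((c ++ b) ++ d) ≡⟨ cong (a ++_) (++-assoc c b d) ⟩
  a ++ (c ++ (b ++ d)) ≡⟨ sym (++-assoc a c (b ++ d)) ⟩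
  (a ++ c) ++ (b ++ d) ∎
  where open PermutationReasoning

concat-map-++ : (f g h : A → List B) (xs : List A) → (∀ {x} → x ∈ xs → f x ↭ g x ++ h x) →
                concat (map f xs) ↭ concat (map g xs) ++ concat (map h xs)
concat-map-++ f g h []       p = prefl
concat-map-++ f g h (x ∷ xs) p = ptrans (++⁺ (p (here refl)) (concat-map-++ f g h xs (p ∘ there)))
  (++-exchange (g x) (h x) (concat (map g xs)) (concat (map h xs)))

split-heads : ∀ k (rows : List (List A)) → All (λ r → length r ≡ suc k) rows →
  Σ (List A) λ hs → Σ (List (List A)) λ tls → length hs ≡ length rows × length tls ≡ length rows ×
  All (λ r → length r ≡ k) tls × concat rows ↭ hs ++ concat tls ×
  (∀ {x} → x ∈ hs → ∃ λ r → (x ∷ r) ∈ rows) × (∀ {r} → r ∈ tls → ∃ λ x → (x ∷ r) ∈ rows)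
split-heads k [] [] = [] , [] , refl , refl , [] , prefl , (λ ()) , (λ ())
split-heads k ((x ∷ r) ∷ rows) (e ∷ es) =
  let (hs , tls , lh , lt , al , p , fh , ft) = split-heads k rows es in
  x ∷ hs , r ∷ tls , cong suc lh , cong suc lt , suc-injective e ∷ al ,
  prep x (ptrans (++⁺ˡ r p) (ptrans (↭-reflexive (sym (++-assoc r hs (concat tls))))
    (ptrans (++⁺ʳ (concat tls) (++-comm r hs)) (↭-reflexive (++-assoc hs r (concat tls)))))) ,
  (λ { (here refl) → r , here refl ; (there x∈) → let (r′ , h) = fh x∈ in r′ , there h }) ,
  (λ { (here refl) → x , here refl ; (there r∈) → let (x′ , h) = ft r∈ in x′ , there h })

someChoice : ∀ s (l : Config s (List A)) → Sized s l → ∃ λ x → Choice s x l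
someChoice unit    _       _       = tt , tt
someChoice (pt _)  (x ∷ _) _       = x , here refl
someChoice (s ⊗ t) (l , m) (e , f) = let (x , c) = someChoice s l e ; (y , d) = someChoice t m f in (x , y) , (c , d)

δ : ∀ {n} → Fin n → Fin n → ℕ
δ x y = ⟦ does (x ≟ᶠ y) ⟧

∑δ-unique : ∀ {n} (x : Fin n) (ys : List (Fin n)) → Unique ys → ∑ ys (δ x) ≤ 1
∑δ-unique x [] u = z≤n
∑δ-unique x (y ∷ ys) (y∉ ∷ u) with x ≟ᶠ y
... | no  _    = ∑δ-unique x ys u
... | yes refl = ≤-reflexive (cong suc (absent ys y∉))
  where
  absent : ∀ ys → All (x ≢_) ys → ∑ ys (δ x) ≡ 0
  absent [] [] = refl
  absent (y ∷ ys) (x≢y ∷ p) with x ≟ᶠ y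
  ... | yes x≡y = ⊥-elim (x≢y x≡y)
  ... | no  _   = absent ys p

∑δ≤1 : ∀ {n} (x : Fin n) → ∑ (allFin n) (δ x) ≤ 1
∑δ≤1 {n} x = ∑δ-unique x (allFin n) (allFin⁺ n)

HalfCodegree : ∀ {n} → ThreeGraph n → Set
HalfCodegree {n} H = ∀ (x y : Fin n) → x ≢ y → n ≤ 2 * codeg H x y

-- The diagonal error term allows the codegree bound to be summed over all pairs; each vertex then
-- contributes an error of at most n.
half-codegree-δ : ∀ {n} (H : ThreeGraph n) → HalfCodegree H → ∀ x y → n ≤ 2 * codeg H x y + n * δ x y
half-codegree-δ {n} H half x y with x ≟ᶠ y
... | yes _   = ≤-trans (≤-reflexive (sym (*-identityʳ n))) (m≤n+m _ (2 * codeg H x y))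
... | no  x≢y = ≤-trans (half x y x≢y) (m≤m+n _ _)

edge-rotate : ∀ {n} (H : ThreeGraph n) x y z → edge H x y z ≡ edge H z x y
edge-rotate H x y z = trans (sym₂₃ H x y z) (sym₁₂ H x z y)

-- Tilings and tiles

module Tiling {n : ℕ} (H : ThreeGraph n) (m : ℕ) where

  V : List (Fin n)
  V = allFin n

  Complete : List (Fin n) → List (Fin n) → List (Fin n) → Set
  Complete as bs cs = ∀ {x y z} → x ∈ as → y ∈ bs → z ∈ cs → edge H x y z ≡ true

  data Tile : List (Fin n) → Set where
    tile : ∀ as bs cs → length as ≡ m → length bs ≡ m → length cs ≡ m → Complete as bs cs → Tile (as ++ bs ++ cs)

  -- Disjointness of the tiles is carried by the permutation: it follows once `L` has no repeated
  -- entries.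
  Tileable : List (Fin n) → Set
  Tileable L = Σ (List (List (Fin n))) λ ts → All Tile ts × concat ts ↭ L

  length-tile : ∀ {t} → Tile t → length t ≡ 3 * m
  length-tile (tile as bs cs la lb lc _) = trans (length-++ as) (cong₂ _+_ la
    (trans (length-++ bs) (cong₂ _+_ lb (trans lc (sym (+-identityʳ m))))))

  tileable-[] : Tileable []
  tileable-[] = [] , [] , prefl

  tileable-tile : ∀ {t} → Tile t → Tileable t
  tileable-tile {t} T = t ∷ [] , T ∷ [] , ↭-reflexive (++-identityʳ t)

  tileable-++ : ∀ {K L} → Tileable K → Tileable L → Tileable (K ++ L)
  tileable-++ (ts , a , p) (us , b , q) = ts ++ us , AllP.++⁺ a b , ptrans (↭-reflexive (concat-++ ts us)) (++⁺ p q)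

  tileable-↭ : ∀ {K L} → K ↭ L → Tileable K → Tileable L
  tileable-↭ p (ts , a , q) = ts , a , ptrans q p

m≤n⇒sucpred : ∀ {x} → 1 ≤ x → suc (pred x) ≡ x
m≤n⇒sucpred {suc x} _ = refl

-- Tilings that miss a bounded number of vertices

single-true : ∀ c b → 1 ≤ c * (⟦ b ⟧ + 0) → b ≡ true
single-true c true  _ = refl
single-true c false h = ⊥-elim (<⇒≱ (s≤s z≤n) (≤-trans h (≤-reflexive (*-zeroʳ c))))

matching : ℕ → ℕ → Shape
matching μ zero    = unit
matching μ (suc k) = (pt μ ⊗ pt μ) ⊗ matching μ k

module Leftover (μ : ℕ) where

  m : ℕ
  m = suc μ

  triple-shape repair-shape : Shape
  triple-shape = pt μ ⊗ pt μ ⊗ pt μ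
  repair-shape = matching μ (suc m)

  abstract
    c₂ : ℕ
    c₂ = pred (24 ^ suc m)

    suc-c₂ : suc c₂ ≡ 24 ^ suc m
    suc-c₂ = m≤n⇒sucpred (m^n>0 24 (suc m))

  L₂ : ℕ
  L₂ = suc (loss repair-shape c₂)

  inside exchange many : ℕ
  inside   = need triple-shape 71 * clones triple-shape
  exchange = need repair-shape c₂ * clones repair-shape
  -- The factor `24 * m` is lost in `many-rich`, `L₂` in the box lemma, and the final `m` is the
  -- number of tiles that one exchange takes apart.
  many     = 24 * m * L₂ * m

  abstract
    leftover : ℕ
    leftover = 36 + (inside + (exchange + many))

    36≤leftover : 36 ≤ leftover
    36≤leftover = m≤m+n 36 (inside + (exchange + many))

    inside≤leftover : inside ≤ leftover
    inside≤leftover = ≤-trans (m≤m+n inside (exchange + many)) (m≤n+m _ 36)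

    exchange≤leftover : exchange ≤ leftover
    exchange≤leftover = ≤-trans (m≤m+n exchange many) (≤-trans (m≤n+m _ inside) (m≤n+m _ 36))

    many≤leftover : many ≤ leftover
    many≤leftover = ≤-trans (m≤n+m many exchange) (≤-trans (m≤n+m _ inside) (m≤n+m _ 36))

module Almost {n : ℕ} (H : ThreeGraph n) (half : HalfCodegree H) (μ : ℕ) where

  open Leftover μ public
  open Tiling H m public

  linkIn : List (Fin n) → Fin n → ℕ
  linkIn U v = ∑ U (λ x → ∑ U (λ y → ⟦ edge H v x y ⟧))

  good : List (Fin n) → Fin n → Bool
  good U v = length U * length U ≤ᵇ 24 * linkIn U v

  rich : List (Fin n) → List (Fin n) → Bool
  rich U t = suc m ≤ᵇ length (filterᵇ (good U) t)

  linkIn≤ : ∀ U v → linkIn U v ≤ length U * length U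
  linkIn≤ U v = ∑-≤const U (length U) (λ x → count≤length U (edge H v x))

  -- With at most m good vertices, a tile has average link at most (m + 2m/24) / 3m, that is 27/72
  -- minus what the crude bound `+ w` on every vertex wastes; in any case at most 3/8 of `w`. The
  -- codegree forces an overall average close to 1/2, so the gap must come from rich tiles.
  ∑link-tile : ∀ U t → length t ≡ 3 * m → let w = length U * length U in
    24 * ∑ t (linkIn U) ≤ 27 * m * w + 48 * m * w * ⟦ rich U t ⟧
  ∑link-tile U t lt = begin
    24 * ∑ t (linkIn U)                              ≡⟨ sym (∑-*ˡ t 24 (linkIn U)) ⟩
    ∑ t (λ v → 24 * linkIn U v)                      ≤⟨ ∑-mono t pointwise ⟩
    ∑ t (λ v → 24 * w * ⟦ good U v ⟧ + w)            ≡⟨ trans (∑-+ t _ _) (cong₂ _+_ (∑-*ˡ t (24 * w) _) (∑-const t w)) ⟩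
    24 * w * ∑ t (λ v → ⟦ good U v ⟧) + length t * w ≡⟨ cong₂ _+_ (cong (24 * w *_) (sym (length-filter (good U) t))) (cong (_* w) lt) ⟩
    24 * w * g + 3 * m * w                           ≤⟨ +-monoˡ-≤ (3 * m * w) (*-monoʳ-≤ (24 * w) g≤) ⟩
    24 * w * (m + 2 * m * ⟦ rich U t ⟧) + 3 * m * w  ≡⟨ ident w m ⟦ rich U t ⟧ ⟩
    27 * m * w + 48 * m * w * ⟦ rich U t ⟧           ∎
    where
    open ≤-Reasoning
    w = length U * length U
    g = length (filterᵇ (good U) t)
    ident : ∀ w m r → 24 * w * (m + 2 * m * r) + 3 * m * w ≡ 27 * m * w + 48 * m * w * r
    ident = solve-∀
    pointwise : ∀ v → 24 * linkIn U v ≤ 24 * w * ⟦ good U v ⟧ + w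
    pointwise v with ⟦≤ᵇ⟧ w (24 * linkIn U v)
    ... | inj₁ (_ , e) rewrite e = ≤-trans (*-monoʳ-≤ 24 (linkIn≤ U v)) (≤-trans (≤-reflexive (sym (*-identityʳ (24 * w)))) (m≤m+n _ w))
    ... | inj₂ (h , e) rewrite e = ≤-trans h (m≤n+m w _)
    g≤ : g ≤ m + 2 * m * ⟦ rich U t ⟧
    g≤ with ⟦≤ᵇ⟧ (suc m) g
    ... | inj₁ (_ , e) rewrite e = ≤-trans (≤-reflexive (length-filter (good U) t)) (≤-trans (count≤length t (good U))
            (≤-reflexive (trans lt (triple m))))
      where
      triple : ∀ m → 3 * m ≡ m + 2 * m * 1
      triple = solve-∀
    ... | inj₂ (h , e) with suc m ≤? g
    ...   | yes m<g = ⊥-elim (subst T (trans (sym (T→ m<g)) e) tt)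
      where
      T→ : suc m ≤ g → (suc m ≤ᵇ g) ≡ true
      T→ p with (suc m ≤ᵇ g) | ≤⇒≤ᵇ p
      ... | true | _ = refl
    ...   | no  m≮g = ≤-trans (≤-pred (≰⇒> m≮g)) (m≤m+n m _)

  module Count (ts : List (List (Fin n))) (U Ab : List (Fin n)) (tiles : All Tile ts)
           (V↭ : V ↭ Ab ++ (concat ts ++ U)) where
    u w : ℕ
    u = length U
    w = u * u

    U-sub : (f : Fin n → ℕ) → ∑ U f ≤ ∑ V f
    U-sub f = ∑-sub {S = Ab ++ concat ts} {R = U} f (ptrans V↭ (↭-reflexive (sym (++-assoc Ab (concat ts) U))))

    -- Triples with two vertices in U and one in V are counted through the codegrees of the pairs in
    -- U; the diagonal costs `n * u`.
    pair-count : n * w ≤ 2 * ∑ V (linkIn U) + n * u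
    pair-count = begin
      n * (u * u)                                              ≡⟨ exch n u ⟩
      u * (u * n)                                              ≤⟨ ∑-≥const U (u * n) row ⟩
      ∑ U (λ x → 2 * ∑ U (codeg H x) + n * 1)                  ≡⟨ trans (∑-+ U _ _) (cong₂ _+_ (∑-*ˡ U 2 _) (∑-const U _)) ⟩
      2 * ∑ U (λ x → ∑ U (codeg H x)) + u * (n * 1)            ≡⟨ cong₂ (λ a b → 2 * a + b) sw (trans (cong (u *_) (*-identityʳ n)) (*-comm u n)) ⟩
      2 * ∑ V (linkIn U) + n * u                               ∎
      where
      open ≤-Reasoning
      exch : ∀ n u → n * (u * u) ≡ u * (u * n)
      exch = solve-∀
      row : ∀ x → u * n ≤ 2 * ∑ U (codeg H x) + n * 1
      row x = begin
        u * n                                             ≤⟨ ∑-≥const U n (half-codegree-δ H half x) ⟩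
        ∑ U (λ y → 2 * codeg H x y + n * δ x y)           ≡⟨ trans (∑-+ U _ _) (cong₂ _+_ (∑-*ˡ U 2 _) (∑-*ˡ U n _)) ⟩
        2 * ∑ U (codeg H x) + n * ∑ U (δ x)               ≤⟨ +-monoʳ-≤ (2 * ∑ U (codeg H x)) (*-monoʳ-≤ n (≤-trans (U-sub (δ x)) (∑δ≤1 x))) ⟩
        2 * ∑ U (codeg H x) + n * 1                       ∎
      sw : ∑ U (λ x → ∑ U (codeg H x)) ≡ ∑ V (linkIn U)
      sw = trans (∑-cong U (λ x → ∑-swap U V _)) (trans (∑-swap U V _)
             (∑-cong V (λ v → ∑-cong U (λ x → ∑-cong U (λ y → cong ⟦_⟧ (edge-rotate H x y v))))))

    many-rich : 72 * length Ab ≤ n → 36 ≤ u → 72 * ∑ U (linkIn U) ≤ u * w → n ≤ 24 * m * length (filterᵇ (rich U) ts)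
    -- In units of n w, `pair-count` puts the scaled total `144 * ∑ V (linkIn U)` at 72, less 2 for
    -- the diagonal because u is at least 36. The set `Ab` and the links inside `U` account for at
    -- most 2 each, and the base share of all tiles for at most 54. The remaining 12 must come from
    -- the rich tiles, each worth at most `288 * m * w`.
    many-rich h5 h7 h6 = *-cancelˡ-≤ w {{w≢0}} (*-cancelˡ-≤ 12 (by-slack 0
      (+-mono-≤ (*-monoʳ-≤ 72 pair-count) (+-mono-≤ (*-monoʳ-≤ 144 h2) (+-mono-≤ (*-monoʳ-≤ 6 h3)
        (+-mono-≤ (*-monoʳ-≤ (54 * w) h4) (+-mono-≤ (*-monoʳ-≤ (2 * w) h5) (+-mono-≤ (*-monoʳ-≤ 2 h6′) (*-monoʳ-≤ (2 * n * u) h7)))))))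
      (ident n u m (length ts) (length Ab) (∑ V (linkIn U)) E (∑ U (linkIn U)) g)))
      where
      E = ∑ ts (λ t → ∑ t (linkIn U))
      g = length (filterᵇ (rich U) ts)
      w≢0 : NonZero w
      w≢0 = >-nonZero (*-mono-≤ (≤-trans (s≤s z≤n) h7) (≤-trans (s≤s z≤n) h7))
      u≤n : u ≤ n
      u≤n = ≤-trans (≤-reflexive (sym (∑-1 U))) (≤-trans (U-sub (λ _ → 1)) (≤-reflexive (trans (∑-1 V) (length-allFin n))))
      h2 : ∑ V (linkIn U) ≤ length Ab * w + (E + ∑ U (linkIn U))
      h2 = ≤-trans (≤-reflexive (trans (∑-↭ (linkIn U) V↭) (trans (∑-++ Ab _ (linkIn U)) (cong (∑ Ab (linkIn U) +_)
             (trans (∑-++ (concat ts) U (linkIn U)) (cong (_+ ∑ U (linkIn U)) (∑-concat ts (linkIn U))))))))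
           (+-monoˡ-≤ _ (∑-≤const Ab w (linkIn≤ U)))
      h3 : 24 * E ≤ length ts * (27 * m * w) + 48 * m * w * g
      h3 = begin
        24 * E                                                       ≡⟨ sym (∑-*ˡ ts 24 _) ⟩
        ∑ ts (λ t → 24 * ∑ t (linkIn U))                             ≤⟨ ∑-mono∈ ts (λ {t} t∈ → ∑link-tile U t (length-tile (All.lookup tiles t∈))) ⟩
        ∑ ts (λ t → 27 * m * w + 48 * m * w * ⟦ rich U t ⟧)          ≡⟨ trans (∑-+ ts _ _) (cong₂ _+_ (∑-const ts _) (∑-*ˡ ts (48 * m * w) _)) ⟩
        length ts * (27 * m * w) + 48 * m * w * ∑ ts (λ t → ⟦ rich U t ⟧) ≡⟨ cong (λ z → length ts * (27 * m * w) + 48 * m * w * z) (sym (length-filter (rich U) ts)) ⟩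
        length ts * (27 * m * w) + 48 * m * w * g                    ∎
        where open ≤-Reasoning
      h4 : length ts * (3 * m) ≤ n
      h4 = begin
        length ts * (3 * m)              ≡⟨ sym (length-concat (3 * m) ts (All.map length-tile tiles)) ⟩
        length (concat ts)               ≤⟨ m≤m+n _ u ⟩
        length (concat ts) + u           ≡⟨ sym (length-++ (concat ts)) ⟩
        length (concat ts ++ U)          ≤⟨ m≤n+m _ (length Ab) ⟩
        length Ab + length (concat ts ++ U) ≡⟨ trans (sym (length-++ Ab)) (trans (sym (↭-length V↭)) (length-allFin n)) ⟩
        n                                ∎
        where open ≤-Reasoning
      h6′ : 72 * ∑ U (linkIn U) ≤ n * w
      h6′ = ≤-trans h6 (*-monoˡ-≤ w u≤n)
      ident : ∀ n u m l a s e z g →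
        12 * (u * u * n) + (72 * (2 * s + n * u) + (144 * (a * (u * u) + (e + z)) + (6 * (l * (27 * m * (u * u)) + 48 * m * (u * u) * g)
           + (54 * (u * u) * n + (2 * (u * u) * n + (2 * (n * (u * u)) + 2 * n * u * u)))))) + 0
        ≡ 12 * (u * u * (24 * m * g)) + (72 * (n * (u * u)) + (144 * s + (6 * (24 * e)
           + (54 * (u * u) * (l * (3 * m)) + (2 * (u * u) * (72 * a) + (2 * (72 * z) + 2 * n * u * 36))))))
      ident = solve-∀

  links : ∀ k → List (Fin n) → Config (matching μ k) (Fin n) → Bool
  links zero    _        _             = true
  links (suc k) []       _             = false
  links (suc k) (v ∷ vs) ((p , q) , r) = edge H v p q ∧ links k vs r

  links-dense : ∀ U k vs → All (λ v → good U v ≡ true) vs → length vs ≡ k →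
    length U ^ dim (matching μ k) ≤ 24 ^ k * ∑ (configs (matching μ k) U) (λ r → ⟦ links k vs r ⟧)
  links-dense U zero    []       _        _ = s≤s z≤n
  links-dense U (suc k) (v ∷ vs) (e ∷ es) l = begin
    length U * (length U * length U ^ dim (matching μ k))  ≡⟨ sym (*-assoc (length U) (length U) _) ⟩
    u² * length U ^ dim (matching μ k)
      ≤⟨ *-mono-≤ (≤ᵇ⇒≤ u² _ (subst T (sym e) tt)) (links-dense U k vs es (suc-injective l)) ⟩
    24 * linkIn U v * (24 ^ k * S)                         ≡⟨ exch (linkIn U v) (24 ^ k) S ⟩
    24 * 24 ^ k * (linkIn U v * S)                         ≡⟨ cong (24 * 24 ^ k *_) (sym prod) ⟩
    24 * 24 ^ k * ∑ (configs (matching μ (suc k)) U) (λ r → ⟦ links (suc k) (v ∷ vs) r ⟧) ∎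
    where
    open ≤-Reasoning
    u² = length U * length U
    S = ∑ (configs (matching μ k) U) (λ r → ⟦ links k vs r ⟧)
    exch : ∀ a b s → 24 * a * (b * s) ≡ 24 * b * (a * s)
    exch = solve-∀
    prod : ∑ (configs (matching μ (suc k)) U) (λ r → ⟦ links (suc k) (v ∷ vs) r ⟧) ≡ linkIn U v * S
    prod = trans (∑-product (cartesianProduct U U) (configs (matching μ k) U) _)
      (trans (∑-cong (cartesianProduct U U) (λ (p , q) → trans (∑-cong (configs (matching μ k) U) (λ r → ⟦∧⟧ (edge H v p q) _))
                (∑-*ˡ (configs (matching μ k) U) ⟦ edge H v p q ⟧ (λ r → ⟦ links k vs r ⟧))))
      (trans (∑-*ʳ (cartesianProduct U U) S (λ (p , q) → ⟦ edge H v p q ⟧)) (cong (_* S) (∑-product U U (λ (p , q) → ⟦ edge H v p q ⟧)))))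

  -- The j-th column of m rows together with the j-th pair of clone lists forms a tile.
  column-tiles : ∀ k (rows : List (List (Fin n))) → length rows ≡ m → All (λ r → length r ≡ k) rows →
    (l : Config (matching μ k) (List (Fin n))) → Sized (matching μ k) l →
    (∀ {r} → r ∈ rows → ∀ {c} → Choice (matching μ k) c l → links k r c ≡ true) →
    Σ (List (List (Fin n))) λ ts → length ts ≡ k × All Tile ts × concat ts ↭ concat rows ++ flat (matching μ k) l
  column-tiles zero rows lr al l sz h = [] , refl , [] , ↭-reflexive (sym (cong (_++ []) (empty rows al)))
    where
    empty : ∀ (rows : List (List (Fin n))) → All (λ r → length r ≡ 0) rows → concat rows ≡ []
    empty [] [] = refl
    empty ([] ∷ rows) (_ ∷ al) = empty rows al
  column-tiles (suc k) rows lr al ((P , Q) , l) ((lP , lQ) , sz) h =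
    let (hs , tls , lh , lt , alt , p , fh , ft) = split-heads k rows al
        (_ , cP) = someChoice (pt μ) P lP
        (_ , cQ) = someChoice (pt μ) Q lQ
        (_ , cl) = someChoice (matching μ k) l sz
        (ts , lts , tiles , q) = column-tiles k tls (trans lt lr) alt l sz
           (λ r∈ c → let (x , xr∈) = ft r∈ in proj₂ (∧-true (h xr∈ ((cP , cQ) , c))))
    in (hs ++ P ++ Q) ∷ ts , cong suc lts ,
       tile hs P Q (trans lh lr) lP lQ (λ x∈ y∈ z∈ → let (r , xr∈) = fh x∈ in proj₁ (∧-true (h xr∈ ((y∈ , z∈) , cl)))) ∷ tiles ,
       ptrans (++⁺ˡ (hs ++ P ++ Q) q) (ptrans (++-exchange hs (P ++ Q) (concat tls) (flat (matching μ k) l))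
         (++⁺ʳ ((P ++ Q) ++ flat (matching μ k) l) (↭-sym p)))

  Improvement : List (List (Fin n)) → List (Fin n) → Set
  Improvement ts U = Σ (List (List (Fin n))) λ ts′ → Σ (List (Fin n)) λ U′ →
    length ts′ ≡ suc (length ts) × All Tile ts′ × concat ts ++ U ↭ concat ts′ ++ U′

  tile-inside : ∀ ts U → All Tile ts → inside ≤ length U →
    length U ^ 3 * 1 ≤ 72 * ∑ (configs triple-shape U) (λ (x , y , z) → ⟦ edge H x y z ⟧ + 0) → Improvement ts U
  tile-inside ts U tiles big dense = found (box triple-shape 71 U [] U (tt ∷ []) (λ (x , y , z) _ → edge H x y z) prefl big dense)
    where
    found : Boxed triple-shape 71 U (tt ∷ []) (λ (x , y , z) _ → edge H x y z) → Improvement ts U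
    found (l@(P , Q , R) , U′ , U↭ , (lP , lQ , lR) , h) = (P ++ Q ++ R) ∷ ts , U′ , refl ,
      tile P Q R lP lQ lR (λ x∈ y∈ z∈ → allChoices-∈ triple-shape l _ holds (x∈ , y∈ , z∈)) ∷ tiles ,
      ptrans (++⁺ˡ (concat ts) U↭) (ptrans (↭-reflexive (sym (++-assoc (concat ts) (P ++ Q ++ R) U′)))
        (++⁺ʳ U′ (++-comm (concat ts) (P ++ Q ++ R))))
      where
      holds : allChoices triple-shape l (λ (x , y , z) → edge H x y z) ≡ true
      holds = single-true (suc (loss triple-shape 71)) _ h

  picks : List (Fin n) → List (Fin n) → List (Fin n)
  picks U t = take (suc m) (filterᵇ (good U) t)

  rest : List (Fin n) → List (Fin n) → List (Fin n)
  rest U t = drop (suc m) (filterᵇ (good U) t) ++ filterᵇ (not ∘ good U) t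

  picks-rest : ∀ U t → t ↭ picks U t ++ rest U t
  picks-rest U t = ptrans (filter-split (good U) t) (ptrans (++⁺ʳ (filterᵇ (not ∘ good U) t)
    (↭-reflexive (sym (take++drop≡id (suc m) (filterᵇ (good U) t))))) (↭-reflexive (++-assoc (picks U t) _ _)))

  length-picks : ∀ U t → rich U t ≡ true → length (picks U t) ≡ suc m
  length-picks U t e = trans (length-take (suc m) (filterᵇ (good U) t)) (m≤n⇒m⊓n≡m (≤ᵇ⇒≤ (suc m) _ (subst T (sym e) tt)))

  picks-good : ∀ U t → All (λ v → good U v ≡ true) (picks U t)
  picks-good U t = AllP.take⁺ (suc m) (All.tabulate (λ v∈ → proj₂ (filter-∈ (good U) t v∈)))

  -- The right-hand side of the box lemma is the list of rich tiles, so one set of clones in `U`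
  -- fits many tiles simultaneously; m of them supply the missing part of each of the m + 1 new
  -- tiles. Whatever else those m tiles contained returns to the uncovered set.
  tile-exchange : ∀ ts U → All Tile ts → exchange ≤ length U →
    many ≤ 24 * m * length (filterᵇ (rich U) ts) → Improvement ts U
  tile-exchange ts U tiles big enough = found (box repair-shape c₂ U [] U G E prefl big dense)
    where
    G = filterᵇ (rich U) ts
    E : Config repair-shape (Fin n) → List (Fin n) → Bool
    E r t = links (suc m) (picks U t) r
    dense : length U ^ dim repair-shape * length G ≤ suc c₂ * ∑ (configs repair-shape U) (λ r → ∑ G (λ t → ⟦ E r t ⟧))
    dense = begin
      length U ^ dim repair-shape * length G ≡⟨ trans (*-comm _ (length G)) (sym (∑-const G _)) ⟩
      ∑ G (λ t → length U ^ dim repair-shape) ≤⟨ ∑-mono∈ G (λ {t} t∈ → links-dense U (suc m) (picks U t) (picks-good U t)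
                                                  (length-picks U t (proj₂ (filter-∈ (rich U) ts t∈)))) ⟩
      ∑ G (λ t → 24 ^ suc m * ∑ (configs repair-shape U) (λ r → ⟦ E r t ⟧)) ≡⟨ ∑-*ˡ G (24 ^ suc m) _ ⟩
      24 ^ suc m * ∑ G (λ t → ∑ (configs repair-shape U) (λ r → ⟦ E r t ⟧)) ≡⟨ cong₂ _*_ (sym suc-c₂) (∑-swap G (configs repair-shape U) _) ⟩
      suc c₂ * ∑ (configs repair-shape U) (λ r → ∑ G (λ t → ⟦ E r t ⟧)) ∎
      where open ≤-Reasoning
    found : Boxed repair-shape c₂ U G E → Improvement ts U
    found (l , R , U↭ , sz , h) = new ++ others , concat (map (rest U) rows) ++ R ,
      trans (length-++ new) (trans (cong (_+ length others) lnew) (cong suc (trans (cong (_+ length others) (sym lrows))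
        (sym (trans (↭-length ts↭) (length-++ rows)))))) ,
      AllP.++⁺ tnew (AllP.++⁻ʳ rows (All-resp-↭ ts↭ tiles)) , perm
      where
      ok : List (Fin n) → Bool
      ok t = allChoices repair-shape l (λ r → E r t)
      G′ = filterᵇ ok G
      rows = take m G′
      others = drop m G′ ++ (filterᵇ (not ∘ ok) G ++ filterᵇ (not ∘ rich U) ts)
      m≤G′ : m ≤ length G′
      m≤G′ = *-cancelˡ-≤ (24 * m * L₂) (≤-trans enough (≤-trans (*-monoʳ-≤ (24 * m) (≤-trans h
        (*-monoʳ-≤ L₂ (≤-reflexive (sym (length-filter ok G)))))) (≤-reflexive (sym (*-assoc (24 * m) L₂ (length G′))))))
      lrows : length rows ≡ m
      lrows = trans (length-take m G′) (m≤n⇒m⊓n≡m m≤G′)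
      ts↭ : ts ↭ rows ++ others
      ts↭ = ptrans (filter-split (rich U) ts) (ptrans (++⁺ʳ _ (filter-split ok G)) (↭-reflexive
        (trans (++-assoc G′ _ _) (trans (cong (_++ (filterᵇ (not ∘ ok) G ++ filterᵇ (not ∘ rich U) ts)) (sym (take++drop≡id m G′)))
          (++-assoc rows (drop m G′) _)))))
      in-G′ : ∀ {t} → t ∈ rows → t ∈ G′
      in-G′ t∈ = subst (_ ∈_) (take++drop≡id m G′) (∈-++⁺ˡ t∈)
      columns = column-tiles (suc m) (map (picks U) rows) (trans (length-map (picks U) rows) lrows)
        (AllP.map⁺ (All.tabulate (λ {t} t∈ → length-picks U t (proj₂ (filter-∈ (rich U) ts (proj₁ (filter-∈ ok G (in-G′ t∈))))))))
        l sz fits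
        where
        fits : ∀ {r} → r ∈ map (picks U) rows → ∀ {c} → Choice repair-shape c l → links (suc m) r c ≡ true
        fits r∈ c with ∈-map⁻ (picks U) r∈
        ... | t , t∈ , refl = allChoices-∈ repair-shape l _ (proj₂ (filter-∈ ok G (in-G′ t∈))) c
      new = proj₁ columns
      lnew = proj₁ (proj₂ columns)
      tnew = proj₁ (proj₂ (proj₂ columns))
      perm : concat ts ++ U ↭ concat (new ++ others) ++ (concat (map (rest U) rows) ++ R)
      perm = begin
        concat ts ++ U
          ↭⟨ ++⁺ (concat-↭ ts↭) U↭ ⟩
        concat (rows ++ others) ++ (flat repair-shape l ++ R)
          ≡⟨ cong (_++ (flat repair-shape l ++ R)) (concat-++ rows others) ⟩
        (concat rows ++ concat others) ++ (flat repair-shape l ++ R)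
          ↭⟨ ++⁺ʳ _ (++⁺ʳ (concat others) (ptrans (↭-reflexive (cong concat (sym (map-id rows))))
               (concat-map-++ id (picks U) (rest U) rows (λ {t} _ → picks-rest U t)))) ⟩
        ((concat (map (picks U) rows) ++ concat (map (rest U) rows)) ++ concat others) ++ (flat repair-shape l ++ R)
          ↭⟨ shuffle (concat (map (picks U) rows)) (concat (map (rest U) rows)) (concat others) (flat repair-shape l) R ⟩
        ((concat (map (picks U) rows) ++ flat repair-shape l) ++ concat others) ++ (concat (map (rest U) rows) ++ R)
          ↭⟨ ++⁺ʳ _ (++⁺ʳ (concat others) (↭-sym (proj₂ (proj₂ (proj₂ columns))))) ⟩
        (concat new ++ concat others) ++ (concat (map (rest U) rows) ++ R)
          ≡⟨ cong (_++ (concat (map (rest U) rows) ++ R)) (sym (concat-++ new others)) ⟩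
        concat (new ++ others) ++ (concat (map (rest U) rows) ++ R) ∎
        where
        open PermutationReasoning
        shuffle : (p r o f s : List (Fin n)) → ((p ++ r) ++ o) ++ (f ++ s) ↭ ((p ++ f) ++ o) ++ (r ++ s)
        shuffle = solve 5 (λ p r o f s → ((p ⊕ r) ⊕ o) ⊕ (f ⊕ s) ⊜ ((p ⊕ f) ⊕ o) ⊕ (r ⊕ s)) prefl
          where open import Algebra.Solver.CommutativeMonoid (++-commutativeMonoid {A = Fin n})

  improve : ∀ ts U Ab → All Tile ts → V ↭ Ab ++ (concat ts ++ U) → 72 * length Ab ≤ n → leftover ≤ length U → Improvement ts U
  -- If a proportion 1/72 of the triples in `U` are edges, a tile is found inside `U`. Otherwise the
  -- vertices of `U` have a negligible total link in `U`, and the large links have to be found at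
  -- covered vertices.
  improve ts U Ab tiles V↭ ab big with ≤-total (length U ^ 3 * 1) (72 * ∑ (configs triple-shape U) (λ (x , y , z) → ⟦ edge H x y z ⟧ + 0))
  ... | inj₁ dense  = tile-inside ts U tiles (≤-trans inside≤leftover big) dense
  ... | inj₂ sparse = tile-exchange ts U tiles (≤-trans exchange≤leftover big)
    (≤-trans (≤-trans many≤leftover (≤-trans big u≤n)) (many-rich ab (≤-trans 36≤leftover big) sparse′))
    where
    open Count ts U Ab tiles V↭
    u≤n : length U ≤ n
    u≤n = ≤-trans (≤-reflexive (sym (∑-1 U))) (≤-trans (U-sub (λ _ → 1)) (≤-reflexive (trans (∑-1 V) (length-allFin n))))
    cube : ∀ u → u * (u * (u * 1)) * 1 ≡ u * (u * u)
    cube = solve-∀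
    sparse′ : 72 * ∑ U (linkIn U) ≤ u * w
    sparse′ = begin
      72 * ∑ U (linkIn U)
        ≡⟨ cong (72 *_) (sym (trans (∑-product U (cartesianProduct U U) _) (∑-cong U (λ x →
             trans (∑-product U U _) (∑-cong U (λ y → ∑-cong U (λ z → +-identityʳ _))))))) ⟩
      72 * ∑ (configs triple-shape U) (λ (x , y , z) → ⟦ edge H x y z ⟧ + 0) ≤⟨ sparse ⟩
      length U ^ 3 * 1 ≡⟨ cube u ⟩
      u * w ∎
      where open ≤-Reasoning

  -- An improvement rearranges the same vertices into one more tile, so `U` shrinks by 3m and a
  -- bound on its length serves as fuel. The part `Ab`, set aside for absorption, is never touched.
  almost : ∀ fuel ts U Ab → All Tile ts → V ↭ Ab ++ (concat ts ++ U) → 72 * length Ab ≤ n → length U ≤ fuel →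
    Σ (List (List (Fin n))) λ ts′ → Σ (List (Fin n)) λ U′ → All Tile ts′ × V ↭ Ab ++ (concat ts′ ++ U′) × length U′ < leftover
  almost fuel ts U Ab tiles V↭ ab l≤ with leftover ≤? length U
  ... | no  small = ts , U , tiles , V↭ , ≰⇒> small
  almost zero ts U Ab tiles V↭ ab l≤ | yes big = ⊥-elim (<⇒≱ (≤-trans (s≤s z≤n) 36≤leftover) (≤-trans big l≤))
  almost (suc fuel) ts U Ab tiles V↭ ab l≤ | yes big =
    let (ts′ , U′ , lts , tiles′ , p) = improve ts U Ab tiles V↭ ab big
        lengths : length ts * (3 * m) + length U ≡ suc (length ts) * (3 * m) + length U′
        lengths = trans (trans (cong (_+ length U) (sym (length-concat (3 * m) ts (All.map length-tile tiles)))) (sym (length-++ (concat ts))))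
          (trans (↭-length p) (trans (length-++ (concat ts′)) (cong (_+ length U′)
            (trans (length-concat (3 * m) ts′ (All.map length-tile tiles′)) (cong (_* (3 * m)) lts)))))
    in almost fuel ts′ U′ Ab tiles′ (ptrans V↭ (++⁺ˡ Ab p)) ab
         (≤-pred (≤-trans (shrink (length ts * (3 * m)) (3 * m) (length U) (length U′) (s≤s z≤n) lengths) l≤))
    where
    shrink : ∀ a k u u′ → 1 ≤ k → a + u ≡ k + a + u′ → suc u′ ≤ u
    shrink a k u u′ k≥1 e = +-cancelˡ-≤ a (suc u′) u (≤-trans (≤-trans (≤-reflexive (+-suc a u′)) (+-monoˡ-≤ (a + u′) k≥1))
      (≤-reflexive (trans (sym (+-assoc k a u′)) (sym e))))

-- Words and the growth of powers

words : ℕ → List A → List (List A)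
words zero    X = [] ∷ []
words (suc k) X = map (λ (x , w) → x ∷ w) (cartesianProduct X (words k X))

length-words : ∀ k (X : List A) → length (words k X) ≡ length X ^ k
length-words zero    X = refl
length-words (suc k) X = trans (length-map _ (cartesianProduct X (words k X)))
  (trans (length-product X (words k X)) (cong (length X *_) (length-words k X)))

∈-words : ∀ {X : List A} (w : List A) → All (_∈ X) w → w ∈ words (length w) X
∈-words []      []       = here refl
∈-words (x ∷ w) (p ∷ ps) = ∈-map⁺ (λ (x , w) → x ∷ w) (∈-cartesianProduct⁺ p (∈-words w ps))

words-⊆ : ∀ k {X : List A} {w} → w ∈ words k X → length w ≡ k × All (_∈ X) w
words-⊆ zero    (here refl) = refl , []
words-⊆ (suc k) {X} w∈ with ∈-map⁻ (λ (x , w) → x ∷ w) w∈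
... | (x , v) , xv∈ , refl with ∈-cartesianProduct⁻ X (words k X) xv∈
...   | x∈ , v∈ = let (l , a) = words-⊆ k v∈ in cong suc l , x∈ ∷ a

bernoulli : ∀ c j → c * c ^ j + suc j * c ^ j ≤ suc c * suc c ^ j
bernoulli c zero = ≤-reflexive (base c)
  where
  base : ∀ c → c * 1 + 1 * 1 ≡ suc c * 1
  base = solve-∀
bernoulli c (suc j) = ≤-trans (≤-trans (m≤m+n _ (suc j * c ^ j)) (≤-reflexive (step c j (c ^ j)))) (*-monoʳ-≤ (suc c) (bernoulli c j))
  where
  step : ∀ c j p → c * (c * p) + suc (suc j) * (c * p) + suc j * p ≡ suc c * (c * p + suc j * p)
  step = solve-∀

double-power : ∀ c → 2 * c ^ suc c ≤ suc c ^ suc c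
double-power c = ≤-trans (≤-trans (m≤m+n _ (c ^ c)) (≤-reflexive (ident c (c ^ c)))) (bernoulli c c)
  where
  ident : ∀ c p → 2 * (c * p) + p ≡ c * p + suc c * p
  ident = solve-∀

-- `suc c` greedy steps that each leave a proportion c / suc c of the targets at least halve their
-- number; t halvings take `suc c * t` steps.
double-powers : ∀ c t → 2 ^ t * c ^ (suc c * t) ≤ suc c ^ (suc c * t)
double-powers c t = begin
  2 ^ t * c ^ (suc c * t)       ≡⟨ cong (2 ^ t *_) (sym (^-*-assoc c (suc c) t)) ⟩
  2 ^ t * (c ^ suc c) ^ t       ≡⟨ sym (^-distribʳ t 2 (c ^ suc c)) ⟩
  (2 * c ^ suc c) ^ t           ≤⟨ ^-monoˡ-≤ t (double-power c) ⟩
  (suc c ^ suc c) ^ t           ≡⟨ ^-*-assoc (suc c) (suc c) t ⟩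
  suc c ^ (suc c * t)           ∎
  where open ≤-Reasoning

log₂ : ∀ n → ∃ λ l → suc n < 2 ^ l × 2 ^ l ≤ 2 * suc n
log₂ zero = 1 , s≤s (s≤s z≤n) , ≤-refl
log₂ (suc n) with log₂ n
... | l , lo , hi with suc (suc n) <? 2 ^ l
...   | yes p = l , p , ≤-trans hi (*-monoʳ-≤ 2 (n≤1+n (suc n)))
...   | no ¬p = suc l , ≤-trans (s≤s (≤-trans (≤-reflexive (sym eq)) (m≤m+n _ 0)))
                    (≤-trans (+-monoˡ-≤ (2 ^ l + 0) (≤-trans (s≤s z≤n) lo)) ≤-refl) , ≤-reflexive (cong (2 *_) eq)
  where
  eq : 2 ^ l ≡ suc (suc n)
  eq = ≤-antisym (≮⇒≥ ¬p) lo

double≤2^ : ∀ j → 2 * j ≤ 2 ^ j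
double≤2^ zero = z≤n
double≤2^ (suc zero) = ≤-refl
double≤2^ (suc (suc j)) = ≤-trans (≤-reflexive (split j)) (+-mono-≤ (double≤2^ (suc j))
  (≤-trans (≤-trans (s≤s (s≤s z≤n)) (*-monoʳ-≤ 2 (m^n>0 2 j))) (≤-reflexive (sym (+-identityʳ _)))))
  where
  split : ∀ j → 2 * (2 + j) ≡ 2 * (1 + j) + 2
  split = solve-∀

linear≤2^ : ∀ C l → 2 * C ≤ l → C * l ≤ 2 ^ l
linear≤2^ C l h = begin
  C * l                          ≤⟨ *-mono-≤ (≤-trans (m≤n*m C 2) (double≤2^ C)) l≤ ⟩
  2 ^ C * 2 ^ (l ∸ C)            ≡⟨ sym (^-distribˡ-+-* 2 C (l ∸ C)) ⟩
  2 ^ (C + (l ∸ C))              ≡⟨ cong (2 ^_) (m+[n∸m]≡n C≤l) ⟩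
  2 ^ l                          ∎
  where
  open ≤-Reasoning
  C≤l : C ≤ l
  C≤l = ≤-trans (m≤n*m C 2) h
  dbl : ∀ a → a + a ≡ 2 * a
  dbl = solve-∀
  l≤ : l ≤ 2 ^ (l ∸ C)
  l≤ = begin
    l                   ≡⟨ sym (m+[n∸m]≡n C≤l) ⟩
    C + (l ∸ C)         ≤⟨ +-monoˡ-≤ (l ∸ C) (m+n≤o⇒m≤o∸n C (≤-trans (≤-reflexive (dbl C)) h)) ⟩
    l ∸ C + (l ∸ C)     ≡⟨ dbl (l ∸ C) ⟩
    2 * (l ∸ C)         ≤⟨ double≤2^ (l ∸ C) ⟩
    2 ^ (l ∸ C)         ∎

2^-cancel-≤ : ∀ a b → 2 ^ a ≤ 2 ^ b → a ≤ b
2^-cancel-≤ a b h with a ≤? b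
... | yes p = p
... | no ¬p = ⊥-elim (<⇒≱ (^-monoʳ-< 2 (s≤s (s≤s z≤n)) (≰⇒> ¬p)) h)

-- Enough greedy steps to exhaust n ^ suc k targets use only o(n) room.
abstract
  greedy-budget : ∀ k d Q → Σ ℕ λ n₀ → ∀ n → n₀ ≤ n →
    Σ ℕ λ s → n ^ suc k * suc d ^ s < suc (suc d) ^ s × Q * s ≤ n
  greedy-budget k d Q = suc (2 ^ (2 * K)) , budget
    where
    K : ℕ
    K = 2 * (Q * (suc (suc d) * suc k))
    assoc : ∀ Q c k l → 2 * (Q * (c * (k * l))) ≡ 2 * (Q * (c * k)) * l
    assoc = solve-∀
    budget : ∀ n → suc (2 ^ (2 * K)) ≤ n → Σ ℕ λ s → n ^ suc k * suc d ^ s < suc (suc d) ^ s × Q * s ≤ n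
    budget zero    ()
    budget (suc n) (s≤s big) with log₂ n
    -- Here l is about the binary logarithm of n, so `suc k * l` halvings exhaust n ^ suc k targets,
    -- and each halving takes `suc (suc d)` steps.
    ... | l , lo , hi = suc (suc d) * (suc k * l) , exhausts , *-cancelˡ-≤ 2 (begin
        2 * (Q * (suc (suc d) * (suc k * l))) ≡⟨ assoc Q (suc (suc d)) (suc k) l ⟩
        K * l                       ≤⟨ linear≤2^ K l (2^-cancel-≤ (2 * K) l (≤-trans big (≤-trans (n≤1+n n) (<⇒≤ lo)))) ⟩
        2 ^ l                       ≤⟨ hi ⟩
        2 * suc n                   ∎)
      where
      open ≤-Reasoning
      s : ℕ
      s = suc (suc d) * (suc k * l)
      exhausts : suc n ^ suc k * suc d ^ s < suc (suc d) ^ s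
      exhausts = begin-strict
        suc n ^ suc k * suc d ^ s          <⟨ *-monoˡ-< (suc d ^ s) {{m^n≢0 (suc d) s}} (^-monoˡ-< (suc k) lo) ⟩
        (2 ^ l) ^ suc k * suc d ^ s        ≡⟨ cong (_* suc d ^ s) (trans (^-*-assoc 2 l (suc k)) (cong (2 ^_) (*-comm l (suc k)))) ⟩
        2 ^ (suc k * l) * suc d ^ s        ≤⟨ double-powers (suc d) (suc k * l) ⟩
        suc (suc d) ^ s                    ∎

-- Absorption

copies : ℕ → Shape → Shape
copies zero    s = unit
copies (suc k) s = s ⊗ copies k s

module Absorber (ν : ℕ) where

  μ : ℕ
  μ = suc ν

  -- With m = ν + 2, `pt ν` gets m - 1 clones: the vacant place is the one at which vertices are
  -- exchanged. The two inner vertices of a chain are `pt 0`, a single copy each. A unit clones the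
  -- three vertices of an edge m times and has m chains for each of them, one per target vertex of
  -- that part.
  triple-shape chain-shape unit-shape : Shape
  triple-shape = pt ν ⊗ pt μ ⊗ pt μ
  chain-shape  = pt 0 ⊗ pt 0 ⊗ triple-shape ⊗ triple-shape ⊗ triple-shape
  unit-shape   = (pt μ ⊗ pt μ ⊗ pt μ) ⊗ (copies (suc μ) chain-shape ⊗ copies (suc μ) chain-shape ⊗ copies (suc μ) chain-shape)

module Absorbing {n : ℕ} (H : ThreeGraph n) (ν : ℕ) where

  open Absorber ν public

  m : ℕ
  m = suc μ

  open Tiling H m public

  -- In a tile through x, P, Q the vertex x may be exchanged for y.
  link : Fin n → Fin n → Config triple-shape (Fin n) → Bool
  link x y (z , p , q) = edge H x p q ∧ (edge H y p q ∧ edge H z p q)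

  chain : Fin n → Fin n → Config chain-shape (Fin n) → Bool
  chain x y (w , w′ , t , t′ , t″) = link x w t ∧ (link w w′ t′ ∧ link w′ y t″)

  -- All target vertices are joined to the same y. After y is cloned, every chain may end at every
  -- clone, so targets and clones can be matched freely.
  chains : ∀ k → List (Fin n) → Fin n → Config (copies k chain-shape) (Fin n) → Bool
  chains zero    _        _ _        = true
  chains (suc k) []       _ _        = false
  chains (suc k) (u ∷ us) y (c , cs) = chain u y c ∧ chains k us y cs

  Target : Set
  Target = List (Fin n) × List (Fin n) × List (Fin n)

  absorbs : Config unit-shape (Fin n) → Target → Bool
  absorbs ((a , b , c) , (ca , cb , cc)) (us , vs , ws) =
    edge H a b c ∧ (chains m us a ca ∧ (chains m vs b cb ∧ chains m ws c cc))

  vertices : Target → List (Fin n)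
  vertices (us , vs , ws) = us ++ vs ++ ws

  link-tiles : ∀ x y (l : Config triple-shape (List (Fin n))) → Sized triple-shape l →
    (∀ {c} → Choice triple-shape c l → link x y c ≡ true) →
    Tile (x ∷ flat triple-shape l) × Tile (y ∷ flat triple-shape l)
  link-tiles x y (Z , P , Q) (lZ , lP , lQ) h = swapped x (λ c → proj₁ (∧-true (h c))) ,
    swapped y (λ c → proj₁ (∧-true (proj₂ (∧-true {edge H x _ _} (h c)))))
    where
    cZ = someChoice (pt ν) Z lZ
    swapped : ∀ u → (∀ {z p q} → Choice triple-shape (z , p , q) (Z , P , Q) → edge H u p q ≡ true) → Tile (u ∷ Z ++ P ++ Q)
    swapped u e = tile (u ∷ Z) P Q (cong suc lZ) lP lQ λ
      { (here refl) y∈ z∈ → e (proj₂ cZ , y∈ , z∈)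
      ; (there x∈)  y∈ z∈ → proj₂ (∧-true {edge H y _ _} (proj₂ (∧-true {edge H x _ _} (h (x∈ , y∈ , z∈))))) }

  three-tiles : ∀ {a b c} (x y z : Fin n) → Tile (x ∷ a) → Tile (y ∷ b) → Tile (z ∷ c) → Tileable (x ∷ y ∷ z ∷ a ++ b ++ c)
  three-tiles {a} {b} {c} x y z tx ty tz = tileable-↭ (shuffle (x ∷ []) (y ∷ []) (z ∷ []) a b c)
    (tileable-++ (tileable-tile tx) (tileable-++ (tileable-tile ty) (tileable-tile tz)))
    where
    shuffle : (x y z a b c : List (Fin n)) → (x ++ a) ++ ((y ++ b) ++ (z ++ c)) ↭ x ++ (y ++ (z ++ (a ++ (b ++ c))))
    shuffle = solve 6 (λ x y z a b c → (x ⊕ a) ⊕ ((y ⊕ b) ⊕ (z ⊕ c)) ⊜ x ⊕ (y ⊕ (z ⊕ (a ⊕ (b ⊕ c))))) prefl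
      where open import Algebra.Solver.CommutativeMonoid (++-commutativeMonoid {A = Fin n})

  -- The three triples are completed by x, w, w′ in one case and by w, w′, y in the other: the
  -- vertices move along the chain by one place.
  chain-tiles : ∀ x y (l : Config chain-shape (List (Fin n))) → Sized chain-shape l →
    (∀ {c} → Choice chain-shape c l → chain x y c ≡ true) →
    Tileable (x ∷ flat chain-shape l) × Tileable (y ∷ flat chain-shape l)
  chain-tiles x y ((w ∷ []) , (w′ ∷ []) , t , t′ , t″) (lw , lw′ , lt , lt′ , lt″) h =
    tileable-↭ (prep x prefl) (three-tiles x w w′ (proj₁ K) (proj₁ K′) (proj₁ K″)) ,
    tileable-↭ (ptrans (prep w (swap w′ y prefl)) (swap w y prefl)) (three-tiles w w′ y (proj₂ K) (proj₂ K′) (proj₂ K″))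
    where
    c  = proj₂ (someChoice triple-shape t lt)
    c′ = proj₂ (someChoice triple-shape t′ lt′)
    c″ = proj₂ (someChoice triple-shape t″ lt″)
    K : Tile (x ∷ flat triple-shape t) × Tile (w ∷ flat triple-shape t)
    K = link-tiles x w t lt (λ {d} e → proj₁ (∧-true {link x w d} (h (here refl , here refl , e , c′ , c″))))
    K′ : Tile (w ∷ flat triple-shape t′) × Tile (w′ ∷ flat triple-shape t′)
    K′ = link-tiles w w′ t′ lt′ (λ {d} e → proj₁ (∧-true {link w w′ d} (proj₂ (∧-true {link x w _} (h (here refl , here refl , c , e , c″))))))
    K″ : Tile (w′ ∷ flat triple-shape t″) × Tile (y ∷ flat triple-shape t″)
    K″ = link-tiles w′ y t″ lt″ (λ {d} e → proj₂ (∧-true {link w w′ _} (proj₂ (∧-true {link x w _} (h (here refl , here refl , c , c′ , e))))))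

  -- The hypothesis treats one y at a time but holds for each clone with each choice of chains, so
  -- the i-th chain may be used between the i-th target vertex and the i-th clone.
  chains-tiles : ∀ k us ys (l : Config (copies k chain-shape) (List (Fin n))) → length us ≡ k → length ys ≡ k →
    Sized (copies k chain-shape) l → (∀ {y} → y ∈ ys → ∀ {c} → Choice (copies k chain-shape) c l → chains k us y c ≡ true) →
    Tileable (us ++ flat (copies k chain-shape) l) × Tileable (ys ++ flat (copies k chain-shape) l)
  chains-tiles zero [] [] l _ _ _ h = tileable-[] , tileable-[]
  chains-tiles (suc k) (u ∷ us) (y ∷ ys) (l , ls) lu ly (sz , szs) h =
    both u us (proj₁ first) (proj₁ others) , both y ys (proj₂ first) (proj₂ others)
    where
    first = chain-tiles u y l sz (λ {d} c → proj₁ (∧-true {chain u y d} (h (here refl) (c , proj₂ (someChoice (copies k chain-shape) ls szs)))))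
    others = chains-tiles k us ys ls (suc-injective lu) (suc-injective ly) szs
      (λ {z} z∈ c → proj₂ (∧-true {chain u z _} (h (there z∈) (proj₂ (someChoice chain-shape l sz) , c))))
    both : ∀ x xs → Tileable (x ∷ flat chain-shape l) → Tileable (xs ++ flat (copies k chain-shape) ls) →
           Tileable (x ∷ xs ++ flat chain-shape l ++ flat (copies k chain-shape) ls)
    both x xs t t′ = tileable-↭ (prep x (ptrans (↭-reflexive (sym (++-assoc (flat chain-shape l) xs _)))
      (ptrans (++⁺ʳ _ (++-comm (flat chain-shape l) xs)) (↭-reflexive (++-assoc xs (flat chain-shape l) _))))) (tileable-++ t t′)

  TargetOf : (τ₀ τ₁ τ₂ : Fin n → Bool) → Target → Set
  TargetOf τ₀ τ₁ τ₂ (us , vs , ws) =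
    (length us ≡ m × All (λ u → τ₀ u ≡ true) us) × (length vs ≡ m × All (λ u → τ₁ u ≡ true) vs) × (length ws ≡ m × All (λ u → τ₂ u ≡ true) ws)

  -- Alone, the chains take up the clones of the edge. In the presence of the target they take up
  -- its vertices instead, and the released clones form one further tile.
  unit-tiles : ∀ (l : Config unit-shape (List (Fin n))) → Sized unit-shape l → ∀ us vs ws → length us ≡ m → length vs ≡ m → length ws ≡ m →
    (∀ {c} → Choice unit-shape c l → absorbs c (us , vs , ws) ≡ true) →
    Tileable (flat unit-shape l) × Tileable (vertices (us , vs , ws) ++ flat unit-shape l)
  unit-tiles l@((as , bs , cs) , (la , lb , lc)) ((sa , sb , sc) , (sla , slb , slc)) us vs ws lu lv lw h =
    tileable-↭ (group as bs cs fa fb fc) (tileable-++ (proj₂ A′) (tileable-++ (proj₂ B′) (proj₂ C′))) ,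
    tileable-↭ (regroup (as ++ bs ++ cs) us vs ws fa fb fc)
      (tileable-++ (tileable-tile K) (tileable-++ (proj₁ A′) (tileable-++ (proj₁ B′) (proj₁ C′))))
    where
    S = copies m chain-shape
    fa = flat S la
    fb = flat S lb
    fc = flat S lc
    ca = proj₂ (someChoice S la sla)
    cb = proj₂ (someChoice S lb slb)
    cc = proj₂ (someChoice S lc slc)
    da = proj₂ (someChoice (pt μ) as sa)
    db = proj₂ (someChoice (pt μ) bs sb)
    dc = proj₂ (someChoice (pt μ) cs sc)
    K : Tile (as ++ bs ++ cs)
    K = tile as bs cs sa sb sc (λ {x} {y} {z} x∈ y∈ z∈ → proj₁ (∧-true {edge H x y z} (h ((x∈ , y∈ , z∈) , (ca , cb , cc)))))
    A′ : Tileable (us ++ fa) × Tileable (as ++ fa)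
    A′ = chains-tiles m us as la lu sa sla (λ {y} y∈ {c} e → proj₁ (∧-true {chains m us y c}
           (proj₂ (∧-true {edge H _ _ _} (h ((y∈ , db , dc) , (e , cb , cc)))))))
    B′ : Tileable (vs ++ fb) × Tileable (bs ++ fb)
    B′ = chains-tiles m vs bs lb lv sb slb (λ {y} y∈ {c} e → proj₁ (∧-true {chains m vs y c} (proj₂ (∧-true {chains m us _ _}
           (proj₂ (∧-true {edge H _ _ _} (h ((da , y∈ , dc) , (ca , e , cc)))))))))
    C′ : Tileable (ws ++ fc) × Tileable (cs ++ fc)
    C′ = chains-tiles m ws cs lc lw sc slc (λ {y} y∈ {c} e → proj₂ (∧-true {chains m vs _ _} (proj₂ (∧-true {chains m us _ _}
           (proj₂ (∧-true {edge H _ _ _} (h ((da , db , y∈) , (ca , cb , e)))))))))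
    open import Algebra.Solver.CommutativeMonoid (++-commutativeMonoid {A = Fin n})
    group : (a b c x y z : List (Fin n)) → (a ++ x) ++ ((b ++ y) ++ (c ++ z)) ↭ (a ++ (b ++ c)) ++ (x ++ (y ++ z))
    group = solve 6 (λ a b c x y z → (a ⊕ x) ⊕ ((b ⊕ y) ⊕ (c ⊕ z)) ⊜ (a ⊕ (b ⊕ c)) ⊕ (x ⊕ (y ⊕ z))) prefl
    regroup : (t a b c x y z : List (Fin n)) → t ++ ((a ++ x) ++ ((b ++ y) ++ (c ++ z))) ↭ (a ++ (b ++ c)) ++ (t ++ (x ++ (y ++ z)))
    regroup = solve 7 (λ t a b c x y z → t ⊕ ((a ⊕ x) ⊕ ((b ⊕ y) ⊕ (c ⊕ z))) ⊜ (a ⊕ (b ⊕ c)) ⊕ (t ⊕ (x ⊕ (y ⊕ z)))) prefl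

∑-product-∧ : (xs : List A) (ys : List B) (p : A → Bool) (q : B → Bool) →
  ∑ (cartesianProduct xs ys) (λ (x , y) → ⟦ p x ∧ q y ⟧) ≡ ∑ xs (λ x → ⟦ p x ⟧) * ∑ ys (λ y → ⟦ q y ⟧)
∑-product-∧ xs ys p q = trans (∑-product xs ys _) (trans (∑-cong xs (λ x → trans (∑-cong ys (λ y → ⟦∧⟧ (p x) (q y)))
  (∑-*ˡ ys ⟦ p x ⟧ (λ y → ⟦ q y ⟧)))) (∑-*ʳ xs (∑ ys (λ y → ⟦ q y ⟧)) (λ x → ⟦ p x ⟧)))

∑³-*ˡ : (xs : List A) (k : ℕ) (f : A → A → A → ℕ) →
  ∑ xs (λ x → ∑ xs (λ y → ∑ xs (λ z → k * f x y z))) ≡ k * ∑ xs (λ x → ∑ xs (λ y → ∑ xs (f x y)))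
∑³-*ˡ xs k f = trans (∑-cong xs (λ x → trans (∑-cong xs (λ y → ∑-*ˡ xs k (f x y))) (∑-*ˡ xs k _))) (∑-*ˡ xs k _)

∑³-*ʳ : (xs : List A) (k : ℕ) (f : A → A → A → ℕ) →
  ∑ xs (λ x → ∑ xs (λ y → ∑ xs (λ z → f x y z * k))) ≡ ∑ xs (λ x → ∑ xs (λ y → ∑ xs (f x y))) * k
∑³-*ʳ xs k f = trans (∑-cong xs (λ x → trans (∑-cong xs (λ y → ∑-*ʳ xs k (f x y))) (∑-*ʳ xs k _))) (∑-*ʳ xs k _)

∈-filter : (p : A → Bool) (xs : List A) {x : A} → x ∈ xs → p x ≡ true → x ∈ filterᵇ p xs
∈-filter p (y ∷ xs) (here refl) e with p y
... | true = here refl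
∈-filter p (y ∷ xs) (there x∈) e with p y
... | true  = there (∈-filter p xs x∈ e)
... | false = ∈-filter p xs x∈ e

nonempty-filter : (p : A → Bool) (xs : List A) → 1 ≤ length (filterᵇ p xs) → ∃ λ x → x ∈ xs × p x ≡ true
nonempty-filter p xs h = first (filterᵇ p xs) h (filter-∈ p xs)
  where
  first : ∀ ys → 1 ≤ length ys → (∀ {y} → y ∈ ys → y ∈ xs × p y ≡ true) → ∃ λ x → x ∈ xs × p x ≡ true
  first (y ∷ ys) _ f = y , f (here refl)

-- The proportion left is at most d / (d + 1). It is relaxed to (d + 1) / (d + 2) so that the base
-- of the powers in the greedy count stays positive for d = 0.
fewer-left : ∀ d p a b → a + b ≤ suc d * a → suc (suc d) * (b * p) ≤ suc d * ((a + b) * p)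
fewer-left d p a b h = by-slack (a * p) (*-monoˡ-≤ p h) (ident d p a b)
  where
  ident : ∀ d p a b → suc (suc d) * (b * p) + suc d * a * p + a * p ≡ suc d * ((a + b) * p) + (a + b) * p
  ident = solve-∀

-- Greedy set cover: each unit is chosen to serve a fixed proportion of the targets not served so far.
module Greedy {T : Set} (X : List A) (sh : Shape) (c : ℕ) (serves : Config sh A → T → Bool) (Valid : T → Set)
  (dense : ∀ t → Valid t → length X ^ dim sh ≤ suc c * ∑ (configs sh X) (λ x → ⟦ serves x t ⟧))
  (Tiles : List A → Set) (tiles-[] : Tiles []) (tiles-++ : ∀ {K L} → Tiles K → Tiles L → Tiles (K ++ L))
  (tiles-↭ : ∀ {K L} → K ↭ L → Tiles K → Tiles L) (vertices : T → List A)
  (sound : ∀ l → Sized sh l → ∀ t → Valid t → (∀ {x} → Choice sh x l → serves x t ≡ true) → Tiles (flat sh l) × Tiles (vertices t ++ flat sh l)) where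

  d : ℕ
  d = loss sh c

  Cover : ℕ → List T → List A → Set
  Cover s Ts rest = Σ (List A) λ Z → Σ (List A) λ R → rest ↭ Z ++ R × length Z ≤ s * clones sh × Tiles Z × (∀ {t} → t ∈ Ts → Tiles (vertices t ++ Z))

  module Step (s : ℕ) (Ts : List T) (used rest : List A) (valid : ∀ {t} → t ∈ Ts → Valid t) (1≤Ts : 1 ≤ length Ts)
    (l : Config sh (List A)) (R : List A) (r↭ : rest ↭ flat sh l ++ R) (sz : Sized sh l)
    (h : length Ts ≤ suc d * ∑ Ts (λ t → ⟦ allChoices sh l (λ x → serves x t) ⟧)) where

    hit : T → Bool
    hit t = allChoices sh l (λ x → serves x t)

    Ts′ : List T
    Ts′ = filterᵇ (not ∘ hit) Ts

    #hit : ℕ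
    #hit = length (filterᵇ hit Ts)

    split : length Ts ≡ #hit + length Ts′
    split = trans (↭-length (filter-split hit Ts)) (length-++ (filterᵇ hit Ts))

    h′ : length Ts ≤ suc d * #hit
    h′ = ≤-trans h (*-monoʳ-≤ (suc d) (≤-reflexive (sym (length-filter hit Ts))))

    fewer : length Ts * suc d ^ suc s < suc (suc d) ^ suc s → length Ts′ * suc d ^ s < suc (suc d) ^ s
    fewer few = *-cancelˡ-< (suc (suc d)) _ _ (≤-<-trans (begin
      suc (suc d) * (length Ts′ * suc d ^ s)
        ≤⟨ fewer-left d (suc d ^ s) #hit (length Ts′) (≤-trans (≤-reflexive (sym split)) h′) ⟩
      suc d * ((#hit + length Ts′) * suc d ^ s)
        ≡⟨ cong (λ z → suc d * (z * suc d ^ s)) (sym split) ⟩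
      suc d * (length Ts * suc d ^ s)
        ≡⟨ *-exchange (suc d) (length Ts) (suc d ^ s) ⟩
      length Ts * (suc d * suc d ^ s) ∎) few)
      where
      open ≤-Reasoning

    tiles-of : ∀ {t} → t ∈ Ts → hit t ≡ true → Tiles (flat sh l) × Tiles (vertices t ++ flat sh l)
    tiles-of {t} t∈ e = sound l sz t (valid t∈) (λ c → allChoices-∈ sh l _ e c)

    -- That a unit can be tiled by itself is read off from a target that it serves, which is why
    -- `Ts` has to be nonempty.
    unit-tiles : Tiles (flat sh l)
    unit-tiles = from (nonempty-filter hit Ts (positive #hit (≤-trans 1≤Ts h′)))
      where
      from : (∃ λ t → t ∈ Ts × hit t ≡ true) → Tiles (flat sh l)
      from (t , t∈ , e) = proj₁ (tiles-of t∈ e)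
      positive : ∀ k → 1 ≤ suc d * k → 1 ≤ k
      positive zero    p = ≤-trans p (≤-reflexive (*-zeroʳ (suc d)))
      positive (suc k) _ = s≤s z≤n

    combine : Cover s Ts′ R → Cover (suc s) Ts rest
    combine (Z , R′ , r↭′ , lZ , tZ , abs) = flat sh l ++ Z , R′ ,
      ptrans r↭ (ptrans (++⁺ˡ (flat sh l) r↭′) (↭-reflexive (sym (++-assoc (flat sh l) Z R′)))) ,
      ≤-trans (≤-reflexive (trans (length-++ (flat sh l)) (cong (_+ length Z) (length-flat sh l sz)))) (+-monoʳ-≤ (clones sh) lZ) ,
      tiles-++ unit-tiles tZ , λ {t} t∈ → served t∈ (hit t) refl
      where
      served : ∀ {t} → t ∈ Ts → ∀ b → hit t ≡ b → Tiles (vertices t ++ (flat sh l ++ Z))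
      served {t} t∈ true  e = tiles-↭ (↭-reflexive (++-assoc (vertices t) (flat sh l) Z)) (tiles-++ (proj₂ (tiles-of t∈ e)) tZ)
      served {t} t∈ false e = tiles-↭ (ptrans (↭-reflexive (sym (++-assoc (flat sh l) (vertices t) Z)))
        (ptrans (++⁺ʳ Z (++-comm (flat sh l) (vertices t))) (↭-reflexive (++-assoc (vertices t) (flat sh l) Z))))
        (tiles-++ unit-tiles (abs (∈-filter (not ∘ hit) Ts t∈ (cong not e))))

  greedy : ∀ s (Ts : List T) used rest → X ↭ used ++ rest → (∀ {t} → t ∈ Ts → Valid t) →
    length Ts * suc d ^ s < suc (suc d) ^ s → need sh c * (length used + s * clones sh) ≤ length X → Cover s Ts rest
  greedy s       []         used rest X↭ valid few big = [] , rest , prefl , z≤n , tiles-[] , (λ ())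
  -- With no steps left the invariant says that the number of targets is less than 1.
  greedy zero    (t ∷ Ts)   used rest X↭ valid (s≤s few) big = ⊥-elim (<⇒≱ (s≤s z≤n) few)
  greedy (suc s) Ts@(_ ∷ _) used rest X↭ valid few big = step (box sh c X used rest Ts serves X↭
      (≤-trans (*-monoʳ-≤ (need sh c) (+-monoʳ-≤ (length used) (m≤m+n (clones sh) (s * clones sh)))) big) dense-Ts)
    where
    dense-Ts : length X ^ dim sh * length Ts ≤ suc c * ∑ (configs sh X) (λ x → ∑ Ts (λ t → ⟦ serves x t ⟧))
    dense-Ts = begin
      length X ^ dim sh * length Ts        ≡⟨ trans (*-comm _ (length Ts)) (sym (∑-const Ts _)) ⟩
      ∑ Ts (λ _ → length X ^ dim sh)       ≤⟨ ∑-mono∈ Ts (λ {t} t∈ → dense t (valid t∈)) ⟩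
      ∑ Ts (λ t → suc c * ∑ (configs sh X) (λ x → ⟦ serves x t ⟧)) ≡⟨ ∑-*ˡ Ts (suc c) _ ⟩
      suc c * ∑ Ts (λ t → ∑ (configs sh X) (λ x → ⟦ serves x t ⟧)) ≡⟨ cong (suc c *_) (∑-swap Ts (configs sh X) _) ⟩
      suc c * ∑ (configs sh X) (λ x → ∑ Ts (λ t → ⟦ serves x t ⟧)) ∎
      where open ≤-Reasoning
    step : Boxed sh c rest Ts serves → Cover (suc s) Ts rest
    step (l , R , r↭ , sz , h) = S.combine (greedy s S.Ts′ (used ++ flat sh l) R
        (ptrans X↭ (ptrans (++⁺ˡ used r↭) (↭-reflexive (sym (++-assoc used (flat sh l) R)))))
        (λ t∈ → valid (proj₁ (filter-∈ (not ∘ S.hit) Ts t∈))) (S.fewer few)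
        (≤-trans (*-monoʳ-≤ (need sh c) (≤-reflexive (trans (cong (_+ s * clones sh) (trans (length-++ used) (cong (length used +_) (length-flat sh l sz))))
           (+-assoc (length used) (clones sh) (s * clones sh))))) big))
      where module S = Step s Ts used rest valid (s≤s z≤n) l R r↭ sz h

  -- A single cover can absorb any one target, but only once; absorbing r targets together takes r
  -- disjoint covers.
  repeat : (targets : List T) → (∀ {t} → t ∈ targets → Valid t) → (∀ t → Valid t → t ∈ targets) →
    ∀ s → length targets * suc d ^ s < suc (suc d) ^ s →
    ∀ r used rest → X ↭ used ++ rest → need sh c * (length used + r * (s * clones sh)) ≤ length X →
    Σ (List (List A)) λ Zs → Σ (List A) λ R → rest ↭ concat Zs ++ R × length Zs ≡ r ×
      All (λ Z → Tiles Z × (∀ t → Valid t → Tiles (vertices t ++ Z))) Zs × length (concat Zs) ≤ r * (s * clones sh)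
  repeat targets ok all s few zero    used rest X↭ big = [] , rest , prefl , refl , [] , z≤n
  repeat targets ok all s few (suc r) used rest X↭ big = first (greedy s targets used rest X↭ ok few
      (≤-trans (*-monoʳ-≤ (need sh c) (+-monoʳ-≤ (length used) (m≤m+n (s * clones sh) (r * (s * clones sh))))) big))
    where
    Family : ℕ → List A → Set
    Family r rest = Σ (List (List A)) λ Zs → Σ (List A) λ R → rest ↭ concat Zs ++ R × length Zs ≡ r ×
      All (λ Z → Tiles Z × (∀ t → Valid t → Tiles (vertices t ++ Z))) Zs × length (concat Zs) ≤ r * (s * clones sh)
    append : ∀ Z R → rest ↭ Z ++ R → length Z ≤ s * clones sh → Tiles Z → (∀ {t} → t ∈ targets → Tiles (vertices t ++ Z)) → Family r R → Family (suc r) rest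
    append Z R r↭ lZ tZ abs (Zs , R′ , r↭′ , lZs , az , l) = Z ∷ Zs , R′ ,
      ptrans r↭ (ptrans (++⁺ˡ Z r↭′) (↭-reflexive (sym (++-assoc Z (concat Zs) R′)))) , cong suc lZs ,
      (tZ , λ t v → abs (all t v)) ∷ az , ≤-trans (≤-reflexive (length-++ Z)) (+-mono-≤ lZ l)
    first : Cover s targets rest → Family (suc r) rest
    first (Z , R , r↭ , lZ , tZ , abs) = append Z R r↭ lZ tZ abs (repeat targets ok all s few r (used ++ Z) R
      (ptrans X↭ (ptrans (++⁺ˡ used r↭) (↭-reflexive (sym (++-assoc used Z R)))))
      (≤-trans (*-monoʳ-≤ (need sh c) (≤-trans (+-monoˡ-≤ (r * (s * clones sh)) (≤-trans (≤-reflexive (length-++ used)) (+-monoʳ-≤ (length used) lZ)))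
        (≤-reflexive (+-assoc (length used) (s * clones sh) (r * (s * clones sh)))))) big))

module AbsorberConstants (ν E K : ℕ) where

  open Absorber ν public

  chains-loss : ℕ
  chains-loss = K ^ suc μ

  abstract
    density : ℕ
    density = pred (E * (chains-loss * (chains-loss * chains-loss)))

    suc-density : 1 ≤ E → 1 ≤ K → suc density ≡ E * (chains-loss * (chains-loss * chains-loss))
    suc-density hE hK = m≤n⇒sucpred (*-mono-≤ hE (*-mono-≤ p (*-mono-≤ p p)))
      where
      p : 1 ≤ chains-loss
      p = m^n>0 K {{>-nonZero hK}} (suc μ)

  hit-loss room size : ℕ
  hit-loss = loss unit-shape density
  room     = need unit-shape density
  size     = clones unit-shape

module AbsorberFamily {n : ℕ} (H : ThreeGraph n) (ν E K : ℕ) (1≤E : 1 ≤ E) (1≤K : 1 ≤ K) where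

  open AbsorberConstants ν E K
  open Absorbing H ν hiding (μ; triple-shape; chain-shape; unit-shape) public

  chain-count : Fin n → Fin n → ℕ
  chain-count x y = ∑ (configs chain-shape V) (λ c → ⟦ chain x y c ⟧)

  Close : Fin n → Fin n → Set
  Close x y = length V ^ dim chain-shape ≤ K * chain-count x y

  chains-dense : ∀ k us y → length us ≡ k → All (λ u → Close u y) us →
    length V ^ dim (copies k chain-shape) ≤ K ^ k * ∑ (configs (copies k chain-shape) V) (λ c → ⟦ chains k us y c ⟧)
  chains-dense zero    []       y _ _        = s≤s z≤n
  chains-dense (suc k) (u ∷ us) y l (h ∷ hs) = begin
    length V ^ (dim chain-shape + dim (copies k chain-shape))
      ≡⟨ ^-distribˡ-+-* (length V) (dim chain-shape) (dim (copies k chain-shape)) ⟩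
    length V ^ dim chain-shape * length V ^ dim (copies k chain-shape)
      ≤⟨ *-mono-≤ h (chains-dense k us y (suc-injective l) hs) ⟩
    K * chain-count u y * (K ^ k * S)
      ≡⟨ exch K (chain-count u y) (K ^ k) S ⟩
    K * K ^ k * (chain-count u y * S)
      ≡⟨ cong (K * K ^ k *_) (sym (∑-product-∧ (configs chain-shape V) (configs (copies k chain-shape) V) (chain u y) (chains k us y))) ⟩
    K * K ^ k * ∑ (configs (copies (suc k) chain-shape) V) (λ c → ⟦ chains (suc k) (u ∷ us) y c ⟧) ∎
    where
    open ≤-Reasoning
    S = ∑ (configs (copies k chain-shape) V) (λ c → ⟦ chains k us y c ⟧)
    exch : ∀ a b c d → a * b * (c * d) ≡ a * c * (b * d)
    exch = solve-∀

  pattern-count : (τ₀ τ₁ τ₂ : Fin n → Bool) → ℕ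
  pattern-count τ₀ τ₁ τ₂ = ∑ V (λ a → ∑ V (λ b → ∑ V (λ c → ⟦ τ₀ a ∧ (τ₁ b ∧ (τ₂ c ∧ edge H a b c)) ⟧)))

  module _ {τ₀ τ₁ τ₂ : Fin n → Bool} (pattern-dense : length V ^ 3 ≤ E * pattern-count τ₀ τ₁ τ₂)
    (closed₀ : ∀ x y → τ₀ x ≡ true → τ₀ y ≡ true → Close x y)
    (closed₁ : ∀ x y → τ₁ x ≡ true → τ₁ y ≡ true → Close x y)
    (closed₂ : ∀ x y → τ₂ x ≡ true → τ₂ y ≡ true → Close x y) where

    -- Every edge with the prescribed class pattern extends to many units: closedness joins each
    -- target vertex to the edge vertex of its own class, and the chains are chosen independently of
    -- each other.
    absorbs-dense : ∀ t → TargetOf τ₀ τ₁ τ₂ t →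
      length V ^ dim unit-shape ≤ suc density * ∑ (configs unit-shape V) (λ c → ⟦ absorbs c t ⟧)
    absorbs-dense t@(us , vs , ws) ((lu , hu) , (lv , hv) , (lw , hw)) = begin
      length V ^ (3 + (d + (d + d)))
        ≡⟨ trans (^-distribˡ-+-* (length V) 3 (d + (d + d))) (cong (length V ^ 3 *_)
             (trans (^-distribˡ-+-* (length V) d (d + d)) (cong (N *_) (^-distribˡ-+-* (length V) d d)))) ⟩
      length V ^ 3 * (N * (N * N))
        ≤⟨ *-monoˡ-≤ (N * (N * N)) pattern-dense ⟩
      E * pattern-count τ₀ τ₁ τ₂ * (N * (N * N))
        ≡⟨ *-assoc E _ _ ⟩
      E * (pattern-count τ₀ τ₁ τ₂ * (N * (N * N)))
        ≤⟨ *-monoʳ-≤ E main ⟩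
      E * (L * ∑ (configs unit-shape V) (λ c → ⟦ absorbs c t ⟧))
        ≡⟨ trans (sym (*-assoc E L _)) (cong (_* ∑ (configs unit-shape V) (λ c → ⟦ absorbs c t ⟧)) (sym (suc-density 1≤E 1≤K))) ⟩
      suc density * ∑ (configs unit-shape V) (λ c → ⟦ absorbs c t ⟧) ∎
      where
      open ≤-Reasoning
      sh = copies m chain-shape
      d = dim sh
      N = length V ^ d
      L = chains-loss * (chains-loss * chains-loss)
      others = cartesianProduct (configs sh V) (cartesianProduct (configs sh V) (configs sh V))
      S : List (Fin n) → Fin n → ℕ
      S us a = ∑ (configs sh V) (λ c → ⟦ chains m us a c ⟧)
      shuffle : ∀ k x y z → (k * x) * ((k * y) * (k * z)) ≡ k * (k * k) * (x * (y * z))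
      shuffle = solve-∀
      point : ∀ a b c → ⟦ τ₀ a ∧ (τ₁ b ∧ (τ₂ c ∧ edge H a b c)) ⟧ * (N * (N * N)) ≤ L * ∑ others (λ r → ⟦ absorbs ((a , b , c) , r) t ⟧)
      point a b c with τ₀ a in ea | τ₁ b in eb | τ₂ c in ec | edge H a b c
      ... | false | _     | _     | _     = z≤n
      ... | true  | false | _     | _     = z≤n
      ... | true  | true  | false | _     = z≤n
      ... | true  | true  | true  | false = z≤n
      ... | true  | true  | true  | true  = begin
        N * (N * N) + 0          ≡⟨ +-identityʳ _ ⟩
        N * (N * N)
          ≤⟨ *-mono-≤ (chains-dense m us a lu (All.map (λ {u} h → closed₀ u a h ea) hu))
             (*-mono-≤ (chains-dense m vs b lv (All.map (λ {u} h → closed₁ u b h eb) hv))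
                       (chains-dense m ws c lw (All.map (λ {u} h → closed₂ u c h ec) hw))) ⟩
        (chains-loss * S us a) * ((chains-loss * S vs b) * (chains-loss * S ws c))
          ≡⟨ shuffle chains-loss (S us a) (S vs b) (S ws c) ⟩
        L * (S us a * (S vs b * S ws c))
          ≡⟨ cong (L *_) (sym (trans (∑-product-∧ (configs sh V) (cartesianProduct (configs sh V) (configs sh V)) (chains m us a) _)
               (cong (S us a *_) (∑-product-∧ (configs sh V) (configs sh V) (chains m vs b) (chains m ws c))))) ⟩
        L * ∑ others (λ (p , q , r) → ⟦ chains m us a p ∧ (chains m vs b q ∧ chains m ws c r) ⟧) ∎
      main : pattern-count τ₀ τ₁ τ₂ * (N * (N * N)) ≤ L * ∑ (configs unit-shape V) (λ c → ⟦ absorbs c t ⟧)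
      main = begin
        pattern-count τ₀ τ₁ τ₂ * (N * (N * N))
          ≡⟨ sym (∑³-*ʳ V (N * (N * N)) (λ a b c → ⟦ τ₀ a ∧ (τ₁ b ∧ (τ₂ c ∧ edge H a b c)) ⟧)) ⟩
        ∑ V (λ a → ∑ V (λ b → ∑ V (λ c → ⟦ τ₀ a ∧ (τ₁ b ∧ (τ₂ c ∧ edge H a b c)) ⟧ * (N * (N * N)))))
          ≤⟨ ∑-mono V (λ a → ∑-mono V (λ b → ∑-mono V (point a b))) ⟩
        ∑ V (λ a → ∑ V (λ b → ∑ V (λ c → L * ∑ others (λ r → ⟦ absorbs ((a , b , c) , r) t ⟧))))
          ≡⟨ ∑³-*ˡ V L (λ a b c → ∑ others (λ r → ⟦ absorbs ((a , b , c) , r) t ⟧)) ⟩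
        L * ∑ V (λ a → ∑ V (λ b → ∑ V (λ c → ∑ others (λ r → ⟦ absorbs ((a , b , c) , r) t ⟧))))
          ≡⟨ cong (L *_) (sym (trans (∑-product (cartesianProduct V (cartesianProduct V V)) others (λ c → ⟦ absorbs c t ⟧))
               (trans (∑-product V (cartesianProduct V V) _) (∑-cong V (λ a → ∑-product V V _))))) ⟩
        L * ∑ (configs unit-shape V) (λ c → ⟦ absorbs c t ⟧) ∎

    Absorbs : List (Fin n) → Set
    Absorbs Z = Tileable Z × (∀ t → TargetOf τ₀ τ₁ τ₂ t → Tileable (vertices t ++ Z))

    targets : List Target
    targets = cartesianProduct (words m (filterᵇ τ₀ V)) (cartesianProduct (words m (filterᵇ τ₁ V)) (words m (filterᵇ τ₂ V)))

    targets-ok : ∀ {t} → t ∈ targets → TargetOf τ₀ τ₁ τ₂ t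
    targets-ok {us , vs , ws} t∈ = let (u∈ , vw∈) = ∈-cartesianProduct⁻ (words m (filterᵇ τ₀ V)) _ t∈
                                       (v∈ , w∈)  = ∈-cartesianProduct⁻ (words m (filterᵇ τ₁ V)) _ vw∈
                                   in part τ₀ u∈ , part τ₁ v∈ , part τ₂ w∈
      where
      part : ∀ τ {u} → u ∈ words m (filterᵇ τ V) → length u ≡ m × All (λ x → τ x ≡ true) u
      part τ u∈ = let (l , a) = words-⊆ m u∈ in l , All.map (λ x∈ → proj₂ (filter-∈ τ V x∈)) a

    targets-all : ∀ t → TargetOf τ₀ τ₁ τ₂ t → t ∈ targets
    targets-all (us , vs , ws) (hu , hv , hw) = ∈-cartesianProduct⁺ (part τ₀ us hu) (∈-cartesianProduct⁺ (part τ₁ vs hv) (part τ₂ ws hw))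
      where
      part : ∀ τ u → length u ≡ m × All (λ x → τ x ≡ true) u → u ∈ words m (filterᵇ τ V)
      part τ u (l , a) = subst (λ k → u ∈ words k (filterᵇ τ V)) l (∈-words u (All.map (λ e → ∈-filter τ V (∈-allFin _) e) a))

    few-targets : length targets ≤ n ^ (m + (m + m))
    few-targets = begin
      length targets ≡⟨ trans (length-product (words m (filterᵇ τ₀ V)) _) (cong (length (words m (filterᵇ τ₀ V)) *_)
                          (length-product (words m (filterᵇ τ₁ V)) _)) ⟩
      length (words m (filterᵇ τ₀ V)) * (length (words m (filterᵇ τ₁ V)) * length (words m (filterᵇ τ₂ V)))
        ≤⟨ *-mono-≤ (part τ₀) (*-mono-≤ (part τ₁) (part τ₂)) ⟩
      n ^ m * (n ^ m * n ^ m) ≡⟨ sym (trans (^-distribˡ-+-* n m (m + m)) (cong (n ^ m *_) (^-distribˡ-+-* n m m))) ⟩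
      n ^ (m + (m + m)) ∎
      where
      open ≤-Reasoning
      part : ∀ τ → length (words m (filterᵇ τ V)) ≤ n ^ m
      part τ = ≤-trans (≤-reflexive (length-words m (filterᵇ τ V))) (^-monoˡ-≤ m (≤-trans (≤-reflexive (length-filter τ V))
                 (≤-trans (count≤length V τ) (≤-reflexive (length-allFin n)))))

    sound : ∀ l → Sized unit-shape l → ∀ t → TargetOf τ₀ τ₁ τ₂ t → (∀ {x} → Choice unit-shape x l → absorbs x t ≡ true) →
      Tileable (flat unit-shape l) × Tileable (vertices t ++ flat unit-shape l)
    sound l sz (us , vs , ws) ((lu , _) , (lv , _) , (lw , _)) = unit-tiles l sz us vs ws lu lv lw

    absorbers : ∀ s → n ^ (m + (m + m)) * suc hit-loss ^ s < suc (suc hit-loss) ^ s →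
      ∀ r used rest → V ↭ used ++ rest → room * (length used + r * (s * size)) ≤ length V →
      Σ (List (List (Fin n))) λ Zs → Σ (List (Fin n)) λ R → rest ↭ concat Zs ++ R × length Zs ≡ r × All Absorbs Zs ×
        length (concat Zs) ≤ r * (s * size)
    absorbers s few = Greedy.repeat V unit-shape density absorbs (TargetOf τ₀ τ₁ τ₂) absorbs-dense Tileable tileable-[] tileable-++ tileable-↭ vertices sound
      targets targets-ok targets-all s (≤-<-trans (*-monoˡ-≤ (suc hit-loss ^ s) few-targets) few)

-- Common links

∑-*-∑ : (xs : List A) (ys : List B) (f : A → ℕ) (g : B → ℕ) → ∑ xs (λ x → ∑ ys (λ y → f x * g y)) ≡ ∑ xs f * ∑ ys g
∑-*-∑ xs ys f g = trans (∑-cong xs (λ x → ∑-*ˡ ys (f x) g)) (∑-*ʳ xs (∑ ys g) f)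

cauchy-schwarz : (xs : List A) (f : A → ℕ) → ∑ xs f * ∑ xs f ≤ length xs * ∑ xs (λ x → f x * f x)
cauchy-schwarz xs f = begin
  ∑ xs f * ∑ xs f                         ≡⟨ sq (∑ xs f) ⟩
  ∑ xs f ^ 2                              ≤⟨ power-mean 1 xs f ⟩
  length xs ^ 1 * ∑ xs (λ x → f x ^ 2)    ≡⟨ cong₂ _*_ (*-identityʳ (length xs)) (∑-cong xs (λ x → sym (sq (f x)))) ⟩
  length xs * ∑ xs (λ x → f x * f x)      ∎
  where
  open ≤-Reasoning
  sq : ∀ a → a * a ≡ a * (a * 1)
  sq = solve-∀

∑-V-const : ∀ n k → ∑ (allFin n) (λ _ → k) ≡ n * k
∑-V-const n k = trans (∑-const (allFin n) k) (cong (_* k) (length-allFin n))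

module Links {n : ℕ} (H : ThreeGraph n) (half : HalfCodegree H) where

  private
    V : List (Fin n)
    V = allFin n

  PP : List (Fin n × Fin n)
  PP = cartesianProduct V V

  length-PP : length PP ≡ n * n
  length-PP = trans (length-product V V) (cong₂ _*_ (length-allFin n) (length-allFin n))

  e : Fin n → Fin n × Fin n → ℕ
  e x (p , q) = ⟦ edge H x p q ⟧

  N : Fin n × Fin n → ℕ
  N π = ∑ V (λ x → e x π)

  N≡codeg : ∀ p q → N (p , q) ≡ codeg H p q
  N≡codeg p q = ∑-cong V (λ x → cong ⟦_⟧ (sym (edge-rotate H p q x)))

  e-loop : ∀ x p → edge H x p p ≡ false
  e-loop x p = trans (sym (edge-rotate H p p x)) (degen H p x)

  -- The factor `e x π` removes the loops p = q, at which `N` vanishes; every other pair has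
  -- codegree at least n/2.
  e-half : ∀ x π → e x π * n ≤ e x π * (2 * N π)
  e-half x (p , q) with p ≟ᶠ q
  ... | yes refl rewrite e-loop x p = z≤n
  ... | no  p≢q  = *-monoʳ-≤ (e x (p , q)) (≤-trans (half p q p≢q) (≤-reflexive (cong (2 *_) (sym (N≡codeg p q)))))

  e≤1 : ∀ x π → e x π ≤ 1
  e≤1 x (p , q) = ⟦⟧≤1 (edge H x p q)

  L : Fin n → ℕ
  L x = ∑ PP (e x)

  D : Fin n → Fin n → ℕ
  D x y = ∑ PP (λ π → e x π * e y π)

  D-sym : ∀ x y → D x y ≡ D y x
  D-sym x y = ∑-cong PP (λ π → *-comm (e x π) (e y π))

  D≤ : ∀ x y → D x y ≤ n * n
  D≤ x y = ≤-trans (∑-≤const PP 1 (λ (p , q) → *-mono-≤ (⟦⟧≤1 (edge H x p q)) (⟦⟧≤1 (edge H y p q))))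
    (≤-reflexive (trans (*-identityʳ _) length-PP))

  L-≥ : ∀ x → n * n ≤ 2 * L x + n
  L-≥ x = begin
    n * n                                               ≡⟨ sym (∑-V-const n n) ⟩
    ∑ V (λ p → n)                                       ≤⟨ ∑-mono V (half-codegree-δ H half x) ⟩
    ∑ V (λ p → 2 * codeg H x p + n * δ x p)             ≡⟨ trans (∑-+ V _ _) (cong₂ _+_ (∑-*ˡ V 2 _) (∑-*ˡ V n _)) ⟩
    2 * ∑ V (codeg H x) + n * ∑ V (δ x)                 ≤⟨ +-mono-≤ (≤-reflexive (cong (2 *_) (sym (∑-product V V (e x)))))
                                                            (≤-trans (*-monoʳ-≤ n (∑δ≤1 x)) (≤-reflexive (*-identityʳ n))) ⟩
    2 * L x + n                                         ∎
    where open ≤-Reasoning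

  L-≥-quarter : 2 ≤ n → ∀ x → n * n ≤ 4 * L x
  L-≥-quarter 2≤n x = by-slack 0 (+-mono-≤ (*-monoʳ-≤ 2 (L-≥ x)) (*-monoˡ-≤ n 2≤n)) (ident n (L x))
    where
    ident : ∀ n l → n * n + (2 * (2 * l + n) + n * n) + 0 ≡ 4 * l + (2 * (n * n) + 2 * n)
    ident = solve-∀

  -- Bonferroni's inequality for three links that each contain about half of all pairs.
  triangle : ∀ x y z → n * n ≤ 2 * (D x y + D y z + D x z) + 3 * n
  triangle x y z = by-slack 0 (+-mono-≤ (L-≥ x) (+-mono-≤ (L-≥ y) (+-mono-≤ (L-≥ z) (*-monoʳ-≤ 2 total))))
    (ident n (L x) (L y) (L z) (D x y) (D y z) (D x z))
    where
    bits : ∀ a b c → ⟦ a ⟧ + ⟦ b ⟧ + ⟦ c ⟧ ≤ 1 + (⟦ a ⟧ * ⟦ b ⟧ + ⟦ b ⟧ * ⟦ c ⟧ + ⟦ a ⟧ * ⟦ c ⟧)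
    bits true  true  true  = s≤s (s≤s (s≤s z≤n))
    bits true  true  false = s≤s (s≤s z≤n)
    bits true  false true  = s≤s (s≤s z≤n)
    bits true  false false = s≤s z≤n
    bits false true  true  = s≤s (s≤s z≤n)
    bits false true  false = s≤s z≤n
    bits false false true  = s≤s z≤n
    bits false false false = z≤n
    total : L x + L y + L z ≤ n * n + (D x y + D y z + D x z)
    total = begin
      L x + L y + L z                                 ≡⟨ sym (trans (∑-+ PP _ _) (cong (_+ L z) (∑-+ PP _ _))) ⟩
      ∑ PP (λ π → e x π + e y π + e z π)              ≤⟨ ∑-mono PP (λ (p , q) → bits (edge H x p q) (edge H y p q) (edge H z p q)) ⟩
      ∑ PP (λ π → 1 + (e x π * e y π + e y π * e z π + e x π * e z π))
        ≡⟨ trans (∑-+ PP _ _) (cong₂ _+_ (trans (∑-1 PP) length-PP) (trans (∑-+ PP _ _) (cong (_+ D x z) (∑-+ PP _ _)))) ⟩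
      n * n + (D x y + D y z + D x z)                 ∎
      where open ≤-Reasoning
    ident : ∀ n a b c d f g → n * n + (2 * a + n + (2 * b + n + (2 * c + n + 2 * (n * n + (d + f + g))))) + 0
          ≡ 2 * (d + f + g) + 3 * n + (n * n + (n * n + (n * n + 2 * (a + b + c))))
    ident = solve-∀

  ∑D : ∀ x → n * L x ≤ 2 * ∑ V (D x)
  ∑D x = begin
    n * L x                               ≡⟨ trans (*-comm n (L x)) (sym (∑-*ʳ PP n (e x))) ⟩
    ∑ PP (λ π → e x π * n)                ≤⟨ ∑-mono PP (e-half x) ⟩
    ∑ PP (λ π → e x π * (2 * N π))        ≡⟨ ∑-cong PP (λ π → exch (e x π) (N π)) ⟩
    ∑ PP (λ π → 2 * (e x π * N π))        ≡⟨ ∑-*ˡ PP 2 _ ⟩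
    2 * ∑ PP (λ π → e x π * N π)          ≡⟨ cong (2 *_) (trans (∑-cong PP (λ π → sym (∑-*ˡ V (e x π) (λ w → e w π)))) (∑-swap PP V _)) ⟩
    2 * ∑ V (D x)                         ∎
    where
    open ≤-Reasoning
    exch : ∀ a b → a * (2 * b) ≡ 2 * (a * b)
    exch = solve-∀

  ∑D-≥ : 5 ≤ n → ∀ x → n * n * n ≤ 5 * ∑ V (D x)
  ∑D-≥ 5≤n x = *-cancelˡ-≤ 4 (by-slack 0 (+-mono-≤ (*-monoʳ-≤ 10 (∑D x)) (+-mono-≤ (*-monoʳ-≤ (5 * n) (L-≥ x)) (*-monoˡ-≤ (n * n) 5≤n)))
    (ident n (L x) (∑ V (D x))))
    where
    ident : ∀ n l s → 4 * (n * n * n) + (10 * (2 * s) + (5 * n * (2 * l + n) + n * (n * n))) + 0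
          ≡ 4 * (5 * s) + (10 * (n * l) + (5 * n * (n * n) + 5 * (n * n)))
    ident = solve-∀

  -- Each factor measures the ways to perform one exchange, so this weighs the chains of three
  -- exchanges from x to y.
  C₃ : Fin n → Fin n → ℕ
  C₃ x y = ∑ V (λ w → ∑ V (λ w′ → D x w * D w w′ * D w′ y))

  -- Two applications of Cauchy–Schwarz: paths inside L a ∩ L b alone already give this many.
  pad : ∀ a b → D a b * D a b * D a b * (n * n) ≤ 16 * C₃ a b
  pad a b = cancel (length Q) refl
    where
    open ≤-Reasoning
    inQ : Fin n × Fin n → Bool
    inQ (p , q) = edge H a p q ∧ edge H b p q
    Q : List (Fin n × Fin n)
    Q = filterᵇ inQ PP
    ⟦inQ⟧ : ∀ π → ⟦ inQ π ⟧ ≡ e a π * e b π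
    ⟦inQ⟧ (p , q) = ⟦∧⟧ (edge H a p q) (edge H b p q)
    |Q| : length Q ≡ D a b
    |Q| = trans (length-filter inQ PP) (∑-cong PP ⟦inQ⟧)
    d : Fin n → ℕ
    d w = ∑ Q (e w)
    g : Fin n × Fin n → ℕ
    g π = ∑ V (λ w → e w π * d w)
    d≤a : ∀ w → d w ≤ D a w
    d≤a w = ≤-trans (≤-reflexive (∑-filter inQ PP (e w))) (∑-mono PP (λ π → *-monoˡ-≤ (e w π)
      (≤-trans (≤-reflexive (⟦inQ⟧ π)) (≤-trans (*-monoʳ-≤ (e a π) (e≤1 b π)) (≤-reflexive (*-identityʳ (e a π)))))))
    d≤b : ∀ w → d w ≤ D w b
    d≤b w = ≤-trans (≤-reflexive (∑-filter inQ PP (e w))) (∑-mono PP (λ π → ≤-trans (*-monoˡ-≤ (e w π)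
      (≤-trans (≤-reflexive (⟦inQ⟧ π)) (≤-trans (*-monoˡ-≤ (e b π) (e≤1 a π)) (≤-reflexive (*-identityˡ (e b π)))))) (≤-reflexive (*-comm (e b π) (e w π)))))
    ∑d : length Q * n ≤ 2 * ∑ V d
    ∑d = begin
      length Q * n                    ≡⟨ sym (∑-const Q n) ⟩
      ∑ Q (λ _ → n)                   ≤⟨ ∑-mono∈ Q (λ {π} π∈ → full π (proj₂ (filter-∈ inQ PP π∈))) ⟩
      ∑ Q (λ π → 2 * N π)             ≡⟨ trans (∑-*ˡ Q 2 N) (cong (2 *_) (∑-swap Q V _)) ⟩
      2 * ∑ V d                       ∎
      where
      full : ∀ π → inQ π ≡ true → n ≤ 2 * N π
      full π@(p , q) h = subst (λ b → ⟦ b ⟧ * n ≤ ⟦ b ⟧ * (2 * N π) → n ≤ 2 * N π) (sym (proj₁ (∧-true {edge H a p q} h)))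
        (λ k → subst₂ _≤_ (*-identityˡ n) (*-identityˡ _) k) (e-half a π)
    ∑d² : ∑ V (λ w → d w * d w) ≡ ∑ Q g
    ∑d² = trans (∑-cong V (λ w → sym (∑-*ʳ Q (d w) (e w)))) (∑-swap V Q _)
    ∑g² : ∑ Q (λ π → g π * g π) ≤ C₃ a b
    ∑g² = begin
      ∑ Q (λ π → g π * g π)
        ≡⟨ ∑-cong Q (λ π → sym (∑-*-∑ V V (λ w → e w π * d w) (λ w → e w π * d w))) ⟩
      ∑ Q (λ π → ∑ V (λ w → ∑ V (λ w′ → (e w π * d w) * (e w′ π * d w′))))
        ≡⟨ trans (∑-swap Q V _) (∑-cong V (λ w → ∑-swap Q V _)) ⟩
      ∑ V (λ w → ∑ V (λ w′ → ∑ Q (λ π → (e w π * d w) * (e w′ π * d w′))))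
        ≤⟨ ∑-mono V (λ w → ∑-mono V (λ w′ → term w w′)) ⟩
      C₃ a b ∎
      where
      exch : ∀ a b c d → (a * b) * (c * d) ≡ b * d * (a * c)
      exch = solve-∀
      exch′ : ∀ a b c → a * b * c ≡ a * c * b
      exch′ = solve-∀
      term : ∀ w w′ → ∑ Q (λ π → (e w π * d w) * (e w′ π * d w′)) ≤ D a w * D w w′ * D w′ b
      term w w′ = begin
        ∑ Q (λ π → (e w π * d w) * (e w′ π * d w′)) ≡⟨ ∑-cong Q (λ π → exch (e w π) (d w) (e w′ π) (d w′)) ⟩
        ∑ Q (λ π → d w * d w′ * (e w π * e w′ π))   ≡⟨ ∑-*ˡ Q (d w * d w′) _ ⟩
        d w * d w′ * ∑ Q (λ π → e w π * e w′ π)     ≤⟨ *-mono-≤ (*-mono-≤ (d≤a w) (d≤b w′)) (∑-sub-filter w w′) ⟩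
        D a w * D w′ b * D w w′                     ≡⟨ exch′ (D a w) (D w′ b) (D w w′) ⟩
        D a w * D w w′ * D w′ b                     ∎
        where
        ∑-sub-filter : ∀ w w′ → ∑ Q (λ π → e w π * e w′ π) ≤ D w w′
        ∑-sub-filter w w′ = ≤-trans (≤-reflexive (∑-filter inQ PP _)) (∑-mono PP (λ π → ≤-trans (*-monoˡ-≤ (e w π * e w′ π) (⟦⟧≤1 (inQ π))) (≤-reflexive (*-identityˡ _))))
    q = length Q
    s = ∑ V (λ w → d w * d w)
    first : q * n * (q * n) ≤ 4 * (n * s)
    first = begin
      q * n * (q * n)                ≤⟨ *-mono-≤ ∑d ∑d ⟩
      2 * ∑ V d * (2 * ∑ V d)        ≡⟨ four (∑ V d) ⟩
      4 * (∑ V d * ∑ V d)            ≤⟨ *-monoʳ-≤ 4 (≤-trans (cauchy-schwarz V d) (≤-reflexive (cong (_* s) (length-allFin n)))) ⟩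
      4 * (n * s)                    ∎
      where
      four : ∀ a → 2 * a * (2 * a) ≡ 4 * (a * a)
      four = solve-∀
    second : s * s ≤ q * C₃ a b
    second = ≤-trans (≤-reflexive (cong₂ _*_ ∑d² ∑d²)) (≤-trans (cauchy-schwarz Q g) (*-monoʳ-≤ q ∑g²))
    -- Together `first` and `second` give (q n)^4 ≤ 16 n² s² ≤ 16 n² q C₃. Dividing by q n² needs a
    -- nonzero q, hence the case distinction.
    cancel : ∀ k → k ≡ q → D a b * D a b * D a b * (n * n) ≤ 16 * C₃ a b
    cancel zero    0≡q = subst (λ z → z * z * z * (n * n) ≤ 16 * C₃ a b) (trans 0≡q |Q|) z≤n
    cancel (suc k) k≡q = subst (λ z → z * z * z * (n * n) ≤ 16 * C₃ a b) |Q|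
      (*-cancelˡ-≤ q {{subst NonZero k≡q _}} (*-cancelˡ-≤ (n * n) {{n²≢0}} (begin
        n * n * (q * (q * q * q * (n * n)))       ≡⟨ lhs n q ⟩
        q * n * (q * n) * (q * n * (q * n))       ≤⟨ *-mono-≤ first first ⟩
        4 * (n * s) * (4 * (n * s))               ≡⟨ mid n s ⟩
        n * n * (16 * (s * s))                    ≤⟨ *-monoʳ-≤ (n * n) (*-monoʳ-≤ 16 second) ⟩
        n * n * (16 * (q * C₃ a b))               ≡⟨ cong (n * n *_) (exch 16 q (C₃ a b)) ⟩
        n * n * (q * (16 * C₃ a b))               ∎)))
      where
      lhs : ∀ n q → n * n * (q * (q * q * q * (n * n))) ≡ q * n * (q * n) * (q * n * (q * n))
      lhs = solve-∀
      mid : ∀ n s → 4 * (n * s) * (4 * (n * s)) ≡ n * n * (16 * (s * s))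
      mid = solve-∀
      exch : ∀ a b c → a * (b * c) ≡ b * (a * c)
      exch = solve-∀
      n≢0 : ∀ {n} → Fin n → NonZero n
      n≢0 {suc n} _ = _
      n²≢0 : NonZero (n * n)
      n²≢0 = m*n≢0 n n {{n≢0 a}} {{n≢0 a}}

-- The dichotomy: one exchange class or two

≤ᵇ-true : ∀ a b → (a ≤ᵇ b) ≡ true → a ≤ b
≤ᵇ-true a b h = ≤ᵇ⇒≤ a b (subst T (sym h) tt)

≤ᵇ-false : ∀ a b → (a ≤ᵇ b) ≡ false → b < a
≤ᵇ-false a b h = ≰⇒> (λ le → subst T h (≤⇒≤ᵇ le))

sq-cancel-≤ : ∀ a b → a * a ≤ b * b → a ≤ b
sq-cancel-≤ a b h with a ≤? b
... | yes p = p
... | no ¬p = ⊥-elim (<⇒≱ (*-mono-< (≰⇒> ¬p) (≰⇒> ¬p)) h)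

choose-true : ∀ q p t → not q ∨ (p ∧ t) ≡ true → q ≡ false ⊎ t ≡ true
choose-true false p    t h = inj₁ refl
choose-true true  true t h = inj₂ h

choose-false : ∀ q p t → not q ∨ (p ∧ t) ≡ false → p ≡ false ⊎ t ≡ false
choose-false true true  t h = inj₂ h
choose-false true false t h = inj₁ refl

-- Subtraction leaves 1/5 - 1/20 - 1/60 = 2/15. The weaker 1/120 is stated because it is also the
-- bound available for the vertices of a core.
weight-bound : ∀ n s a b j → n * n * n ≤ 5 * s → s ≤ a + b + n * n * j → 20 * a ≤ n * n * n → 60 * j ≤ n → n * n * n ≤ 120 * b
weight-bound n s a b j hs hw ha hj = ≤-trans (≤-trans (m≤m+n (n * n * n) (n * n * n + 0)) (*-cancelˡ-≤ 4 (by-slack 0 (+-mono-≤ (*-monoʳ-≤ 12 hs)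
    (+-mono-≤ (*-monoʳ-≤ 60 hw) (+-mono-≤ (*-monoʳ-≤ 3 ha) (*-monoʳ-≤ (n * n) hj)))) (ident n s a b j))))
    (*-monoˡ-≤ b (≤ᵇ⇒≤ 15 120 tt))
  where
  ident : ∀ n s a b j → 4 * (2 * (n * n * n)) + (12 * (5 * s) + (60 * (a + b + n * n * j) + (3 * (n * n * n) + n * n * n))) + 0
        ≡ 4 * (15 * b) + (12 * (n * n * n) + (60 * s + (3 * (20 * a) + n * n * (60 * j))))
  ident = solve-∀

-- The closedness constant `K` is independent of `Z`: the weight across the classes can be made as
-- small as later steps require without weakening the exchanges inside them.
record Split {n : ℕ} (H : ThreeGraph n) (half : HalfCodegree H) (K Z : ℕ) : Set where
  open Links H half
  field
    side        : Fin n → Bool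
    closed      : ∀ x y → side x ≡ side y → n * n * (n * n) * (n * n * (n * n)) ≤ K * C₃ x y
    cross-small : Z * ∑ (allFin n) (λ x → ∑ (allFin n) (λ y → ⟦ side x ⟧ * ⟦ not (side y) ⟧ * D x y)) ≤ n * n * (n * n)
    large       : n ≤ 10 * ∑ (allFin n) (λ x → ⟦ side x ⟧)
    large′      : n ≤ 10 * ∑ (allFin n) (λ x → ⟦ not (side x) ⟧)

module Dichotomy {n : ℕ} (H : ThreeGraph n) (half : HalfCodegree H) (6≤n : 6 ≤ n) (K : ℕ) (K-big : 12 * (120 * 120) ≤ K) where

  open Links H half

  private
    V : List (Fin n)
    V = allFin n
    n² n³ n⁴ : ℕ
    n² = n * n
    n³ = n * n * n
    n⁴ = n² * n²
    n≢0 : NonZero n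
    n≢0 = >-nonZero (≤-trans (s≤s z≤n) 6≤n)
    n²≢0 : NonZero n²
    n²≢0 = m*n≢0 n n {{n≢0}} {{n≢0}}
    5≤n : 5 ≤ n
    5≤n = ≤-trans (n≤1+n 5) 6≤n

  near : Fin n → Fin n → Bool
  near x y = n² ≤ᵇ 12 * D x y

  near-sym : ∀ x y → near x y ≡ near y x
  near-sym x y = cong (λ d → n² ≤ᵇ 12 * d) (D-sym x y)

  -- This fixes the constant 12: three overlaps below n²/12 would turn `triangle` into n² < n²/2 +
  -- 3n, which is false for n ≥ 6.
  far-triangle : ∀ x y z → near x y ≡ false → near y z ≡ false → near x z ≡ true
  far-triangle x y z xy yz with near x z in xz
  ... | true  = refl
  ... | false = ⊥-elim (<⇒≱ (+-mono-< (+-mono-< (≤ᵇ-false n² _ xy) (≤ᵇ-false n² _ yz)) (≤ᵇ-false n² _ xz))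
    (by-slack 0 (+-mono-≤ (*-monoʳ-≤ 6 (triangle x y z)) (*-monoʳ-≤ (3 * n) 6≤n)) (ident n (D x y) (D y z) (D x z))))
    where
    ident : ∀ n a b c → n * n + n * n + n * n + (6 * (2 * (a + b + c) + 3 * n) + 3 * n * n) + 0
          ≡ 12 * a + 12 * b + 12 * c + (6 * (n * n) + 3 * n * 6)
    ident = solve-∀

  weight : (Fin n → Bool) → Fin n → ℕ
  weight S x = ∑ V (λ w → ⟦ S w ⟧ * D x w)

  Clique : (Fin n → Bool) → Set
  Clique S = ∀ x y → S x ≡ true → S y ≡ true → near x y ≡ true

  -- Only the chains with both inner vertices in `S` are counted. There the middle weight is at
  -- least n²/s, and the two outer weights sum independently.
  clique-paths : ∀ s t S → (∀ x y → S x ≡ true → S y ≡ true → n² ≤ s * D x y) → ∀ x y → n³ ≤ t * weight S x → n³ ≤ t * weight S y →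
    n⁴ * n⁴ ≤ s * (t * t) * C₃ x y
  clique-paths s t S clique x y hx hy = begin
    n⁴ * n⁴                                                ≡⟨ eight n ⟩
    n² * (n³ * n³)                                         ≤⟨ *-monoʳ-≤ n² (*-mono-≤ hx hy) ⟩
    n² * (t * weight S x * (t * weight S y))               ≡⟨ consts t n² (weight S x) (weight S y) ⟩
    t * t * (n² * (weight S x * weight S y))               ≡⟨ cong (λ z → t * t * (n² * z)) (sym (∑-*-∑ V V _ _)) ⟩
    t * t * (n² * ∑ V (λ w → ∑ V (λ w′ → ⟦ S w ⟧ * D x w * (⟦ S w′ ⟧ * D y w′))))
      ≡⟨ cong (t * t *_) (sym (trans (∑-cong V (λ w → ∑-*ˡ V n² _)) (∑-*ˡ V n² _))) ⟩
    t * t * ∑ V (λ w → ∑ V (λ w′ → n² * (⟦ S w ⟧ * D x w * (⟦ S w′ ⟧ * D y w′))))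
      ≤⟨ *-monoʳ-≤ (t * t) (∑-mono V (λ w → ∑-mono V (term w))) ⟩
    t * t * ∑ V (λ w → ∑ V (λ w′ → s * (D x w * D w w′ * D w′ y)))
      ≡⟨ cong (t * t *_) (trans (∑-cong V (λ w → ∑-*ˡ V s _)) (∑-*ˡ V s _)) ⟩
    t * t * (s * C₃ x y)                                   ≡⟨ rotate (t * t) s (C₃ x y) ⟩
    s * (t * t) * C₃ x y                                   ∎
    where
    open ≤-Reasoning
    eight : ∀ n → n * n * (n * n) * (n * n * (n * n)) ≡ n * n * (n * n * n * (n * n * n))
    eight = solve-∀
    consts : ∀ t a b c → a * (t * b * (t * c)) ≡ t * t * (a * (b * c))
    consts = solve-∀
    rotate : ∀ p r x → p * (r * x) ≡ r * p * x
    rotate = solve-∀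
    one : ∀ a b c → a * ((b + 0) * (c + 0)) ≡ a * (b * c)
    one = solve-∀
    exch : ∀ s a b c → s * a * (b * c) ≡ s * (b * a * c)
    exch = solve-∀
    term : ∀ w w′ → n² * (⟦ S w ⟧ * D x w * (⟦ S w′ ⟧ * D y w′)) ≤ s * (D x w * D w w′ * D w′ y)
    term w w′ = bits (S w) (S w′) refl refl
      where
      bits : ∀ p q → S w ≡ p → S w′ ≡ q → n² * (⟦ p ⟧ * D x w * (⟦ q ⟧ * D y w′)) ≤ s * (D x w * D w w′ * D w′ y)
      bits false _     _  _   = ≤-trans (≤-reflexive (*-zeroʳ n²)) z≤n
      bits true  false _  _   = ≤-trans (≤-reflexive (trans (cong (n² *_) (*-zeroʳ (D x w + 0))) (*-zeroʳ n²))) z≤n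
      bits true  true  ew ew′ = begin
        n² * ((D x w + 0) * (D y w′ + 0))     ≡⟨ one n² (D x w) (D y w′) ⟩
        n² * (D x w * D y w′)                 ≤⟨ *-monoˡ-≤ (D x w * D y w′) (clique w w′ ew ew′) ⟩
        s * D w w′ * (D x w * D y w′)         ≡⟨ cong (λ z → s * D w w′ * (D x w * z)) (D-sym y w′) ⟩
        s * D w w′ * (D x w * D w′ y)         ≡⟨ exch s (D w w′) (D x w) (D w′ y) ⟩
        s * (D x w * D w w′ * D w′ y)         ∎

  clique-closed : ∀ S → Clique S → ∀ x y → n³ ≤ 120 * weight S x → n³ ≤ 120 * weight S y → n⁴ * n⁴ ≤ K * C₃ x y
  clique-closed S clique x y hx hy = ≤-trans (clique-paths 12 120 S (λ x y sx sy → ≤ᵇ-true n² _ (clique x y sx sy)) x y hx hy)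
    (*-monoˡ-≤ (C₃ x y) K-big)

  count : (Fin n → Bool) → ℕ
  count S = ∑ V (λ x → ⟦ S x ⟧)

  -- By `∑D-≥` the overlaps with x sum to at least n³/5. Vertices outside `S` and `J` contribute at
  -- most n³/12 in all and those of `J` at most n³/60, which leaves n³/10 for `S`.
  core-large : ∀ x S J → (∀ w → S w ≡ false → J w ≡ false → near x w ≡ false) → 60 * count J ≤ n → n ≤ 10 * count S
  core-large x S J far small = *-cancelˡ-≤ (6 * n²) {{m*n≢0 6 n² {{_}} {{n²≢0}}}} (by-slack 0
    (+-mono-≤ (*-monoʳ-≤ 12 (∑D-≥ 5≤n x)) (+-mono-≤ (*-monoʳ-≤ 5 upper) (*-monoʳ-≤ n² small)))
    (ident n (∑ V (D x)) (count S) (count J)))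
    where
    upper : 12 * ∑ V (D x) ≤ 12 * n² * count S + 12 * n² * count J + n * n²
    upper = begin
      12 * ∑ V (D x)                ≡⟨ sym (∑-*ˡ V 12 (D x)) ⟩
      ∑ V (λ w → 12 * D x w)        ≤⟨ ∑-mono V term ⟩
      ∑ V (λ w → 12 * n² * ⟦ S w ⟧ + 12 * n² * ⟦ J w ⟧ + n²)
        ≡⟨ trans (∑-+ V _ _) (cong₂ _+_ (trans (∑-+ V _ _) (cong₂ _+_ (∑-*ˡ V (12 * n²) _) (∑-*ˡ V (12 * n²) _))) (∑-V-const n n²)) ⟩
      12 * n² * count S + 12 * n² * count J + n * n² ∎
      where
      open ≤-Reasoning
      full : ∀ w → 12 * D x w ≤ 12 * n² * 1
      full w = ≤-trans (*-monoʳ-≤ 12 (D≤ x w)) (≤-reflexive (sym (*-identityʳ (12 * n²))))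
      term : ∀ w → 12 * D x w ≤ 12 * n² * ⟦ S w ⟧ + 12 * n² * ⟦ J w ⟧ + n²
      term w = bits (S w) (J w) refl refl
        where
        bits : ∀ p q → S w ≡ p → J w ≡ q → 12 * D x w ≤ 12 * n² * ⟦ p ⟧ + 12 * n² * ⟦ q ⟧ + n²
        bits true  _     _  _  = ≤-trans (full w) (≤-trans (m≤m+n _ _) (m≤m+n _ _))
        bits false true  _  _  = ≤-trans (full w) (≤-trans (m≤n+m _ (12 * n² * 0)) (m≤m+n _ _))
        bits false false ek ej = ≤-trans (<⇒≤ (≤ᵇ-false n² _ (far w ek ej))) (m≤n+m n² _)
    ident : ∀ n s k j → 6 * (n * n) * n + (12 * (5 * s) + (5 * (12 * (n * n) * k + 12 * (n * n) * j + n * (n * n)) + n * n * n)) + 0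
          ≡ 6 * (n * n) * (10 * k) + (12 * (n * n * n) + (5 * (12 * s) + n * n * (60 * j)))
    ident = solve-∀

  core-weight : ∀ S → Clique S → n ≤ 10 * count S → ∀ x → S x ≡ true → n³ ≤ 120 * weight S x
  core-weight S clique big x kx = begin
    n² * n                                     ≤⟨ *-monoʳ-≤ n² big ⟩
    n² * (10 * count S)                        ≡⟨ exch n² (count S) ⟩
    10 * (n² * count S)                        ≡⟨ cong (10 *_) (sym (∑-*ˡ V n² _)) ⟩
    10 * ∑ V (λ w → n² * ⟦ S w ⟧)              ≤⟨ *-monoʳ-≤ 10 (∑-mono V term) ⟩
    10 * ∑ V (λ w → 12 * (⟦ S w ⟧ * D x w))    ≡⟨ cong (10 *_) (∑-*ˡ V 12 _) ⟩
    10 * (12 * weight S x)                     ≡⟨ sym (*-assoc 10 12 (weight S x)) ⟩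
    120 * weight S x                           ∎
    where
    open ≤-Reasoning
    exch : ∀ a b → a * (10 * b) ≡ 10 * (a * b)
    exch = solve-∀
    term : ∀ w → n² * ⟦ S w ⟧ ≤ 12 * (⟦ S w ⟧ * D x w)
    term w = bits (S w) refl
      where
      bits : ∀ p → S w ≡ p → n² * ⟦ p ⟧ ≤ 12 * (⟦ p ⟧ * D x w)
      bits false _  = ≤-trans (≤-reflexive (*-zeroʳ n²)) z≤n
      bits true  ew = ≤-trans (≤-reflexive (*-identityʳ n²)) (≤-trans (≤ᵇ-true n² _ (clique x w kx ew)) (*-monoʳ-≤ 12 (≤-reflexive (sym (+-identityʳ (D x w))))))

  module FarPair (k : ℕ) (k-big : 48 * 60 ≤ k) (a b : Fin n) (few : k * k * C₃ a b < n⁴ * n⁴) where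

    open ≤-Reasoning

    -- A large common link of a and b would by `pad` already provide more chains between them than
    -- `few` allows.
    far-ab : near a b ≡ false
    far-ab = not-near (near a b) refl
      where
      k≥ : 12 * 12 ≤ k
      k≥ = ≤-trans (≤ᵇ⇒≤ (12 * 12) (48 * 60) tt) k-big
      k≥′ : 12 * 16 ≤ k
      k≥′ = ≤-trans (≤ᵇ⇒≤ (12 * 16) (48 * 60) tt) k-big
      cube : ∀ a → a * a * (a * a) ≡ a * a * a * a
      cube = solve-∀
      consts : ∀ t d c → t * d * (t * d) * (t * d) * c ≡ t * t * t * (d * d * d * c)
      consts = solve-∀
      group : ∀ p q r s x → p * q * r * (s * x) ≡ p * q * (r * s) * x
      group = solve-∀
      not-near : ∀ c → near a b ≡ c → c ≡ false
      not-near false _  = refl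
      not-near true  eq = ⊥-elim (<⇒≱ few (begin
          n⁴ * n⁴                                                   ≡⟨ cube n² ⟩
          n² * n² * n² * n²                                         ≤⟨ *-monoˡ-≤ n² (*-mono-≤ (*-mono-≤ h h) h) ⟩
          12 * D a b * (12 * D a b) * (12 * D a b) * n²             ≡⟨ consts 12 (D a b) n² ⟩
          12 * 12 * 12 * (D a b * D a b * D a b * n²)               ≤⟨ *-monoʳ-≤ (12 * 12 * 12) (pad a b) ⟩
          12 * 12 * 12 * (16 * C₃ a b)                              ≡⟨ group 12 12 12 16 (C₃ a b) ⟩
          12 * 12 * (12 * 16) * C₃ a b                              ≤⟨ *-monoˡ-≤ (C₃ a b) (*-mono-≤ k≥ k≥′) ⟩
          k * k * C₃ a b                                            ∎))
        where
        h : n² ≤ 12 * D a b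
        h = ≤ᵇ-true n² _ eq

    -- Every vertex is near a or near b. Those near only one of them form the cliques `K₁` and `K₂`,
    -- the cores of the two sides; `both` is the ambiguous remainder, to be shown small.
    α β K₁ K₂ both : Fin n → Bool
    α x = near a x
    β x = near b x
    K₁ x = not (β x)
    K₂ x = not (α x)
    both x = α x ∧ β x

    α-or-β : ∀ x → β x ≡ false → α x ≡ true
    α-or-β x h = far-triangle a b x far-ab h

    β-or-α : ∀ x → α x ≡ false → β x ≡ true
    β-or-α x h = far-triangle b a x (trans (near-sym b a) far-ab) h

    clique₁ : Clique K₁
    clique₁ x y hx hy = far-triangle x b y (trans (near-sym x b) (not-true hx)) (not-true hy)
      where
      not-true : ∀ {c} → not c ≡ true → c ≡ false
      not-true {false} _ = refl

    clique₂ : Clique K₂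
    clique₂ x y hx hy = far-triangle x a y (trans (near-sym x a) (not-true hx)) (not-true hy)
      where
      not-true : ∀ {c} → not c ≡ true → c ≡ false
      not-true {false} _ = refl

    cross : ℕ
    cross = ∑ V (λ x → ∑ V (λ y → ⟦ α x ⟧ * ⟦ β y ⟧ * D x y))

    -- When x is near a and y is near b, the outer weights of the chain a, x, y, b are at least
    -- n²/12 each, so a large `cross` would make `C₃ a b` large.
    cross-≤ : k * k * cross ≤ 144 * n⁴
    cross-≤ = *-cancelˡ-≤ n⁴ {{m*n≢0 n² n² {{n²≢0}} {{n²≢0}}}} (begin
      n⁴ * (k * k * cross)           ≡⟨ *-exchange n⁴ (k * k) cross ⟩
      k * k * (n⁴ * cross)           ≡⟨ cong (k * k *_) (sym (trans (∑-cong V (λ x → ∑-*ˡ V n⁴ _)) (∑-*ˡ V n⁴ _))) ⟩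
      k * k * ∑ V (λ x → ∑ V (λ y → n⁴ * (⟦ α x ⟧ * ⟦ β y ⟧ * D x y)))
        ≤⟨ *-monoʳ-≤ (k * k) (∑-mono V (λ x → ∑-mono V (term x))) ⟩
      k * k * ∑ V (λ x → ∑ V (λ y → 144 * (D a x * D x y * D y b)))
        ≡⟨ cong (k * k *_) (trans (∑-cong V (λ x → ∑-*ˡ V 144 _)) (∑-*ˡ V 144 _)) ⟩
      k * k * (144 * C₃ a b)         ≡⟨ *-exchange (k * k) 144 (C₃ a b) ⟩
      144 * (k * k * C₃ a b)         ≤⟨ *-monoʳ-≤ 144 (<⇒≤ few) ⟩
      144 * (n⁴ * n⁴)                ≡⟨ *-exchange 144 n⁴ n⁴ ⟩
      n⁴ * (144 * n⁴)                ∎)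
      where
      one : ∀ a d → a * a * (1 * 1 * d) ≡ a * a * d
      one = solve-∀
      consts : ∀ a b d → 12 * a * (12 * b) * d ≡ 144 * (a * d * b)
      consts = solve-∀
      term : ∀ x y → n⁴ * (⟦ α x ⟧ * ⟦ β y ⟧ * D x y) ≤ 144 * (D a x * D x y * D y b)
      term x y = bits (α x) (β y) refl refl
        where
        bits : ∀ p q → α x ≡ p → β y ≡ q → n⁴ * (⟦ p ⟧ * ⟦ q ⟧ * D x y) ≤ 144 * (D a x * D x y * D y b)
        bits false _     _  _  = ≤-trans (≤-reflexive (*-zeroʳ n⁴)) z≤n
        bits true  false _  _  = ≤-trans (≤-reflexive (*-zeroʳ n⁴)) z≤n
        bits true  true  ex ey = begin
          n⁴ * (1 * 1 * D x y)                   ≡⟨ one n² (D x y) ⟩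
          n² * n² * D x y                        ≤⟨ *-monoˡ-≤ (D x y) (*-mono-≤ (≤ᵇ-true n² _ ex) (≤-trans (≤ᵇ-true n² _ ey) (≤-reflexive (cong (12 *_) (D-sym b y))))) ⟩
          12 * D a x * (12 * D y b) * D x y      ≡⟨ consts (D a x) (D y b) (D x y) ⟩
          144 * (D a x * D x y * D y b)          ∎

    cross-≤′ : k * cross ≤ n⁴
    cross-≤′ = *-cancelˡ-≤ k {{>-nonZero (≤-trans (≤ᵇ⇒≤ 1 (48 * 60) tt) k-big)}} (begin
      k * (k * cross)   ≡⟨ sym (*-assoc k k cross) ⟩
      k * k * cross     ≤⟨ cross-≤ ⟩
      144 * n⁴          ≤⟨ *-monoˡ-≤ n⁴ (≤-trans (≤ᵇ⇒≤ 144 (48 * 60) tt) k-big) ⟩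
      k * n⁴            ∎)

    -- Links that each contain a quarter of all pairs cannot be almost disjoint on average:
    -- Cauchy-Schwarz over the pairs bounds their total overlap from below, and pairs of vertices of
    -- `both` are counted in `cross`.
    both-sq : n² * (count both * count both) ≤ 16 * cross
    both-sq = *-cancelˡ-≤ n² {{n²≢0}} (begin
      n² * (n² * (count both * count both))                       ≡⟨ sq n² (count both) ⟩
      n² * count both * (n² * count both)                         ≤⟨ *-mono-≤ each each ⟩
      4 * ∑ PP g * (4 * ∑ PP g)                             ≡⟨ four (∑ PP g) ⟩
      16 * (∑ PP g * ∑ PP g)                                ≤⟨ *-monoʳ-≤ 16 (≤-trans (cauchy-schwarz PP g) (*-mono-≤ (≤-reflexive length-PP) ∑g²)) ⟩
      16 * (n² * cross)                                     ≡⟨ *-exchange 16 n² cross ⟩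
      n² * (16 * cross)                                     ∎)
      where
      sq : ∀ a c → a * (a * (c * c)) ≡ a * c * (a * c)
      sq = solve-∀
      four : ∀ a → 4 * a * (4 * a) ≡ 16 * (a * a)
      four = solve-∀
      g : Fin n × Fin n → ℕ
      g π = ∑ V (λ x → ⟦ both x ⟧ * e x π)
      each : n² * count both ≤ 4 * ∑ PP g
      each = begin
        n² * count both                        ≡⟨ sym (∑-*ˡ V n² _) ⟩
        ∑ V (λ x → n² * ⟦ both x ⟧)            ≤⟨ ∑-mono V (λ x → *-monoˡ-≤ ⟦ both x ⟧ (L-≥-quarter (≤-trans (s≤s (s≤s z≤n)) 6≤n) x)) ⟩
        ∑ V (λ x → 4 * L x * ⟦ both x ⟧)       ≡⟨ ∑-cong V (λ x → exch′ (L x) ⟦ both x ⟧) ⟩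
        ∑ V (λ x → 4 * (⟦ both x ⟧ * L x))     ≡⟨ trans (∑-*ˡ V 4 _) (cong (4 *_) (trans (∑-cong V (λ x → sym (∑-*ˡ PP ⟦ both x ⟧ (e x)))) (∑-swap V PP _))) ⟩
        4 * ∑ PP g                          ∎
        where
        exch′ : ∀ a b → 4 * a * b ≡ 4 * (b * a)
        exch′ = solve-∀
      ∑g² : ∑ PP (λ π → g π * g π) ≤ cross
      ∑g² = begin
        ∑ PP (λ π → g π * g π)
          ≡⟨ ∑-cong PP (λ π → sym (∑-*-∑ V V (λ x → ⟦ both x ⟧ * e x π) (λ x → ⟦ both x ⟧ * e x π))) ⟩
        ∑ PP (λ π → ∑ V (λ x → ∑ V (λ y → ⟦ both x ⟧ * e x π * (⟦ both y ⟧ * e y π))))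
          ≡⟨ trans (∑-swap PP V _) (∑-cong V (λ x → ∑-swap PP V _)) ⟩
        ∑ V (λ x → ∑ V (λ y → ∑ PP (λ π → ⟦ both x ⟧ * e x π * (⟦ both y ⟧ * e y π))))
          ≡⟨ ∑-cong V (λ x → ∑-cong V (λ y → trans (∑-cong PP (λ π → regroup ⟦ both x ⟧ (e x π) ⟦ both y ⟧ (e y π))) (∑-*ˡ PP (⟦ both x ⟧ * ⟦ both y ⟧) _))) ⟩
        ∑ V (λ x → ∑ V (λ y → ⟦ both x ⟧ * ⟦ both y ⟧ * D x y))
          ≤⟨ ∑-mono V (λ x → ∑-mono V (λ y → *-monoˡ-≤ (D x y) (*-mono-≤ (left (α x) (β x)) (right (α y) (β y))))) ⟩
        cross ∎
        where
        regroup : ∀ a b c d → a * b * (c * d) ≡ a * c * (b * d)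
        regroup = solve-∀
        left : ∀ p q → ⟦ p ∧ q ⟧ ≤ ⟦ p ⟧
        left true  q = ⟦⟧≤1 q
        left false q = z≤n
        right : ∀ p q → ⟦ p ∧ q ⟧ ≤ ⟦ q ⟧
        right true  q = ≤-refl
        right false q = z≤n

    -- Since 16 * 144 = 48², the square root of the two preceding bounds is
    -- `k * count both ≤ 48 * n`; this is where the hypothesis `48 * 60 ≤ k` comes from.
    both-small : 60 * count both ≤ n
    both-small = *-cancelˡ-≤ 48 (begin
      48 * (60 * count both)   ≡⟨ sym (*-assoc 48 60 (count both)) ⟩
      48 * 60 * count both        ≤⟨ *-monoˡ-≤ (count both) k-big ⟩
      k * count both           ≤⟨ sq-cancel-≤ (k * count both) (48 * n) (*-cancelˡ-≤ n² {{n²≢0}} squares) ⟩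
      48 * n                ∎)
      where
      lhs : ∀ c k j → c * (k * j * (k * j)) ≡ k * k * (c * (j * j))
      lhs = solve-∀
      rhs : ∀ n → 16 * (144 * (n * n * (n * n))) ≡ n * n * (48 * n * (48 * n))
      rhs = solve-∀
      squares : n² * (k * count both * (k * count both)) ≤ n² * (48 * n * (48 * n))
      squares = begin
        n² * (k * count both * (k * count both))   ≡⟨ lhs n² k (count both) ⟩
        k * k * (n² * (count both * count both))   ≤⟨ *-monoʳ-≤ (k * k) both-sq ⟩
        k * k * (16 * cross)                 ≡⟨ *-exchange (k * k) 16 cross ⟩
        16 * (k * k * cross)                 ≤⟨ *-monoʳ-≤ 16 cross-≤ ⟩
        16 * (144 * n⁴)                      ≡⟨ rhs n ⟩
        n² * (48 * n * (48 * n))             ∎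

    large₁ : n ≤ 10 * count K₁
    large₁ = core-large a K₁ both (λ w k j → aux (α w) (β w) k j) both-small
      where
      aux : ∀ p q → not q ≡ false → p ∧ q ≡ false → p ≡ false
      aux false q _ _ = refl
      aux true true k ()

    large₂ : n ≤ 10 * count K₂
    large₂ = core-large b K₂ both (λ w k j → aux (α w) (β w) k j) both-small
      where
      aux : ∀ p q → not p ≡ false → p ∧ q ≡ false → q ≡ false
      aux true q _ j = j

    -- The cores go to their own sides. A vertex near both a and b goes with `K₁` if its overlap
    -- with `K₁` is substantial; otherwise nearly all of its overlap is with `K₂`.
    side : Fin n → Bool
    side x = not (β x) ∨ (α x ∧ (n³ ≤ᵇ 20 * weight K₁ x))

    raise : ∀ {x} → n³ ≤ 20 * weight K₁ x → n³ ≤ 120 * weight K₁ x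
    raise {x} h = ≤-trans h (*-monoˡ-≤ (weight K₁ x) (≤ᵇ⇒≤ 20 120 tt))

    side-true : ∀ x → side x ≡ true → n³ ≤ 120 * weight K₁ x
    side-true x h = from (choose-true (β x) (α x) (n³ ≤ᵇ 20 * weight K₁ x) h)
      where
      from : β x ≡ false ⊎ (n³ ≤ᵇ 20 * weight K₁ x) ≡ true → n³ ≤ 120 * weight K₁ x
      from (inj₁ eβ) = core-weight K₁ clique₁ large₁ x (cong not eβ)
      from (inj₂ t)  = raise {x} (≤ᵇ-true n³ _ t)

    side-false : ∀ x → side x ≡ false → n³ ≤ 120 * weight K₂ x
    side-false x h = from (choose-false (β x) (α x) (n³ ≤ᵇ 20 * weight K₁ x) h)
      where
      upper : ∑ V (D x) ≤ weight K₁ x + weight K₂ x + n² * count both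
      upper = begin
        ∑ V (D x) ≤⟨ ∑-mono V term ⟩
        ∑ V (λ w → ⟦ K₁ w ⟧ * D x w + ⟦ K₂ w ⟧ * D x w + n² * ⟦ both w ⟧)
          ≡⟨ trans (∑-+ V _ _) (cong₂ _+_ (∑-+ V _ _) (∑-*ˡ V n² _)) ⟩
        weight K₁ x + weight K₂ x + n² * count both ∎
        where
        term : ∀ w → D x w ≤ ⟦ K₁ w ⟧ * D x w + ⟦ K₂ w ⟧ * D x w + n² * ⟦ both w ⟧
        term w = bits (α w) (β w) (D x w) n² (D≤ x w)
          where
          bits : ∀ p q t N → t ≤ N → t ≤ ⟦ not q ⟧ * t + ⟦ not p ⟧ * t + N * ⟦ p ∧ q ⟧
          bits true  true  t N le = ≤-trans le (≤-reflexive (sym (*-identityʳ N)))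
          bits true  false t N le = ≤-trans (≤-trans (≤-reflexive (sym (+-identityʳ t))) (m≤m+n (t + 0) 0)) (m≤m+n _ _)
          bits false true  t N le = ≤-trans (≤-reflexive (sym (+-identityʳ t))) (m≤m+n _ _)
          bits false false t N le = ≤-trans (≤-trans (≤-reflexive (sym (+-identityʳ t))) (m≤m+n (t + 0) _)) (m≤m+n _ _)
      from : α x ≡ false ⊎ (n³ ≤ᵇ 20 * weight K₁ x) ≡ false → n³ ≤ 120 * weight K₂ x
      from (inj₁ eα) = core-weight K₂ clique₂ large₂ x (cong not eα)
      from (inj₂ t)  = weight-bound n (∑ V (D x)) (weight K₁ x) (weight K₂ x) (count both) (∑D-≥ 5≤n x) upper (<⇒≤ (≤ᵇ-false n³ _ t)) both-small

    split : Split H half K k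
    split = record
      { side = side
      ; closed = closed
      ; cross-small = ≤-trans (*-monoʳ-≤ k (∑-mono V (λ x → ∑-mono V (λ y →
          *-monoˡ-≤ (D x y) (*-mono-≤ (side⇒α x) (¬side⇒β y)))))) cross-≤′
      ; large = ≤-trans large₁ (*-monoʳ-≤ 10 (∑-mono V K₁⇒side))
      ; large′ = ≤-trans large₂ (*-monoʳ-≤ 10 (∑-mono V K₂⇒¬side))
      }
      where
      closed : ∀ x y → side x ≡ side y → n⁴ * n⁴ ≤ K * C₃ x y
      closed x y h = by-side (side x) refl (sym h)
        where
        by-side : ∀ c → side x ≡ c → side y ≡ c → n⁴ * n⁴ ≤ K * C₃ x y
        by-side true  hx hy = clique-closed K₁ clique₁ x y (side-true x hx) (side-true y hy)
        by-side false hx hy = clique-closed K₂ clique₂ x y (side-false x hx) (side-false y hy)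
      side⇒α : ∀ x → ⟦ side x ⟧ ≤ ⟦ α x ⟧
      side⇒α x = aux (β x) (α x) (n³ ≤ᵇ 20 * weight K₁ x) (α-or-β x)
        where
        aux : ∀ q p t → (q ≡ false → p ≡ true) → ⟦ not q ∨ (p ∧ t) ⟧ ≤ ⟦ p ⟧
        aux false p     t h rewrite h refl = ≤-refl
        aux true  true  t h = ⟦⟧≤1 t
        aux true  false t h = z≤n
      ¬side⇒β : ∀ x → ⟦ not (side x) ⟧ ≤ ⟦ β x ⟧
      ¬side⇒β x = aux (β x) (α x ∧ (n³ ≤ᵇ 20 * weight K₁ x))
        where
        aux : ∀ q t → ⟦ not (not q ∨ t) ⟧ ≤ ⟦ q ⟧
        aux false t = z≤n
        aux true  t = ⟦⟧≤1 (not t)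
      K₁⇒side : ∀ x → ⟦ K₁ x ⟧ ≤ ⟦ side x ⟧
      K₁⇒side x = aux (β x) (α x ∧ (n³ ≤ᵇ 20 * weight K₁ x))
        where
        aux : ∀ q t → ⟦ not q ⟧ ≤ ⟦ not q ∨ t ⟧
        aux false t = ≤-refl
        aux true  t = z≤n
      K₂⇒¬side : ∀ x → ⟦ K₂ x ⟧ ≤ ⟦ not (side x) ⟧
      K₂⇒¬side x = aux (β x) (α x) (n³ ≤ᵇ 20 * weight K₁ x) (β-or-α x)
        where
        aux : ∀ q p t → (p ≡ false → q ≡ true) → ⟦ not p ⟧ ≤ ⟦ not (not q ∨ (p ∧ t)) ⟧
        aux q true  t h = z≤n
        aux q false t h rewrite h refl = ≤-refl

  -- The threshold is quadratic in k because the size of `both` is obtained from a square root.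
  dichotomy : ∀ k → 48 * 60 ≤ k → (∀ x y → n⁴ * n⁴ ≤ k * k * C₃ x y) ⊎ Split H half K k
  dichotomy k k-big with all? (λ x → all? (λ y → n⁴ * n⁴ ≤? k * k * C₃ x y))
  ... | yes p = inj₁ p
  ... | no ¬p with ¬∀⟶∃¬ n _ (λ x → all? (λ y → n⁴ * n⁴ ≤? k * k * C₃ x y)) ¬p
  ...   | a , ¬q with ¬∀⟶∃¬ n _ (λ y → n⁴ * n⁴ ≤? k * k * C₃ a y) ¬q
  ...     | b , ¬r = inj₂ (FarPair.split k k-big a b (≰⇒> ¬r))

-- The parity structure

∑-min : (xs : List A) (f : A → ℕ) → 1 ≤ length xs → ∃ λ x → length xs * f x ≤ ∑ xs f
∑-min (x ∷ [])     f _ = x , ≤-refl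
∑-min (x ∷ y ∷ ys) f _ with ∑-min (y ∷ ys) f (s≤s z≤n)
... | z , h with ≤-total (f x) (f z)
...   | inj₁ fx≤fz = x , +-monoʳ-≤ (f x) (≤-trans (*-monoʳ-≤ (suc (length ys)) fx≤fz) h)
...   | inj₂ fz≤fx = z , +-mono-≤ fz≤fx h

xor-triangle : ∀ c a b → ⟦ a xor b ⟧ ≤ ⟦ c xor a ⟧ + ⟦ c xor b ⟧
xor-triangle true  true  b     = m≤n+m _ 0
xor-triangle true  false true  = ≤-refl
xor-triangle true  false false = z≤n
xor-triangle false true  true  = z≤n
xor-triangle false true  false = ≤-refl
xor-triangle false false b     = ≤-refl

-- side x = true puts x in the first class A; up to n³ / k triples, the edges are those with an odd number of vertices in A.
record Parity {n : ℕ} (H : ThreeGraph n) (half : HalfCodegree H) (K k : ℕ) : Set where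
  open Links H half
  field
    side   : Fin n → Bool
    closed : ∀ x y → side x ≡ side y → n * n * (n * n) * (n * n * (n * n)) ≤ K * C₃ x y
    parity-few : k * ∑ (allFin n) (λ x → ∑ (allFin n) (λ y → ∑ (allFin n) (λ z → ⟦ edge H x y z xor (side x xor (side y xor side z)) ⟧))) ≤ n * n * n
    half₁  : k * n ≤ 2 * k * ∑ (allFin n) (λ x → ⟦ side x ⟧) + 2 * n
    half₂  : k * n ≤ 2 * k * ∑ (allFin n) (λ x → ⟦ not (side x) ⟧) + 2 * n

module ParityOf {n : ℕ} (H : ThreeGraph n) (half : HalfCodegree H) (K Z k : ℕ) (1≤k : 1 ≤ k) (6≤n : 6 ≤ n) (k≤n : k ≤ n)
  (Z-big : 40 * k * 4 < Z) (S : Split H half K Z) where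

  open Links H half
  open Split S
  open ≤-Reasoning

  private
    V : List (Fin n)
    V = allFin n
    n² n³ n⁴ : ℕ
    n² = n * n
    n³ = n * n * n
    n⁴ = n² * n²
    n≢0 : NonZero n
    n≢0 = >-nonZero (≤-trans (s≤s z≤n) 6≤n)
    n²≢0 : NonZero n²
    n²≢0 = m*n≢0 n n {{n≢0}} {{n≢0}}

  a b : Fin n × Fin n → ℕ
  a π = ∑ V (λ x → ⟦ side x ⟧ * e x π)
  b π = ∑ V (λ x → ⟦ not (side x) ⟧ * e x π)

  a+b : ∀ π → a π + b π ≡ N π
  a+b π = trans (sym (∑-+ V _ _)) (∑-cong V (λ x → one (side x) (e x π)))
    where
    one : ∀ c d → ⟦ c ⟧ * d + ⟦ not c ⟧ * d ≡ d
    one true  d = trans (+-identityʳ _) (+-identityʳ d)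
    one false d = +-identityʳ d

  nA nB X : ℕ
  nA = ∑ V (λ x → ⟦ side x ⟧)
  nB = ∑ V (λ x → ⟦ not (side x) ⟧)
  X  = ∑ V (λ x → ∑ V (λ y → ⟦ side x ⟧ * ⟦ not (side y) ⟧ * D x y))

  nA+nB : nA + nB ≡ n
  nA+nB = trans (sym (∑-+ V _ _)) (trans (∑-cong V (λ x → one (side x))) (trans (∑-1 V) (length-allFin n)))
    where
    one : ∀ c → ⟦ c ⟧ + ⟦ not c ⟧ ≡ 1
    one true  = refl
    one false = refl

  ∑ab : ∑ PP (λ π → a π * b π) ≡ X
  ∑ab = trans (∑-cong PP (λ π → sym (∑-*-∑ V V (λ x → ⟦ side x ⟧ * e x π) (λ y → ⟦ not (side y) ⟧ * e y π))))
    (trans (∑-swap PP V _) (∑-cong V (λ x → trans (∑-swap PP V _) (∑-cong V (λ y →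
      trans (∑-cong PP (λ π → regroup ⟦ side x ⟧ (e x π) ⟦ not (side y) ⟧ (e y π))) (∑-*ˡ PP (⟦ side x ⟧ * ⟦ not (side y) ⟧) _))))))
    where
    regroup : ∀ a b c d → a * b * (c * d) ≡ a * c * (b * d)
    regroup = solve-∀

  mn : Fin n × Fin n → ℕ
  mn π = a π ⊓ b π

  N-loop : ∀ p → N (p , p) ≡ 0
  N-loop p = trans (∑-cong V (λ x → cong ⟦_⟧ (e-loop x p))) (trans (∑-const V 0) (*-zeroʳ (length V)))

  a-loop : ∀ p → a (p , p) ≡ 0
  a-loop p = m+n≡0⇒m≡0 (a (p , p)) (trans (a+b (p , p)) (N-loop p))

  b-loop : ∀ p → b (p , p) ≡ 0
  b-loop p = m+n≡0⇒n≡0 (a (p , p)) (trans (a+b (p , p)) (N-loop p))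

  N-pair : ∀ {p q} → p ≢ q → n ≤ 2 * (a (p , q) + b (p , q))
  N-pair {p} {q} p≢q = ≤-trans (half p q p≢q) (≤-reflexive (cong (2 *_) (sym (trans (a+b (p , q)) (N≡codeg p q)))))

  -- The larger of a and b is at least n/4.
  min-product : ∀ n a b → n ≤ 2 * (a + b) → n * (a ⊓ b) ≤ 4 * (a * b)
  min-product n a b h with ≤-total a b
  ... | inj₁ a≤b rewrite m≤n⇒m⊓n≡m a≤b = by-slack 0 (+-mono-≤ (*-monoʳ-≤ a h) (*-monoʳ-≤ (2 * a) a≤b)) (ident n a b)
    where
    ident : ∀ n a b → n * a + (a * (2 * (a + b)) + 2 * a * b) + 0 ≡ 4 * (a * b) + (a * n + 2 * a * a)
    ident = solve-∀
  ... | inj₂ b≤a rewrite m≥n⇒m⊓n≡n b≤a = by-slack 0 (+-mono-≤ (*-monoʳ-≤ b h) (*-monoʳ-≤ (2 * b) b≤a)) (ident n a b)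
    where
    ident : ∀ n a b → n * b + (b * (2 * (a + b)) + 2 * b * a) + 0 ≡ 4 * (a * b) + (b * n + 2 * b * b)
    ident = solve-∀

  n-min : ∀ π → n * mn π ≤ 4 * (a π * b π)
  n-min (p , q) with p ≟ᶠ q
  ... | yes refl = ≤-trans (≤-reflexive (trans (cong (λ c → n * (c ⊓ b (p , p))) (a-loop p)) (*-zeroʳ n))) z≤n
  ... | no  p≢q  = min-product n (a (p , q)) (b (p , q)) (N-pair p≢q)

  -- The products `a π * b π` sum to the weight across the classes, which `cross-small` bounds. So a
  -- typical pair has almost all of its neighbours in one class.
  ∑min : Z * ∑ PP mn ≤ 4 * n³
  ∑min = *-cancelˡ-≤ n {{n≢0}} (begin
    n * (Z * ∑ PP mn)                ≡⟨ *-exchange n Z (∑ PP mn) ⟩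
    Z * (n * ∑ PP mn)                ≡⟨ cong (Z *_) (sym (∑-*ˡ PP n mn)) ⟩
    Z * ∑ PP (λ π → n * mn π)        ≤⟨ *-monoʳ-≤ Z (∑-mono PP n-min) ⟩
    Z * ∑ PP (λ π → 4 * (a π * b π)) ≡⟨ cong (Z *_) (trans (∑-*ˡ PP 4 _) (cong (4 *_) ∑ab)) ⟩
    Z * (4 * X)                      ≡⟨ *-exchange Z 4 X ⟩
    4 * (Z * X)                      ≤⟨ *-monoʳ-≤ 4 cross-small ⟩
    4 * n⁴                           ≡⟨ ident n ⟩
    n * (4 * n³)                     ∎)
    where
    ident : ∀ n → 4 * (n * n * (n * n)) ≡ n * (4 * (n * n * n))
    ident = solve-∀

  -- If a class is too small, every pair has min(a, b) comparable with its degree into that class.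
  class-size : (s : Fin n → Bool) (c d : Fin n × Fin n → ℕ) → (∀ π → c π ≡ ∑ V (λ x → ⟦ s x ⟧ * e x π)) →
    (∀ p → c (p , p) ≡ 0) → (∀ {p q} → p ≢ q → n ≤ 2 * (c (p , q) + d (p , q))) → Z * ∑ PP (λ π → c π ⊓ d π) ≤ 4 * n³ →
    n ≤ 10 * ∑ V (λ x → ⟦ s x ⟧) → k * n ≤ 2 * k * ∑ V (λ x → ⟦ s x ⟧) + 2 * n
  class-size s c d c≡ c-loop pair small large with k * n ≤? 2 * k * ∑ V (λ x → ⟦ s x ⟧) + 2 * n
  ... | yes p = p
  ... | no ¬p = ⊥-elim (<⇒≱ Z-big (*-cancelˡ-≤ n³ {{m*n≢0 n² n {{n²≢0}} {{n≢0}}}} (begin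
      n³ * Z                                  ≡⟨ *-comm n³ Z ⟩
      Z * n³                                  ≤⟨ *-monoʳ-≤ Z total ⟩
      Z * (40 * (k * ∑ PP (λ π → c π ⊓ d π))) ≡⟨ exch Z k (∑ PP (λ π → c π ⊓ d π)) ⟩
      40 * k * (Z * ∑ PP (λ π → c π ⊓ d π))   ≤⟨ *-monoʳ-≤ (40 * k) small ⟩
      40 * k * (4 * n³)                       ≡⟨ sym (*-assoc (40 * k) 4 n³) ⟩
      40 * k * 4 * n³                         ≡⟨ *-comm (40 * k * 4) n³ ⟩
      n³ * (40 * k * 4)                       ∎)))
    where
    size = ∑ V (λ x → ⟦ s x ⟧)
    exch : ∀ z k m → z * (40 * (k * m)) ≡ 40 * k * (z * m)
    exch = solve-∀
    c≤size : ∀ π → c π ≤ size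
    c≤size π = ≤-trans (≤-reflexive (c≡ π)) (∑-mono V (λ x → ≤-trans (*-monoʳ-≤ ⟦ s x ⟧ (e≤1 x π)) (≤-reflexive (*-identityʳ _))))
    size≤n : size ≤ n
    size≤n = ≤-trans (count≤length V s) (≤-reflexive (length-allFin n))
    c≤min : ∀ π → c π ≤ k * (c π ⊓ d π)
    c≤min (p , q) with p ≟ᶠ q
    ... | yes refl = ≤-trans (≤-reflexive (c-loop p)) z≤n
    ... | no  p≢q with ≤-total (c (p , q)) (d (p , q))
    ...   | inj₁ c≤d = ≤-trans (≤-trans (≤-reflexive (sym (*-identityˡ _))) (*-monoˡ-≤ (c (p , q)) 1≤k))
                         (*-monoʳ-≤ k (≤-reflexive (sym (m≤n⇒m⊓n≡m c≤d))))
    ...   | inj₂ d≤c = ≤-trans (≤-trans (c≤size (p , q)) size≤n) (≤-trans n≤kd (*-monoʳ-≤ k (≤-reflexive (sym (m≥n⇒m⊓n≡n d≤c)))))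
      where
      n≤kd : n ≤ k * d (p , q)
      n≤kd = *-cancelˡ-≤ 2 (by-slack 0 (+-mono-≤ (<⇒≤ (≰⇒> ¬p)) (+-mono-≤ (*-monoʳ-≤ k (pair p≢q)) (*-monoʳ-≤ (2 * k) (c≤size (p , q)))))
        (ident n k (c (p , q)) (d (p , q)) size))
        where
        ident : ∀ n k c d s → 2 * n + (k * n + (k * (2 * (c + d)) + 2 * k * s)) + 0 ≡ 2 * (k * d) + (2 * k * s + 2 * n + (k * n + 2 * k * c))
        ident = solve-∀
    ∑c : n² * size ≤ 4 * ∑ PP c
    ∑c = begin
      n² * size                              ≡⟨ sym (∑-*ˡ V n² _) ⟩
      ∑ V (λ x → n² * ⟦ s x ⟧)               ≤⟨ ∑-mono V (λ x → *-monoˡ-≤ ⟦ s x ⟧ (L-≥-quarter (≤-trans (s≤s (s≤s z≤n)) 6≤n) x)) ⟩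
      ∑ V (λ x → 4 * L x * ⟦ s x ⟧)          ≡⟨ trans (∑-cong V (λ x → exch′ (L x) ⟦ s x ⟧)) (∑-*ˡ V 4 _) ⟩
      4 * ∑ V (λ x → ⟦ s x ⟧ * L x)          ≡⟨ cong (4 *_) (trans (∑-cong V (λ x → sym (∑-*ˡ PP ⟦ s x ⟧ (e x)))) (trans (∑-swap V PP _)
                                                  (∑-cong PP (λ π → sym (c≡ π))))) ⟩
      4 * ∑ PP c                             ∎
      where
      exch′ : ∀ a b → 4 * a * b ≡ 4 * (b * a)
      exch′ = solve-∀
    total : n³ ≤ 40 * (k * ∑ PP (λ π → c π ⊓ d π))
    total = begin
      n² * n                                 ≤⟨ *-monoʳ-≤ n² large ⟩
      n² * (10 * size)                       ≡⟨ exch″ n² size ⟩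
      10 * (n² * size)                       ≤⟨ *-monoʳ-≤ 10 ∑c ⟩
      10 * (4 * ∑ PP c)                      ≡⟨ sym (*-assoc 10 4 (∑ PP c)) ⟩
      40 * ∑ PP c                            ≤⟨ *-monoʳ-≤ 40 (≤-trans (∑-mono PP c≤min) (≤-reflexive (∑-*ˡ PP k _))) ⟩
      40 * (k * ∑ PP (λ π → c π ⊓ d π))      ∎
      where
      exch″ : ∀ a b → a * (10 * b) ≡ 10 * (a * b)
      exch″ = solve-∀

  sizeA : k * n ≤ 2 * k * nA + 2 * n
  sizeA = class-size side a b (λ _ → refl) a-loop N-pair ∑min large

  sizeB : k * n ≤ 2 * k * nB + 2 * n
  sizeB = class-size (not ∘ side) b a (λ _ → refl) b-loop
    (λ {p} {q} p≢q → ≤-trans (N-pair p≢q) (≤-reflexive (cong (2 *_) (+-comm (a (p , q)) (b (p , q))))))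
    (≤-trans (≤-reflexive (cong (Z *_) (∑-cong PP (λ π → ⊓-comm (b π) (a π))))) ∑min) large′

  χ : Fin n × Fin n → Bool
  χ π = b π ≤ᵇ a π

  -- The prediction is that z is joined to a pair exactly when z lies in the class holding the
  -- majority of its neighbours, as recorded by `χ`; this marks the failures.
  mis : Fin n → Fin n × Fin n → ℕ
  mis z (p , q) = ⟦ edge H z p q xor not (side z xor χ (p , q)) ⟧

  mis-true : ∀ π → χ π ≡ true → ∑ V (λ z → mis z π) + a π ≡ nA + b π
  mis-true π h = trans (sym (∑-+ V _ _)) (trans (∑-cong V (λ z → trans
      (cong (λ c → ⟦ edge H z (proj₁ π) (proj₂ π) xor not (side z xor c) ⟧ + ⟦ side z ⟧ * e z π) h)
      (bits (edge H z (proj₁ π) (proj₂ π)) (side z)))) (∑-+ V _ _))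
    where
    bits : ∀ c s → ⟦ c xor not (s xor true) ⟧ + ⟦ s ⟧ * ⟦ c ⟧ ≡ ⟦ s ⟧ + ⟦ not s ⟧ * ⟦ c ⟧
    bits true  true  = refl
    bits true  false = refl
    bits false true  = refl
    bits false false = refl

  mis-false : ∀ π → χ π ≡ false → ∑ V (λ z → mis z π) + b π ≡ nB + a π
  mis-false π h = trans (sym (∑-+ V _ _)) (trans (∑-cong V (λ z → trans
      (cong (λ c → ⟦ edge H z (proj₁ π) (proj₂ π) xor not (side z xor c) ⟧ + ⟦ not (side z) ⟧ * e z π) h)
      (bits (edge H z (proj₁ π) (proj₂ π)) (side z)))) (∑-+ V _ _))
    where
    bits : ∀ c s → ⟦ c xor not (s xor false) ⟧ + ⟦ not s ⟧ * ⟦ c ⟧ ≡ ⟦ not s ⟧ + ⟦ s ⟧ * ⟦ c ⟧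
    bits true  true  = refl
    bits true  false = refl
    bits false true  = refl
    bits false false = refl

  -- Failures are the x - c vertices missing from the majority class and the d neighbours in the
  -- other class. The majority class has x ≤ n/2 + n/k because its complement is large, and c ≥ n/2
  -- - d by the codegree, so M ≤ 2d + n/k.
  mis-bound : ∀ M c d x y → M + c ≡ x + d → x + y ≡ n → k * n ≤ 2 * k * y + 2 * n → n ≤ 2 * (c + d) → 2 * k * M ≤ 4 * k * d + 2 * n
  mis-bound M c d x y eq xy hy hcd = by-slack 0
    (+-mono-≤ (*-monoʳ-≤ (2 * k) (≤-reflexive eq)) (+-mono-≤ hy (+-mono-≤ (*-monoʳ-≤ k hcd) (*-monoʳ-≤ (2 * k) (≤-reflexive xy)))))
    (ident n k M c d x y)
    where
    ident : ∀ n k M c d x y → 2 * k * M + (2 * k * (x + d) + (2 * k * y + 2 * n + (k * (2 * (c + d)) + 2 * k * n))) + 0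
          ≡ 4 * k * d + 2 * n + (2 * k * (M + c) + (k * n + (k * n + 2 * k * (x + y))))
    ident = solve-∀

  mis-π : ∀ π → 2 * k * ∑ V (λ z → mis z π) ≤ 4 * k * mn π + 2 * n + 2 * k * n * δ (proj₁ π) (proj₂ π)
  mis-π (p , q) with p ≟ᶠ q
  ... | yes _  = ≤-trans (*-monoʳ-≤ (2 * k) (≤-trans (count≤length V _) (≤-reflexive (length-allFin n))))
                   (≤-trans (≤-reflexive (sym (*-identityʳ (2 * k * n)))) (m≤n+m _ _))
  ... | no p≢q = ≤-trans (by-colour (χ (p , q)) refl) (m≤m+n _ _)
    where
    by-colour : ∀ c → χ (p , q) ≡ c → 2 * k * ∑ V (λ z → mis z (p , q)) ≤ 4 * k * mn (p , q) + 2 * n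
    by-colour true h = ≤-trans (mis-bound _ (a (p , q)) (b (p , q)) nA nB (mis-true (p , q) h) nA+nB sizeB (N-pair p≢q))
      (≤-reflexive (cong (λ z → 4 * k * z + 2 * n) (sym (m≥n⇒m⊓n≡n (≤ᵇ-true _ _ h)))))
    by-colour false h = ≤-trans (mis-bound _ (b (p , q)) (a (p , q)) nB nA (mis-false (p , q) h) (trans (+-comm nB nA) nA+nB) sizeA
        (≤-trans (N-pair p≢q) (≤-reflexive (cong (2 *_) (+-comm (a (p , q)) (b (p , q)))))))
      (≤-reflexive (cong (λ z → 4 * k * z + 2 * n) (sym (m≤n⇒m⊓n≡m (<⇒≤ (≤ᵇ-false _ _ h))))))

  M : ℕ
  M = ∑ PP (λ π → ∑ V (λ z → mis z π))

  M-small : k * M ≤ 4 * n³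
  M-small = *-cancelˡ-≤ 2 (by-slack 0 (+-mono-≤ M≤ (+-mono-≤ min≤ (*-monoʳ-≤ (2 * n²) k≤n))) (ident n k M (∑ PP mn)))
    where
    M≤ : 2 * k * M ≤ 4 * k * ∑ PP mn + n * n * (2 * n) + 2 * k * n * n
    M≤ = begin
      2 * k * M                                       ≡⟨ sym (∑-*ˡ PP (2 * k) _) ⟩
      ∑ PP (λ π → 2 * k * ∑ V (λ z → mis z π))        ≤⟨ ∑-mono PP mis-π ⟩
      ∑ PP (λ π → 4 * k * mn π + 2 * n + 2 * k * n * δ (proj₁ π) (proj₂ π))
        ≡⟨ trans (∑-+ PP _ _) (cong₂ _+_ (trans (∑-+ PP _ _) (cong₂ _+_ (∑-*ˡ PP (4 * k) mn) (trans (∑-const PP (2 * n)) (cong (_* (2 * n)) length-PP))))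
             (∑-*ˡ PP (2 * k * n) _)) ⟩
      4 * k * ∑ PP mn + n * n * (2 * n) + 2 * k * n * ∑ PP (λ π → δ (proj₁ π) (proj₂ π))
        ≤⟨ +-monoʳ-≤ (4 * k * ∑ PP mn + n * n * (2 * n)) (*-monoʳ-≤ (2 * k * n) (≤-trans (≤-reflexive (∑-product V V _))
             (≤-trans (∑-≤const V 1 ∑δ≤1) (≤-reflexive (trans (*-identityʳ _) (length-allFin n)))))) ⟩
      4 * k * ∑ PP mn + n * n * (2 * n) + 2 * k * n * n ∎
    min≤ : 4 * k * ∑ PP mn ≤ 4 * n³
    min≤ = ≤-trans (*-monoˡ-≤ (∑ PP mn) (≤-trans (≤-trans (m≤m*n (4 * k) 40) (≤-reflexive (exch k))) (<⇒≤ Z-big))) ∑min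
      where
      exch : ∀ k → 4 * k * 40 ≡ 40 * k * 4
      exch = solve-∀
    ident : ∀ n k M s → 2 * (k * M) + (4 * k * s + n * n * (2 * n) + 2 * k * n * n + (4 * (n * n * n) + 2 * (n * n) * n)) + 0
          ≡ 2 * (4 * (n * n * n)) + (2 * k * M + (4 * k * s + 2 * (n * n) * k))
    ident = solve-∀

  -- The deviation from parity. It is symmetric in its three arguments, and up to the few failures
  -- counted by `M` it equals `G`, which sees only two of them; a symmetric function of this kind is
  -- nearly constant.
  F : Fin n → Fin n → Fin n → Bool
  F x y z = edge H x y z xor (side x xor (side y xor side z))

  G : Fin n → Fin n → Bool
  G p q = not (χ (p , q)) xor (side p xor side q)

  F-sym₁₂ : ∀ x y z → F x y z ≡ F y x z
  F-sym₁₂ x y z = cong₂ _xor_ (sym₁₂ H x y z) (swap-xor (side x) (side y) (side z))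
    where
    swap-xor : ∀ a b c → a xor (b xor c) ≡ b xor (a xor c)
    swap-xor = solve 3 (λ a b c → a :+ (b :+ c) := b :+ (a :+ c)) refl
      where open xor-∧-Solver

  F-sym₂₃ : ∀ x y z → F x y z ≡ F x z y
  F-sym₂₃ x y z = cong₂ (λ u v → u xor (side x xor v)) (sym₂₃ H x y z) (xor-comm (side y) (side z))

  FG : ∀ z p q → ⟦ F z p q xor G p q ⟧ ≡ mis z (p , q)
  FG z p q = cong ⟦_⟧ (ident (edge H z p q) (side z) (side p xor side q) (χ (p , q)))
    where
    ident : ∀ e z c x → (e xor (z xor c)) xor ((true xor x) xor c) ≡ e xor (true xor (z xor x))
    ident = solve 4 (λ e z c x → (e :+ (z :+ c)) :+ ((con true :+ x) :+ c) := e :+ (con true :+ (z :+ x))) refl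
      where open xor-∧-Solver

  ∑³ : (Fin n → Fin n → Fin n → ℕ) → ℕ
  ∑³ f = ∑ V (λ x → ∑ V (λ y → ∑ V (f x y)))

  ∑³-cong : ∀ {f g : Fin n → Fin n → Fin n → ℕ} → (∀ x y z → f x y z ≡ g x y z) → ∑³ f ≡ ∑³ g
  ∑³-cong h = ∑-cong V (λ x → ∑-cong V (λ y → ∑-cong V (h x y)))

  ∑³-mono : ∀ {f g : Fin n → Fin n → Fin n → ℕ} → (∀ x y z → f x y z ≤ g x y z) → ∑³ f ≤ ∑³ g
  ∑³-mono h = ∑-mono V (λ x → ∑-mono V (λ y → ∑-mono V (h x y)))

  ∑³-+ : ∀ f g → ∑³ (λ x y z → f x y z + g x y z) ≡ ∑³ f + ∑³ g
  ∑³-+ f g = trans (∑-cong V (λ x → trans (∑-cong V (λ y → ∑-+ V _ _)) (∑-+ V _ _))) (∑-+ V _ _)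

  ∑³-swap₁₂ : ∀ f → ∑³ f ≡ ∑³ (λ x y z → f y x z)
  ∑³-swap₁₂ f = ∑-swap V V _

  ∑³-swap₂₃ : ∀ f → ∑³ f ≡ ∑³ (λ x y z → f x z y)
  ∑³-swap₂₃ f = ∑-cong V (λ x → ∑-swap V V _)

  FG-total : ∑³ (λ z p q → ⟦ F z p q xor G p q ⟧) ≡ M
  FG-total = trans (∑³-cong FG) (sym (trans (∑-swap PP V _) (∑-cong V (λ z → ∑-product V V _))))

  -- Both values are compared with `F z p q` = `F p z q`: the first form is close to `G p q` and the
  -- second to `G z q`. Thus the first argument of `G` hardly matters, and `G₂` does the same for
  -- the second.
  G₁ : ∑³ (λ z p q → ⟦ G p q xor G z q ⟧) ≤ M + M
  G₁ = ≤-trans (∑³-mono (λ z p q → xor-triangle (F z p q) (G p q) (G z q))) (≤-reflexive (trans (∑³-+ _ _) (cong₂ _+_ FG-total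
    (trans (∑³-cong (λ z p q → cong (λ c → ⟦ c xor G z q ⟧) (F-sym₁₂ z p q))) (trans (∑³-swap₁₂ _) FG-total)))))

  G₂ : ∑³ (λ z q w → ⟦ G z q xor G z w ⟧) ≤ M + M
  G₂ = ≤-trans (∑³-mono (λ z q w → xor-triangle (F z q w) (G z q) (G z w))) (≤-reflexive (trans (∑³-+ _ _) (cong₂ _+_
    (trans (∑³-cong (λ z q w → cong (λ c → ⟦ c xor G z q ⟧) (trans (F-sym₂₃ z q w) (F-sym₁₂ z w q))))
      (trans (∑³-swap₂₃ _) (trans (∑³-swap₁₂ _) FG-total)))
    (trans (∑³-cong (λ z q w → cong (λ c → ⟦ c xor G z w ⟧) (F-sym₁₂ z q w))) (trans (∑³-swap₁₂ _) FG-total)))))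

  G-dist : Fin n × Fin n → ℕ
  G-dist (z , w) = ∑ PP (λ (p , q) → ⟦ G p q xor G z w ⟧)

  G-total : ∑ PP (G-dist) ≤ n * (4 * M)
  G-total = begin
    ∑ PP (G-dist)
      ≡⟨ trans (∑-product V V _) (∑-cong V (λ z → ∑-cong V (λ w → ∑-product V V _))) ⟩
    ∑ V (λ z → ∑ V (λ w → ∑ V (λ p → ∑ V (λ q → ⟦ G p q xor G z w ⟧))))
      ≤⟨ ∑-mono V (λ z → ∑-mono V (λ w → ∑-mono V (λ p → ∑-mono V (λ q →
           ≤-trans (≤-trans (≤-reflexive (cong ⟦_⟧ (xor-comm (G p q) (G z w)))) (xor-triangle (G z q) (G z w) (G p q)))
             (≤-reflexive (cong₂ _+_ refl (cong ⟦_⟧ (xor-comm (G z q) (G p q))))))))) ⟩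
    ∑ V (λ z → ∑ V (λ w → ∑ V (λ p → ∑ V (λ q → ⟦ G z q xor G z w ⟧ + ⟦ G p q xor G z q ⟧))))
      ≡⟨ trans (∑-cong V (λ z → ∑³-+ˡ z)) (∑-+ V _ _) ⟩
    ∑ V (λ z → ∑ V (λ w → ∑ V (λ p → ∑ V (λ q → ⟦ G z q xor G z w ⟧)))) + ∑ V (λ z → ∑ V (λ w → ∑ V (λ p → ∑ V (λ q → ⟦ G p q xor G z q ⟧))))
      ≡⟨ cong₂ _+_
           (trans (∑-cong V (λ z → trans (∑-cong V (λ w → ∑-V-const n _)) (trans (∑-*ˡ V n _) (cong (n *_) (∑-swap V V _))))) (∑-*ˡ V n _))
           (trans (∑-cong V (λ z → ∑-V-const n _)) (∑-*ˡ V n _)) ⟩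
    n * ∑³ (λ z q w → ⟦ G z q xor G z w ⟧) + n * ∑³ (λ z p q → ⟦ G p q xor G z q ⟧)
      ≤⟨ +-mono-≤ (*-monoʳ-≤ n G₂) (*-monoʳ-≤ n G₁) ⟩
    n * (M + M) + n * (M + M)
      ≡⟨ ident n M ⟩
    n * (4 * M) ∎
    where
    ident : ∀ n M → n * (M + M) + n * (M + M) ≡ n * (4 * M)
    ident = solve-∀
    ∑³-+ˡ : ∀ z → ∑ V (λ w → ∑ V (λ p → ∑ V (λ q → ⟦ G z q xor G z w ⟧ + ⟦ G p q xor G z q ⟧)))
          ≡ ∑ V (λ w → ∑ V (λ p → ∑ V (λ q → ⟦ G z q xor G z w ⟧))) + ∑ V (λ w → ∑ V (λ p → ∑ V (λ q → ⟦ G p q xor G z q ⟧)))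
    ∑³-+ˡ z = ∑³-+ (λ w p q → ⟦ G z q xor G z w ⟧) (λ w p q → ⟦ G p q xor G z q ⟧)

  -- A pair whose value under `G` disagrees least with the others; that value is the constant `g` to
  -- which `F` is compared.
  reference : ∃ λ π → length PP * G-dist π ≤ ∑ PP (G-dist)
  reference = ∑-min PP (G-dist) (≤-trans (*-mono-≤ (≤-trans (s≤s z≤n) 6≤n) (≤-trans (s≤s z≤n) 6≤n)) (≤-reflexive (sym length-PP)))

  g : Bool
  g = G (proj₁ (proj₁ reference)) (proj₂ (proj₁ reference))

  G-const : n * ∑ PP (λ (p , q) → ⟦ G p q xor g ⟧) ≤ 4 * M
  G-const = *-cancelˡ-≤ n {{n≢0}} (≤-trans (≤-reflexive (trans (sym (*-assoc n n _)) (cong (_* G-dist (proj₁ reference)) (sym length-PP))))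
    (≤-trans (proj₂ reference) G-total))

  F-const : k * ∑³ (λ x y z → ⟦ F x y z xor g ⟧) ≤ 20 * n³
  F-const = begin
    k * ∑³ (λ x y z → ⟦ F x y z xor g ⟧)
      ≤⟨ *-monoʳ-≤ k (∑³-mono (λ x y z → ≤-trans (xor-triangle (G y z) (F x y z) g) (≤-reflexive (cong (λ c → ⟦ c ⟧ + ⟦ G y z xor g ⟧) (xor-comm (G y z) (F x y z)))))) ⟩
    k * ∑³ (λ x y z → ⟦ F x y z xor G y z ⟧ + ⟦ G y z xor g ⟧)
      ≡⟨ cong (k *_) (trans (∑³-+ _ _) (cong₂ _+_ FG-total (trans (∑-V-const n _) (cong (n *_) (sym (∑-product V V _)))))) ⟩
    k * (M + n * ∑ PP (λ (p , q) → ⟦ G p q xor g ⟧))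
      ≤⟨ *-monoʳ-≤ k (+-monoʳ-≤ M G-const) ⟩
    k * (M + 4 * M)
      ≡⟨ ident k M ⟩
    5 * (k * M)
      ≤⟨ *-monoʳ-≤ 5 M-small ⟩
    5 * (4 * n³)
      ≡⟨ sym (*-assoc 5 4 n³) ⟩
    20 * n³ ∎
    where
    ident : ∀ k M → k * (M + 4 * M) ≡ 5 * (k * M)
    ident = solve-∀

  -- If the constant `g` is true, the classes are interchanged. Changing all three sides of a triple
  -- changes their parity by `g xor g xor g`, which is `g`, so the deviation becomes nearly zero.
  class-of : Fin n → Bool
  class-of x = side x xor g

  parity-structure : ∀ k′ → k ≡ 20 * k′ → Parity H half K k′
  parity-structure k′ k≡ = record
    { side = class-of
    ; closed = λ x y h → closed x y (xor-cancel g (side x) (side y) h)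
    ; parity-few = *-cancelˡ-≤ 20 (≤-trans (≤-reflexive (trans (sym (*-assoc 20 k′ _)) (cong₂ _*_ (sym k≡)
        (∑³-cong (λ x y z → cong ⟦_⟧ (shift-xor (edge H x y z) (side x) (side y) (side z) g)))))) F-const)
    ; half₁ = by-g g
    ; half₂ = by-g′ g
    }
    where
    xor-idʳ : ∀ s → s xor false ≡ s
    xor-idʳ true  = refl
    xor-idʳ false = refl
    xor-true : ∀ s → s xor true ≡ not s
    xor-true true  = refl
    xor-true false = refl
    not-xor-true : ∀ s → not (s xor true) ≡ s
    not-xor-true true  = refl
    not-xor-true false = refl
    xor-cancel : ∀ c a b → a xor c ≡ b xor c → a ≡ b
    xor-cancel c true  true  h = refl
    xor-cancel c false false h = refl
    xor-cancel true  true  false ()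
    xor-cancel false true  false ()
    xor-cancel true  false true  ()
    xor-cancel false false true  ()
    shift-xor : ∀ e x y z g → e xor ((x xor g) xor ((y xor g) xor (z xor g))) ≡ (e xor (x xor (y xor z))) xor g
    shift-xor = solve 5 (λ e x y z g → e :+ ((x :+ g) :+ ((y :+ g) :+ (z :+ g))) := (e :+ (x :+ (y :+ z))) :+ g) refl
      where open xor-∧-Solver
    rescale : ∀ c → k * n ≤ 2 * k * c + 2 * n → k′ * n ≤ 2 * k′ * c + 2 * n
    rescale c h = *-cancelˡ-≤ 20 (≤-trans (≤-trans (≤-reflexive (trans (sym (*-assoc 20 k′ n)) (cong (_* n) (sym k≡)))) h)
      (≤-trans (≤-reflexive (cong (λ z → 2 * z * c + 2 * n) k≡)) (≤-trans (m≤m+n _ (38 * n)) (≤-reflexive (ident k′ c n)))))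
      where
      ident : ∀ k c n → 2 * (20 * k) * c + 2 * n + 38 * n ≡ 20 * (2 * k * c + 2 * n)
      ident = solve-∀
    by-g : ∀ c → k′ * n ≤ 2 * k′ * ∑ V (λ x → ⟦ side x xor c ⟧) + 2 * n
    by-g false = ≤-trans (rescale nA sizeA) (≤-reflexive (cong (λ z → 2 * k′ * z + 2 * n) (∑-cong V (λ x → cong ⟦_⟧ (sym (xor-idʳ (side x)))))))
    by-g true  = ≤-trans (rescale nB sizeB) (≤-reflexive (cong (λ z → 2 * k′ * z + 2 * n) (∑-cong V (λ x → cong ⟦_⟧ (sym (xor-true (side x)))))))
    by-g′ : ∀ c → k′ * n ≤ 2 * k′ * ∑ V (λ x → ⟦ not (side x xor c) ⟧) + 2 * n
    by-g′ false = ≤-trans (rescale nB sizeB) (≤-reflexive (cong (λ z → 2 * k′ * z + 2 * n) (∑-cong V (λ x → cong (⟦_⟧ ∘ not) (sym (xor-idʳ (side x)))))))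
    by-g′ true  = ≤-trans (rescale nA sizeA) (≤-reflexive (cong (λ z → 2 * k′ * z + 2 * n) (∑-cong V (λ x → cong ⟦_⟧ (sym (not-xor-true (side x)))))))

-- Unbalanced tiles

least : {P : ℕ → Set} → (∀ x → Dec (P x)) → ∀ N → P N → ∃ λ d → P d × (∀ x → P x → d ≤ x)
least P? zero    p = zero , p , λ _ _ → z≤n
least {P} P? (suc N) p with P? 0
... | yes p₀ = zero , p₀ , λ _ _ → z≤n
... | no ¬p₀ with least (P? ∘ suc) N p
...   | d , q , min = suc d , q , bound
  where
  bound : ∀ x → P x → suc d ≤ x
  bound zero    px = ⊥-elim (¬p₀ px)
  bound (suc x) px = s≤s (min x px)

ceiling-root : ∀ m X → ∃ λ d → X ≤ d ^ suc m × (∀ x → X ≤ x ^ suc m → d ≤ x)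
ceiling-root m zero    = 0 , z≤n , λ _ _ → z≤n
ceiling-root m (suc X) = least (λ x → suc X ≤? x ^ suc m) (suc X)
  (≤-trans (≤-reflexive (sym (*-identityʳ (suc X)))) (*-monoʳ-≤ (suc X) (m^n>0 (suc X) m)))

^-cancel-≤ : ∀ m a b → a ^ suc m ≤ b ^ suc m → a ≤ b
^-cancel-≤ m a b h with a ≤? b
... | yes p = p
... | no ¬p = ⊥-elim (<⇒≱ (^-monoˡ-< (suc m) (≰⇒> ¬p)) h)

bernoulli-∸ : ∀ j N s → N ^ suc j ≤ (N ∸ s) ^ suc j + suc j * s * N ^ j
bernoulli-∸ zero N s = ≤-trans (≤-reflexive (*-identityʳ N)) (≤-trans (m≤n+m∸n N s) (≤-reflexive (ident s (N ∸ s))))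
  where
  ident : ∀ s x → s + x ≡ x * 1 + 1 * s * 1
  ident = solve-∀
bernoulli-∸ (suc j) N s = begin
  N * N ^ suc j                                            ≤⟨ *-monoˡ-≤ (N ^ suc j) (m≤n+m∸n N s) ⟩
  (s + (N ∸ s)) * N ^ suc j                                ≡⟨ *-distribʳ-+ (N ^ suc j) s (N ∸ s) ⟩
  s * N ^ suc j + (N ∸ s) * N ^ suc j                      ≤⟨ +-monoʳ-≤ (s * N ^ suc j) (*-monoʳ-≤ (N ∸ s) (bernoulli-∸ j N s)) ⟩
  s * N ^ suc j + (N ∸ s) * ((N ∸ s) ^ suc j + suc j * s * N ^ j)
    ≡⟨ ident s (N ∸ s) (N ^ suc j) ((N ∸ s) ^ suc j) (suc j) (N ^ j) ⟩
  (N ∸ s) * (N ∸ s) ^ suc j + s * N ^ suc j + suc j * s * ((N ∸ s) * N ^ j)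
    ≤⟨ +-monoʳ-≤ ((N ∸ s) * (N ∸ s) ^ suc j + s * N ^ suc j) (*-monoʳ-≤ (suc j * s) (*-monoˡ-≤ (N ^ j) (m∸n≤m N s))) ⟩
  (N ∸ s) * (N ∸ s) ^ suc j + s * N ^ suc j + suc j * s * N ^ suc j
    ≡⟨ ident′ ((N ∸ s) * (N ∸ s) ^ suc j) s (N ^ suc j) (suc j) ⟩
  (N ∸ s) ^ suc (suc j) + suc (suc j) * s * N ^ suc j ∎
  where
  open ≤-Reasoning
  ident : ∀ s x n p j q → s * n + x * (p + j * s * q) ≡ x * p + s * n + j * s * (x * q)
  ident = solve-∀
  ident′ : ∀ a s n j → a + s * n + j * s * n ≡ a + (1 + j) * s * n
  ident′ = solve-∀

-- Absence of repetitions, stated by counting so that passing to permutations and sublists is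
-- immediate from the sum lemmas.
Simple : ∀ {n} → List (Fin n) → Set
Simple xs = ∀ v → ∑ xs (δ v) ≤ 1

simple-sub : ∀ {n} {X : List (Fin n)} S R → X ↭ S ++ R → Simple X → Simple R
simple-sub S R p h v = ≤-trans (∑-sub {S = S} {R} (δ v) p) (h v)

simple-subˡ : ∀ {n} {X : List (Fin n)} S R → X ↭ S ++ R → Simple X → Simple S
simple-subˡ S R p h = simple-sub R S (ptrans p (++-comm S R)) h

simple-filter : ∀ {n} (c : Fin n → Bool) {X : List (Fin n)} → Simple X → Simple (filterᵇ c X)
simple-filter c {X} = simple-subˡ (filterᵇ c X) (filterᵇ (not ∘ c) X) (filter-split c X)

simple-take : ∀ {n} k {X : List (Fin n)} → Simple X → Simple (take k X)
simple-take k {X} = simple-subˡ (take k X) (drop k X) (↭-reflexive (sym (take++drop≡id k X)))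

δ-refl : ∀ {n} (v : Fin n) → δ v v ≡ 1
δ-refl v with v ≟ᶠ v
... | yes _ = refl
... | no ¬p = ⊥-elim (¬p refl)

∑δ-∈ : ∀ {n} {v : Fin n} {xs} → v ∈ xs → 1 ≤ ∑ xs (δ v)
∑δ-∈ {v = v} (here refl) = ≤-trans (≤-reflexive (sym (δ-refl v))) (m≤m+n _ _)
∑δ-∈ {v = v} {x ∷ xs} (there v∈) = ≤-trans (∑δ-∈ v∈) (m≤n+m _ (δ v x))

∑δ-∉ : ∀ {n} {v : Fin n} xs → ¬ (v ∈ xs) → ∑ xs (δ v) ≡ 0
∑δ-∉ [] v∉ = refl
∑δ-∉ {v = v} (x ∷ xs) v∉ with v ≟ᶠ x
... | yes refl = ⊥-elim (v∉ (here refl))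
... | no  _    = ∑δ-∉ xs (v∉ ∘ there)

sub-permutation : ∀ {n} (t X : List (Fin n)) → Simple t → (∀ {v} → v ∈ t → v ∈ X) → ∃ λ R → X ↭ t ++ R
sub-permutation []      X h sub = X , prefl
sub-permutation (x ∷ t) X h sub with pick (sub (here refl))
... | X′ , X↭ = let (R , p) = sub-permutation t X′ (λ v → ≤-trans (m≤n+m _ (δ v x)) (h v)) sub′ in R , ptrans X↭ (prep x p)
  where
  sub′ : ∀ {v} → v ∈ t → v ∈ X′
  sub′ {v} v∈ with ∈-resp-↭ X↭ (sub (there v∈))
  ... | there v∈X′ = v∈X′
  ... | here refl  = ⊥-elim (<⇒≱ (s≤s (∑δ-∈ v∈)) (≤-trans (≤-reflexive (cong (_+ ∑ t (δ x)) (sym (δ-refl x)))) (h x)))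

simple-++ : ∀ {n} (xs ys : List (Fin n)) → Simple xs → Simple ys → (∀ {v} → v ∈ xs → v ∈ ys → ⊥) → Simple (xs ++ ys)
simple-++ xs ys hx hy disj v = ≤-trans (≤-reflexive (∑-++ xs ys (δ v))) (bound (v ∈? xs))
  where
  open import Data.List.Membership.DecPropositional _≟ᶠ_ using (_∈?_)
  bound : Dec (v ∈ xs) → ∑ xs (δ v) + ∑ ys (δ v) ≤ 1
  bound (yes v∈) = ≤-trans (≤-reflexive (trans (cong (∑ xs (δ v) +_) (∑δ-∉ ys (disj v∈))) (+-identityʳ _))) (hx v)
  bound (no v∉)  = ≤-trans (≤-reflexive (cong (_+ ∑ ys (δ v)) (∑δ-∉ xs v∉))) (hy v)

-- A vertex common to two parts, with any vertex of the third, would be an edge on a degenerate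
-- triple; hence all parts must be nonempty.
simple-complete : ∀ {n} (H : ThreeGraph n) m {as bs cs} → Tiling.Complete H m as bs cs → ∃ (_∈ as) → ∃ (_∈ bs) → ∃ (_∈ cs) →
  Simple as → Simple bs → Simple cs → Simple (as ++ bs ++ cs)
simple-complete H m {as} {bs} {cs} full (a , a∈) (b , b∈) (c , c∈) sa sb sc =
  simple-++ as (bs ++ cs) sa (simple-++ bs cs sb sc bc) λ v∈as v∈ → abc v∈as (∈-++⁻ bs v∈)
  where
  absurd : ∀ {x y z} → edge H x y z ≡ true → edge H x y z ≡ false → ⊥
  absurd e f with trans (sym e) f
  ... | ()
  bc : ∀ {v} → v ∈ bs → v ∈ cs → ⊥
  bc {v} v∈b v∈c = absurd (full a∈ v∈b v∈c) (trans (sym (edge-rotate H v v a)) (degen H v a))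
  abc : ∀ {v} → v ∈ as → v ∈ bs ⊎ v ∈ cs → ⊥
  abc {v} v∈a (inj₁ v∈b) = absurd (full v∈a v∈b c∈) (degen H v c)
  abc {v} v∈a (inj₂ v∈c) = absurd (full v∈a b∈ v∈c) (trans (sym₂₃ H v b v) (degen H v b))

nearly-all : ∀ j N s → 30 * (suc j * s) ≤ N → 29 * N ^ suc j ≤ 30 * (N ∸ s) ^ suc j
nearly-all j N s h = by-slack 0 (+-mono-≤ (*-monoʳ-≤ 30 (bernoulli-∸ j N s)) (*-monoˡ-≤ (N ^ j) h)) (ident N ((N ∸ s) ^ suc j) (suc j * s) (N ^ j))
  where
  ident : ∀ N x s q → 29 * (N * q) + (30 * (x + s * q) + N * q) + 0 ≡ 30 * x + (30 * (N * q) + 30 * s * q)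
  ident = solve-∀

-- Each hypothesis loses a factor u / v. Passing to the pairs `Γ`, to their incidences `Y`, to those
-- kept by the chosen common neighbours, and to the fibre over one outside vertex leaves Z d up to
-- (u / v)^4, because A and O have nearly equal sizes.
chain-averages : ∀ u v A Z O d Γ Y ok f → 1 ≤ O → u * (A * Z) ≤ v * Γ → u * (Γ * d) ≤ v * Y → u * Y ≤ v * ok → ok ≤ O * f → u * O ≤ v * A →
  u * u * u * u * (Z * d) ≤ v * v * v * v * f
chain-averages u v A Z O d Γ Y ok f 1≤O hΓ hY hok hf hO = *-cancelˡ-≤ O {{>-nonZero 1≤O}} (begin
  O * (u * u * u * u * (Z * d))    ≡⟨ i₁ u O Z d ⟩
  u * u * u * (Z * d) * (u * O)    ≤⟨ *-monoʳ-≤ (u * u * u * (Z * d)) hO ⟩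
  u * u * u * (Z * d) * (v * A)    ≡⟨ i₂ u v A Z d ⟩
  u * u * v * d * (u * (A * Z))    ≤⟨ *-monoʳ-≤ (u * u * v * d) hΓ ⟩
  u * u * v * d * (v * Γ)          ≡⟨ i₃ u v d Γ ⟩
  u * v * v * (u * (Γ * d))        ≤⟨ *-monoʳ-≤ (u * v * v) hY ⟩
  u * v * v * (v * Y)              ≡⟨ i₄ u v Y ⟩
  v * v * v * (u * Y)              ≤⟨ *-monoʳ-≤ (v * v * v) hok ⟩
  v * v * v * (v * ok)             ≤⟨ *-monoʳ-≤ (v * v * v) (*-monoʳ-≤ v hf) ⟩
  v * v * v * (v * (O * f))        ≡⟨ i₅ v O f ⟩
  O * (v * v * v * v * f)          ∎)
  where
  open ≤-Reasoning
  i₁ : ∀ u O Z d → O * (u * u * u * u * (Z * d)) ≡ u * u * u * (Z * d) * (u * O)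
  i₁ = solve-∀
  i₂ : ∀ u v A Z d → u * u * u * (Z * d) * (v * A) ≡ u * u * v * d * (u * (A * Z))
  i₂ = solve-∀
  i₃ : ∀ u v d Γ → u * u * v * d * (v * Γ) ≡ u * v * v * (u * (Γ * d))
  i₃ = solve-∀
  i₄ : ∀ u v Y → u * v * v * (v * Y) ≡ v * v * v * (u * Y)
  i₄ = solve-∀
  i₅ : ∀ v O f → v * v * v * (v * (O * f)) ≡ O * (v * v * v * v * f)
  i₅ = solve-∀

-- Removing m from each of the Z degrees costs a further proportion 1 / v. For u = 29 and v = 30 the
-- numerical hypothesis holds, and 5/6 of Z d survives.
star-average : ∀ u v Z d m f g → 1 ≤ v → 5 * (v * v * v * v) + 6 * (v * v * v) ≤ 6 * (u * u * u * u) →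
  u * u * u * u * (Z * d) ≤ v * v * v * v * f → f ≤ g + Z * m → v * m ≤ d → 5 * d * Z ≤ 6 * g
star-average u v Z d m f g 1≤v num hf hg hm = *-cancelˡ-≤ (v * v * v * v) {{>-nonZero (*-mono-≤ (*-mono-≤ (*-mono-≤ 1≤v 1≤v) 1≤v) 1≤v)}}
  (by-slack 0 (+-mono-≤ (*-monoˡ-≤ (Z * d) num) (+-mono-≤ (*-monoʳ-≤ 6 hf) (+-mono-≤ (*-monoʳ-≤ (6 * (v * v * v * v)) hg) (*-monoʳ-≤ (6 * (v * v * v) * Z) hm))))
    (ident u v Z d m f g))
  where
  ident : ∀ u v Z d m f g → v * v * v * v * (5 * d * Z) + (6 * (u * u * u * u) * (Z * d) + (6 * (v * v * v * v * f) + (6 * (v * v * v * v) * (g + Z * m) + 6 * (v * v * v) * Z * d))) + 0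
        ≡ v * v * v * v * (6 * g) + ((5 * (v * v * v * v) + 6 * (v * v * v)) * (Z * d) + (6 * (u * u * u * u * (Z * d)) + (6 * (v * v * v * v) * f + 6 * (v * v * v) * Z * (v * m))))
  ident = solve-∀

-- The Kővári–Sós–Turán count: here m n^(m-1) ≤ d^m beats the (m-1) |A|^m / |Z| needed.
kst-count : ∀ ν n d A Z Q → let m = suc (suc ν) in m * n ^ suc ν ≤ d ^ m → 9 * A ≤ 5 * n → 4 * A ≤ 5 * Z → 1 ≤ A →
  (5 * d) ^ m * Z ≤ 6 ^ m * (A ^ m * Q) → m ≤ Q
kst-count ν n d A Z Q hd hA hZ 1≤A h with suc (suc ν) ≤? Q
... | yes p = p
... | no ¬p = ⊥-elim (<⇒≱ (*-monoʳ-< (20 * 6 ^ m * A ^ m) {{nz}} (≤-refl {m})) (begin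
    20 * 6 ^ m * A ^ m * m                               ≡⟨ i₁ (6 ^ m) A (A ^ suc ν) m ⟩
    5 * (6 ^ m * m * A ^ suc ν) * (4 * A)                ≤⟨ *-monoʳ-≤ (5 * (6 ^ m * m * A ^ suc ν)) hZ ⟩
    5 * (6 ^ m * m * A ^ suc ν) * (5 * Z)                ≤⟨ *-monoˡ-≤ (5 * Z) beats ⟩
    4 * (5 * d) ^ m * (5 * Z)                            ≡⟨ i₂ ((5 * d) ^ m) Z ⟩
    20 * ((5 * d) ^ m * Z)                               ≤⟨ *-monoʳ-≤ 20 h ⟩
    20 * (6 ^ m * (A ^ m * Q))                           ≡⟨ i₃ (6 ^ m) (A ^ m) Q ⟩
    20 * 6 ^ m * A ^ m * Q                               ≤⟨ *-monoʳ-≤ (20 * 6 ^ m * A ^ m) (≤-pred (≰⇒> ¬p)) ⟩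
    20 * 6 ^ m * A ^ m * suc ν                           ≡⟨⟩
    20 * 6 ^ m * A ^ m * pred m                          ∎))
  where
  open ≤-Reasoning
  m = suc (suc ν)
  nz : NonZero (20 * 6 ^ m * A ^ m)
  nz = m*n≢0 (20 * 6 ^ m) (A ^ m) {{m*n≢0 20 (6 ^ m) {{_}} {{m^n≢0 6 m}}}} {{m^n≢0 A m {{>-nonZero 1≤A}}}}
  i₁ : ∀ x A y m → 20 * x * (A * y) * m ≡ 5 * (x * m * y) * (4 * A)
  i₁ = solve-∀
  i₂ : ∀ x z → 4 * x * (5 * z) ≡ 20 * (x * z)
  i₂ = solve-∀
  i₃ : ∀ x y q → 20 * (x * (y * q)) ≡ 20 * x * y * q
  i₃ = solve-∀
  i₄ : ∀ x y m → 5 * (6 * (6 * x) * m * y) ≡ 36 * x * (5 * m * y)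
  i₄ = solve-∀
  i₅ : ∀ x m y → 36 * x * (5 * m * y) ≡ 4 * (5 * (m * (9 * x * y)))
  i₅ = solve-∀
  i₆ : ∀ m x y → 5 * (m * (x * y)) ≡ 5 * x * (m * y)
  i₆ = solve-∀
  -- With n ≥ 9A/5 the gain over m A^(m-1) is (5/6)^m (9/5)^(m-1) = (5/6) (3/2)^(m-1), at least 5/4
  -- because m ≥ 2. This makes up for |Z| being only 4/5 of |A|.
  beats : 5 * (6 ^ m * m * A ^ suc ν) ≤ 4 * (5 * d) ^ m
  beats = begin
    5 * (6 * (6 * 6 ^ ν) * m * A ^ suc ν)                ≡⟨ i₄ (6 ^ ν) (A ^ suc ν) m ⟩
    36 * 6 ^ ν * (5 * m * A ^ suc ν)                     ≤⟨ *-monoˡ-≤ (5 * m * A ^ suc ν) (*-monoʳ-≤ 36 (^-monoˡ-≤ ν (≤ᵇ⇒≤ 6 9 tt))) ⟩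
    36 * 9 ^ ν * (5 * m * A ^ suc ν)                     ≡⟨ i₅ (9 ^ ν) m (A ^ suc ν) ⟩
    4 * (5 * (m * (9 ^ suc ν * A ^ suc ν)))              ≡⟨ cong (λ z → 4 * (5 * (m * z))) (sym (^-distribʳ (suc ν) 9 A)) ⟩
    4 * (5 * (m * (9 * A) ^ suc ν))                      ≤⟨ *-monoʳ-≤ 4 (*-monoʳ-≤ 5 (*-monoʳ-≤ m (^-monoˡ-≤ (suc ν) hA))) ⟩
    4 * (5 * (m * (5 * n) ^ suc ν))                      ≡⟨ cong (λ z → 4 * (5 * (m * z))) (^-distribʳ (suc ν) 5 n) ⟩
    4 * (5 * (m * (5 ^ suc ν * n ^ suc ν)))              ≡⟨ cong (4 *_) (i₆ m (5 ^ suc ν) (n ^ suc ν)) ⟩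
    4 * (5 ^ m * (m * n ^ suc ν))                        ≤⟨ *-monoʳ-≤ 4 (*-monoʳ-≤ (5 ^ m) hd) ⟩
    4 * (5 ^ m * d ^ m)                                  ≡⟨ cong (4 *_) (sym (^-distribʳ m 5 d)) ⟩
    4 * (5 * d) ^ m                                      ∎

filter-sub : (c : A → Bool) {X W R : List A} (f : A → ℕ) → X ↭ W ++ R → ∑ (filterᵇ c R) f ≤ ∑ X f
filter-sub c {W = W} {R} f p = ≤-trans (≤-reflexive (∑-filter c R f)) (≤-trans (∑-mono R (λ x → ≤-trans (*-monoˡ-≤ (f x) (⟦⟧≤1 (c x))) (≤-reflexive (*-identityˡ (f x)))))
  (∑-sub {S = W} {R} f p))

count-split : (c : A → Bool) {X W R : List A} (f : A → Bool) → X ↭ W ++ R →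
  ∑ X (λ x → ⟦ c x ⟧ * ⟦ f x ⟧) ≤ length W + ∑ (filterᵇ c R) (λ x → ⟦ f x ⟧)
count-split c {W = W} {R} f p = ≤-trans (≤-reflexive (trans (∑-↭ _ p) (∑-++ W R _)))
  (+-mono-≤ (≤-trans (∑-≤const W 1 (λ x → *-mono-≤ (⟦⟧≤1 (c x)) (⟦⟧≤1 (f x)))) (≤-reflexive (*-identityʳ _))) (≤-reflexive (sym (∑-filter c R _))))

class-lower : ∀ k n c → 240 ≤ k → k * n ≤ 2 * k * c + 2 * n → 119 * n ≤ 240 * c
class-lower k n c h hc = *-cancelˡ-≤ k {{>-nonZero (≤-trans (≤ᵇ⇒≤ 1 240 tt) h)}} (*-cancelˡ-≤ 2 (by-slack 0
  (+-mono-≤ (*-monoʳ-≤ 240 hc) (*-monoʳ-≤ (2 * n) h)) (ident k n c)))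
  where
  ident : ∀ k n c → 2 * (k * (119 * n)) + (240 * (2 * k * c + 2 * n) + 2 * n * k) + 0 ≡ 2 * (k * (240 * c)) + (240 * (k * n) + 2 * n * 240)
  ident = solve-∀

class-upper : ∀ n c c′ → c + c′ ≡ n → 119 * n ≤ 240 * c → 240 * c′ ≤ 121 * n
class-upper n c c′ e h = by-slack 0 (+-mono-≤ (*-monoʳ-≤ 240 (≤-reflexive e)) h) (ident n c c′)
  where
  ident : ∀ n c c′ → 240 * c′ + (240 * n + 240 * c) + 0 ≡ 121 * n + (240 * (c + c′) + 119 * n)
  ident = solve-∀

list-lower : ∀ n w c l → 119 * n ≤ 240 * c → c ≤ w + l → 240 * w ≤ n → 118 * n ≤ 240 * l
list-lower n w c l hc hl hw = by-slack 0 (+-mono-≤ hc (+-mono-≤ (*-monoʳ-≤ 240 hl) hw)) (ident n w c l)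
  where
  ident : ∀ n w c l → 118 * n + (240 * c + (240 * (w + l) + n)) + 0 ≡ 240 * l + (119 * n + (240 * c + 240 * w))
  ident = solve-∀

five-ninths : ∀ a n → 240 * a ≤ 121 * n → 9 * a ≤ 5 * n
five-ninths a n h = *-cancelˡ-≤ 80 (by-slack (37 * n) (*-monoʳ-≤ 3 h) (ident a n))
  where
  ident : ∀ a n → 80 * (9 * a) + 3 * (121 * n) + 37 * n ≡ 80 * (5 * n) + 3 * (240 * a)
  ident = solve-∀

-- The number of vertices outside A in the unbalanced tile: 1 or 2 m - 1, where m = ν + 2.
imbalance : ℕ → Bool → ℕ
imbalance ν true  = 1
imbalance ν false = suc ν + suc (suc ν)

-- A tile whose third class has one vertex outside Z and the others in Z, where Z is a class with at most n/2 vertices.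
module Unbalanced {n : ℕ} (H : ThreeGraph n) (half : HalfCodegree H) (ν K k : ℕ) (P : Parity H half K k)
  (cond : CodegCondition (suc (suc ν)) H) (ζ : Bool)
  (ζ-small : 2 * ∑ (allFin n) (λ x → ⟦ not (Parity.side P x xor ζ) ⟧) ≤ n)
  (h : ℕ) (h-big : 180 * suc (suc ν) ≤ h) (k-big : 270 * h ≤ k)
  (W rest : List (Fin n)) (V↭ : allFin n ↭ W ++ rest) (w-small : 240 * length W ≤ n)
  (n-big : (30 * (length W + suc (suc ν))) ^ suc (suc ν) ≤ n) where

  m : ℕ
  m = suc (suc ν)

  open Tiling H m
  open Links H half
  open Parity P
  open ≤-Reasoning

  w : ℕ
  w = length W

  -- For `ζ = true` the small class Z is A, for `ζ = false` it is B.
  zb out : Fin n → Bool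
  zb x  = not (side x xor ζ)
  out x = side x xor ζ

  AL ZL OL : List (Fin n)
  AL = filterᵇ side rest
  ZL = filterᵇ zb rest
  OL = filterᵇ out rest

  cA cB cZ cO : ℕ
  cA = ∑ V (λ x → ⟦ side x ⟧)
  cB = ∑ V (λ x → ⟦ not (side x) ⟧)
  cZ = ∑ V (λ x → ⟦ zb x ⟧)
  cO = ∑ V (λ x → ⟦ out x ⟧)

  complement : (s : Fin n → Bool) → ∑ V (λ x → ⟦ s x ⟧) + ∑ V (λ x → ⟦ not (s x) ⟧) ≡ n
  complement s = trans (sym (∑-+ V _ _)) (trans (∑-cong V (λ x → one (s x))) (trans (∑-1 V) (length-allFin n)))
    where
    one : ∀ c → ⟦ c ⟧ + ⟦ not c ⟧ ≡ 1
    one true  = refl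
    one false = refl

  h≥180 : 180 ≤ h
  h≥180 = ≤-trans (m≤m*n 180 m) h-big

  k≥270 : 270 ≤ k
  k≥270 = ≤-trans (m≤m*n 270 h {{>-nonZero (≤-trans (≤ᵇ⇒≤ 1 180 tt) h≥180)}}) k-big

  lowerA : 119 * n ≤ 240 * cA
  lowerA = class-lower k n cA (≤-trans (≤ᵇ⇒≤ 240 270 tt) k≥270) half₁

  lowerB : 119 * n ≤ 240 * cB
  lowerB = class-lower k n cB (≤-trans (≤ᵇ⇒≤ 240 270 tt) k≥270) half₂

  xor-side : ∀ c → (∀ s → s xor c ≡ s) ⊎ (∀ s → s xor c ≡ not s)
  xor-side false = inj₁ (λ { true → refl ; false → refl })
  xor-side true  = inj₂ (λ { true → refl ; false → refl })

  lowerZ : 119 * n ≤ 240 * cZ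
  lowerZ with xor-side ζ
  ... | inj₁ e = ≤-trans lowerB (≤-reflexive (cong (240 *_) (∑-cong V (λ x → cong (⟦_⟧ ∘ not) (sym (e (side x)))))))
  ... | inj₂ e = ≤-trans lowerA (≤-reflexive (cong (240 *_) (∑-cong V (λ x → cong ⟦_⟧ (sym (trans (cong not (e (side x))) (not-involutive (side x))))))))

  lowerO : 119 * n ≤ 240 * cO
  lowerO with xor-side ζ
  ... | inj₁ e = ≤-trans lowerA (≤-reflexive (cong (240 *_) (∑-cong V (λ x → cong ⟦_⟧ (sym (e (side x)))))))
  ... | inj₂ e = ≤-trans lowerB (≤-reflexive (cong (240 *_) (∑-cong V (λ x → cong ⟦_⟧ (sym (e (side x)))))))

  upperO : 240 * cO ≤ 121 * n
  upperO = class-upper n cZ cO (trans (+-comm cZ cO) (complement out)) lowerZ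

  upperA : 240 * cA ≤ 121 * n
  upperA = class-upper n cB cA (trans (+-comm cB cA) (complement side)) lowerB

  list≥ : ∀ c → ∑ V (λ x → ⟦ c x ⟧) ≤ w + length (filterᵇ c rest)
  list≥ c = ≤-trans (∑-mono V (λ x → ≤-reflexive (sym (*-identityʳ ⟦ c x ⟧)))) (≤-trans (count-split c {W = W} {rest} (λ _ → true) V↭) (+-monoʳ-≤ w (≤-reflexive (∑-1 (filterᵇ c rest)))))

  list≤ : ∀ c → length (filterᵇ c rest) ≤ ∑ V (λ x → ⟦ c x ⟧)
  list≤ c = ≤-trans (≤-reflexive (length-filter c rest)) (∑-sub {S = W} {rest} _ V↭)

  lA lZ lO : ℕ
  lA = length AL
  lZ = length ZL
  lO = length OL

  A-lower : 118 * n ≤ 240 * lA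
  A-lower = list-lower n w cA lA lowerA (list≥ side) w-small

  Z-lower : 118 * n ≤ 240 * lZ
  Z-lower = list-lower n w cZ lZ lowerZ (list≥ zb) w-small

  O-lower : 118 * n ≤ 240 * lO
  O-lower = list-lower n w cO lO lowerO (list≥ out) w-small

  A-upper : 240 * lA ≤ 121 * n
  A-upper = ≤-trans (*-monoʳ-≤ 240 (list≤ side)) upperA

  O-upper : 240 * lO ≤ 121 * n
  O-upper = ≤-trans (*-monoʳ-≤ 240 (list≤ out)) upperO

  ratio : ∀ x y p q → 121 * q ≤ 118 * p → 118 * n ≤ 240 * x → 240 * y ≤ 121 * n → q * y ≤ p * x
  ratio x y p q num hx hy = *-cancelˡ-≤ 240 (≤-trans (≤-trans (≤-reflexive (*-exchange 240 q y)) (*-monoʳ-≤ q hy))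
    (≤-trans (≤-trans (≤-reflexive (mid q n)) (*-monoˡ-≤ n num)) (≤-trans (≤-reflexive (mid′ p n)) (≤-trans (*-monoʳ-≤ p hx) (≤-reflexive (*-exchange p 240 x))))))
    where
    mid : ∀ q n → q * (121 * n) ≡ 121 * q * n
    mid = solve-∀
    mid′ : ∀ p n → 118 * p * n ≡ p * (118 * n)
    mid′ = solve-∀

  third : ∀ x → 118 * n ≤ 240 * x → n ≤ 3 * x
  third x hx = *-cancelˡ-≤ 118 (≤-trans hx (≤-trans (*-monoˡ-≤ x (≤ᵇ⇒≤ 240 (118 * 3) tt)) (≤-reflexive (*-assoc 118 3 x))))

  1≤n : 1 ≤ n
  1≤n = ≤-trans (m^n>0 (30 * (w + m)) {{m*n≢0 30 (w + m) {{_}} {{>-nonZero (≤-trans (s≤s z≤n) (m≤n+m m w))}}}} m) n-big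

  positive : ∀ {x} → n ≤ 3 * x → 1 ≤ x
  positive {zero}  p = ⊥-elim (<⇒≱ 1≤n p)
  positive {suc x} p = s≤s z≤n

  1≤lZ : 1 ≤ lZ
  1≤lZ = positive (third lZ Z-lower)

  -- d is the ceiling of m^(1/m) n^(1-1/m).
  abstract
    root : ∃ λ d → m * n ^ suc ν ≤ d ^ m × (∀ x → m * n ^ suc ν ≤ x ^ m → d ≤ x)
    root = ceiling-root (suc ν) (m * n ^ suc ν)

  d : ℕ
  d = proj₁ root

  d-big : 30 * (w + m) ≤ d
  d-big = ^-cancel-≤ (suc ν) (30 * (w + m)) d (≤-trans n-big (≤-trans (≤-trans (m≤m*n n (n ^ ν) {{m^n≢0 n ν {{>-nonZero 1≤n}}}}) (m≤n*m (n ^ suc ν) m)) (proj₁ (proj₂ root))))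

  -- Since Z has at most n/2 vertices, the whole excess of the codegree over n/2 lies outside Z. The
  -- set `W` of used vertices can hide at most w of it.
  outside-degree : ∀ {p q} → p ≢ q → d ≤ w + ∑ OL (λ x → ⟦ edge H x p q ⟧)
  outside-degree {p} {q} p≢q = ≤-trans (proj₂ (proj₂ root) b root≤) (count-split out {W = W} {rest} (λ x → edge H x p q) V↭)
    where
    b = ∑ V (λ x → ⟦ out x ⟧ * ⟦ edge H x p q ⟧)
    codeg≤ : codeg H p q ≤ cZ + b
    codeg≤ = begin
      codeg H p q                                             ≡⟨ sym (N≡codeg p q) ⟩
      ∑ V (λ x → ⟦ edge H x p q ⟧)                            ≤⟨ ∑-mono V (λ x → bits (out x) (edge H x p q)) ⟩
      ∑ V (λ x → ⟦ zb x ⟧ + ⟦ out x ⟧ * ⟦ edge H x p q ⟧)     ≡⟨ ∑-+ V _ _ ⟩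
      cZ + b                                                  ∎
      where
      bits : ∀ o e → ⟦ e ⟧ ≤ ⟦ not o ⟧ + ⟦ o ⟧ * ⟦ e ⟧
      bits true  e = ≤-reflexive (sym (+-identityʳ _))
      bits false e = ≤-trans (⟦⟧≤1 e) (≤-reflexive refl)
    excess : 2 * codeg H p q ∸ n ≤ 2 * b
    excess = m≤n+o⇒m∸n≤o (2 * codeg H p q) n (≤-trans (*-monoʳ-≤ 2 codeg≤) (≤-trans (≤-reflexive (*-distribˡ-+ 2 cZ b)) (+-monoˡ-≤ (2 * b) ζ-small)))
    root≤ : m * n ^ suc ν ≤ b ^ m
    root≤ = *-cancelˡ-≤ (2 ^ m) {{m^n≢0 2 m}} (begin
      2 ^ m * (m * n ^ suc ν)            ≡⟨ sym (*-assoc (2 ^ m) m (n ^ suc ν)) ⟩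
      2 ^ m * m * n ^ suc ν              ≤⟨ proj₂ (cond p q p≢q) ⟩
      (2 * codeg H p q ∸ n) ^ m          ≤⟨ ^-monoˡ-≤ m excess ⟩
      (2 * b) ^ m                        ≡⟨ ^-distribʳ m 2 b ⟩
      2 ^ m * b ^ m                      ∎)

  μ : Fin n × Fin n → ℕ
  μ (p , q) = ∑ ZL (λ y → ⟦ not (edge H y p q) ⟧)

  small : Fin n × Fin n → Bool
  small π = h * μ π ≤ᵇ n

  pairs Γ : List (Fin n × Fin n)
  pairs = cartesianProduct AL ZL
  Γ = filterᵇ small pairs

  ∑μ : k * ∑ pairs μ ≤ n * n * n
  ∑μ = ≤-trans (*-monoʳ-≤ k total) parity-few
    where
    -- p lies in A while q and y lie in the same class, so an odd number of the three lies in A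
    -- whichever class Z is: a missing triple is a deviation from parity.
    bits : ∀ p q y → side p ≡ true → zb q ≡ true → zb y ≡ true →
      ⟦ not (edge H y p q) ⟧ ≤ ⟦ edge H p q y xor (side p xor (side q xor side y)) ⟧
    bits p q y sp zq zy rewrite sp | edge-rotate H p q y = aux (edge H y p q) (side q) (side y) ζ zq zy
      where
      aux : ∀ e a b z → not (a xor z) ≡ true → not (b xor z) ≡ true → ⟦ not e ⟧ ≤ ⟦ e xor (true xor (a xor b)) ⟧
      aux true  a     b     z     _ _ = z≤n
      aux false true  true  z     _ _ = ≤-refl
      aux false false false z     _ _ = ≤-refl
      aux false true  false true  _ ()
      aux false true  false false ()
      aux false false true  true  ()
      aux false false true  false _ ()
    total : ∑ pairs μ ≤ ∑ V (λ x → ∑ V (λ y → ∑ V (λ z → ⟦ edge H x y z xor (side x xor (side y xor side z)) ⟧)))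
    total = begin
      ∑ pairs μ ≡⟨ ∑-product AL ZL μ ⟩
      ∑ AL (λ p → ∑ ZL (λ q → ∑ ZL (λ y → ⟦ not (edge H y p q) ⟧)))
        ≤⟨ ∑-mono∈ AL (λ {p} p∈ → ∑-mono∈ ZL (λ {q} q∈ → ∑-mono∈ ZL (λ {y} y∈ →
             bits p q y (proj₂ (filter-∈ side rest p∈)) (proj₂ (filter-∈ zb rest q∈)) (proj₂ (filter-∈ zb rest y∈))))) ⟩
      ∑ AL (λ p → ∑ ZL (λ q → ∑ ZL (λ y → ⟦ edge H p q y xor (side p xor (side q xor side y)) ⟧)))
        ≤⟨ ∑-mono AL (λ p → ≤-trans (∑-mono ZL (λ q → filter-sub zb {W = W} {rest} _ V↭)) (filter-sub zb {W = W} {rest} _ V↭)) ⟩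
      ∑ AL (λ p → ∑ V (λ q → ∑ V (λ y → ⟦ edge H p q y xor (side p xor (side q xor side y)) ⟧)))
        ≤⟨ filter-sub side {W = W} {rest} _ V↭ ⟩
      ∑ V (λ x → ∑ V (λ y → ∑ V (λ z → ⟦ edge H x y z xor (side x xor (side y xor side z)) ⟧))) ∎

  bad : ℕ
  bad = length (filterᵇ (not ∘ small) pairs)

  -- A bad pair accounts for more than n/h of the at most n³/k missing triples. The factor 270 in
  -- `k-big` is 30 * 9, where 9 comes from A and Z having at least n/3 vertices left.
  bad-few : 30 * bad ≤ lA * lZ
  bad-few = *-cancelˡ-≤ 9 (begin
    9 * (30 * bad)          ≡⟨ sym (*-assoc 9 30 bad) ⟩
    270 * bad               ≤⟨ *-cancelˡ-≤ h {{h≢0}} (≤-trans (≤-reflexive (exch h 270 bad)) (≤-trans (*-monoˡ-≤ bad k-big) few)) ⟩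
    n * n                   ≤⟨ *-mono-≤ (third lA A-lower) (third lZ Z-lower) ⟩
    3 * lA * (3 * lZ)         ≡⟨ nine lA lZ ⟩
    9 * (lA * lZ)             ∎)
    where
    h≢0 : NonZero h
    h≢0 = >-nonZero (≤-trans (≤ᵇ⇒≤ 1 180 tt) h≥180)
    exch : ∀ h c b → h * (c * b) ≡ c * h * b
    exch = solve-∀
    nine : ∀ a z → 3 * a * (3 * z) ≡ 9 * (a * z)
    nine = solve-∀
    cube : ∀ h n → h * (n * n * n) ≡ n * (h * (n * n))
    cube = solve-∀
    few : k * bad ≤ h * (n * n)
    few = *-cancelˡ-≤ n {{>-nonZero 1≤n}} (begin
      n * (k * bad)                                                    ≡⟨ *-exchange n k bad ⟩
      k * (n * bad)                                                    ≡⟨ cong (k *_) (trans (*-comm n bad) (sym (∑-const (filterᵇ (not ∘ small) pairs) n))) ⟩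
      k * ∑ (filterᵇ (not ∘ small) pairs) (λ _ → n)                    ≤⟨ *-monoʳ-≤ k (∑-mono∈ (filterᵇ (not ∘ small) pairs) (λ {π} π∈ → over π (proj₂ (filter-∈ (not ∘ small) pairs π∈)))) ⟩
      k * ∑ (filterᵇ (not ∘ small) pairs) (λ π → h * μ π)              ≤⟨ *-monoʳ-≤ k (filter-sub (not ∘ small) {X = pairs} {W = []} {pairs} _ prefl) ⟩
      k * ∑ pairs (λ π → h * μ π)                                      ≡⟨ cong (k *_) (∑-*ˡ pairs h μ) ⟩
      k * (h * ∑ pairs μ)                                              ≡⟨ *-exchange k h (∑ pairs μ) ⟩
      h * (k * ∑ pairs μ)                                              ≤⟨ *-monoʳ-≤ h ∑μ ⟩
      h * (n * n * n)                                                  ≡⟨ cube h n ⟩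
      n * (h * (n * n))                                                ∎)
      where
      over : ∀ π → not (small π) ≡ true → n ≤ h * μ π
      over π e = <⇒≤ (≤ᵇ-false (h * μ π) n (not-true e))
        where
        not-true : ∀ {c} → not c ≡ true → c ≡ false
        not-true {false} _ = refl

  Γ-large : 29 * (lA * lZ) ≤ 30 * length Γ
  Γ-large = by-slack 0 (+-mono-≤ bad-few (*-monoʳ-≤ 30 (≤-reflexive split))) (ident (lA * lZ) (length Γ) bad)
    where
    split : lA * lZ ≡ length Γ + bad
    split = trans (sym (length-product AL ZL)) (trans (↭-length (filter-split small pairs)) (length-++ Γ))
    ident : ∀ s g b → 29 * s + (s + 30 * (g + b)) + 0 ≡ 30 * g + (30 * b + 30 * s)
    ident = solve-∀

  Γ-distinct : ∀ {p q} → (p , q) ∈ Γ → p ≢ q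
  Γ-distinct {p} π∈ refl = <⇒≱ many (≤ᵇ-true _ n (proj₂ (filter-∈ small pairs π∈)))
    where
    μ-loop : μ (p , p) ≡ lZ
    μ-loop = trans (∑-cong ZL (λ y → cong (⟦_⟧ ∘ not) (e-loop y p))) (∑-1 ZL)
    many : n < h * μ (p , p)
    many = begin-strict
      n                  ≤⟨ third lZ Z-lower ⟩
      3 * lZ              <⟨ *-monoˡ-< lZ {{>-nonZero 1≤lZ}} (≤-refl {4}) ⟩
      4 * lZ              ≤⟨ *-monoˡ-≤ lZ (≤-trans (≤ᵇ⇒≤ 4 180 tt) h≥180) ⟩
      h * lZ              ≡⟨ cong (h *_) (sym μ-loop) ⟩
      h * μ (p , p)      ∎

  incident : Fin n × (Fin n × Fin n) → Bool
  incident (x , (p , q)) = edge H x p q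

  Y : List (Fin n × (Fin n × Fin n))
  Y = filterᵇ incident (cartesianProduct OL Γ)

  Y-large : 29 * (length Γ * d) ≤ 30 * length Y
  Y-large = begin
    29 * (length Γ * d)                                   ≡⟨ trans (*-exchange 29 (length Γ) d) (sym (∑-const Γ (29 * d))) ⟩
    ∑ Γ (λ _ → 29 * d)                                    ≤⟨ ∑-mono∈ Γ (λ {π} π∈ → each (outside-degree (Γ-distinct π∈))) ⟩
    ∑ Γ (λ π → 30 * ∑ OL (λ x → ⟦ incident (x , π) ⟧))    ≡⟨ trans (∑-*ˡ Γ 30 _) (cong (30 *_) (∑-swap Γ OL _)) ⟩
    30 * ∑ OL (λ x → ∑ Γ (λ π → ⟦ incident (x , π) ⟧))    ≡⟨ cong (30 *_) (sym (trans (length-filter incident (cartesianProduct OL Γ)) (∑-product OL Γ _))) ⟩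
    30 * length Y                                         ∎
    where
    each : ∀ {b} → d ≤ w + b → 29 * d ≤ 30 * b
    each {b} hb = by-slack (30 * m) (+-mono-≤ (*-monoʳ-≤ 30 hb) d-big) (ident d w b m)
      where
      ident : ∀ d w b m → 29 * d + (30 * (w + b) + d) + 30 * m ≡ 30 * b + (30 * d + 30 * (w + m))
      ident = solve-∀

  n-square : 180 * (m * m) ≤ n
  n-square = begin
    180 * (m * m)                       ≤⟨ *-monoˡ-≤ (m * m) (≤ᵇ⇒≤ 180 900 tt) ⟩
    900 * (m * m)                       ≡⟨ sq m ⟩
    30 * m * (30 * m)                   ≤⟨ *-mono-≤ (*-monoʳ-≤ 30 (m≤n+m m w)) (*-monoʳ-≤ 30 (m≤n+m m w)) ⟩
    base * base                               ≤⟨ *-monoʳ-≤ base (m≤m*n base (base ^ ν) {{m^n≢0 base ν {{base≢0}}}}) ⟩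
    base ^ m                               ≤⟨ n-big ⟩
    n                                   ∎
    where
    base = 30 * (w + m)
    base≢0 : NonZero base
    base≢0 = m*n≢0 30 (w + m) {{_}} {{>-nonZero (≤-trans (s≤s z≤n) (m≤n+m m w))}}
    sq : ∀ m → 900 * (m * m) ≡ 30 * m * (30 * m)
    sq = solve-∀

  m≤list : ∀ x → 118 * n ≤ 240 * x → m ≤ x
  m≤list x hx = *-cancelˡ-≤ 3 (≤-trans (≤-trans (*-monoʳ-≤ 3 (m≤m*n m m)) (≤-trans (*-monoˡ-≤ (m * m) (≤ᵇ⇒≤ 3 180 tt)) n-square)) (third x hx))

  j : ℕ
  j = suc ν

  -- The m - 1 vertices that share a part of the tile with the outside vertex. Pairs of `Γ` miss
  -- very few vertices of Z, so the choice loses almost nothing; averaging runs over the incidences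
  -- `Y` because these are what the next averaging divides among outside vertices.
  Selection : Set
  Selection = Σ (List (Fin n)) λ S → Σ (List (Fin n)) λ R → ZL ↭ S ++ R × length S ≡ j ×
    ∑ Y (λ (x , (p , q)) → (∑ ZL (λ y → ⟦ edge H y p q ⟧) ∸ j) ^ j) ≤ lZ ^ j * ∑ Y (λ (x , (p , q)) → ⟦ all (λ y → edge H y p q) S ⟧)

  abstract
    selection : Selection
    selection = select j ZL Y (λ y (x , (p , q)) → edge H y p q) (≤-trans (n≤1+n j) (m≤list lZ Z-lower))

  S : List (Fin n)
  S = proj₁ selection

  common : Fin n × Fin n → Bool
  common (p , q) = all (λ y → edge H y p q) S

  kept : ℕ
  kept = ∑ Y (λ (x , π) → ⟦ common π ⟧)

  kept-large : 29 * length Y ≤ 30 * kept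
  kept-large = *-cancelˡ-≤ (lZ ^ j) {{m^n≢0 lZ j {{>-nonZero 1≤lZ}}}} (begin
    lZ ^ j * (29 * length Y)                   ≡⟨ exch (lZ ^ j) (length Y) ⟩
    length Y * (29 * lZ ^ j)                   ≡⟨ sym (∑-const Y _) ⟩
    ∑ Y (λ _ → 29 * lZ ^ j)                    ≤⟨ ∑-mono∈ Y (λ {t} t∈ → each t t∈) ⟩
    ∑ Y (λ (x , (p , q)) → 30 * (∑ ZL (λ y → ⟦ edge H y p q ⟧) ∸ j) ^ j)   ≡⟨ ∑-*ˡ Y 30 _ ⟩
    30 * ∑ Y (λ (x , (p , q)) → (∑ ZL (λ y → ⟦ edge H y p q ⟧) ∸ j) ^ j)   ≤⟨ *-monoʳ-≤ 30 (proj₂ (proj₂ (proj₂ (proj₂ selection)))) ⟩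
    30 * (lZ ^ j * kept)                       ≡⟨ exch′ (lZ ^ j) kept ⟩
    lZ ^ j * (30 * kept)                       ∎)
    where
    exch : ∀ a b → a * (29 * b) ≡ b * (29 * a)
    exch = solve-∀
    exch′ : ∀ a b → 30 * (a * b) ≡ a * (30 * b)
    exch′ = solve-∀
    each : ∀ t → t ∈ Y → 29 * lZ ^ j ≤ 30 * (∑ ZL (λ y → ⟦ edge H y (proj₁ (proj₂ t)) (proj₂ (proj₂ t)) ⟧) ∸ j) ^ j
    each (x , (p , q)) t∈ = subst (λ z → 29 * lZ ^ j ≤ 30 * z ^ j) degree (nearly-all ν lZ (μ (p , q) + j) room)
      where
      π∈Γ : (p , q) ∈ Γ
      π∈Γ = proj₂ (∈-cartesianProduct⁻ OL Γ (proj₁ (filter-∈ incident (cartesianProduct OL Γ) t∈)))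
      -- The parts `180 * j * μ` and `180 * (j * j)` are each at most n, the former by smallness of
      -- the pair and `h ≥ 180 * m`, and 2n is at most 6 |Z|.
      room : 30 * (suc ν * (μ (p , q) + j)) ≤ lZ
      room = *-cancelˡ-≤ 6 (by-slack 0 (+-mono-≤ (*-monoˡ-≤ (μ (p , q)) (≤-trans (*-monoʳ-≤ 180 (n≤1+n j)) h-big))
          (+-mono-≤ (≤ᵇ-true (h * μ (p , q)) n (proj₂ (filter-∈ small pairs π∈Γ)))
            (+-mono-≤ (≤-trans (*-monoʳ-≤ 180 (*-mono-≤ (n≤1+n j) (n≤1+n j))) n-square) (*-monoʳ-≤ 2 (third lZ Z-lower)))))
        (ident j h n (μ (p , q)) lZ))
        where
        ident : ∀ j h n μ z → 6 * (30 * (j * (μ + j))) + (h * μ + (n + (n + 2 * (3 * z)))) + 0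
              ≡ 6 * z + (180 * j * μ + (h * μ + (180 * (j * j) + 2 * n)))
        ident = solve-∀
      degree : lZ ∸ (μ (p , q) + j) ≡ ∑ ZL (λ y → ⟦ edge H y p q ⟧) ∸ j
      degree = trans (sym (∸-+-assoc lZ (μ (p , q)) j)) (cong (_∸ j) (trans (cong (_∸ μ (p , q)) (sym total)) (m+n∸n≡m _ (μ (p , q)))))
        where
        total : ∑ ZL (λ y → ⟦ edge H y p q ⟧) + μ (p , q) ≡ lZ
        total = trans (sym (∑-+ ZL _ _)) (trans (∑-cong ZL (λ y → one (edge H y p q))) (∑-1 ZL))
          where
          one : ∀ c → ⟦ c ⟧ + ⟦ not c ⟧ ≡ 1
          one true  = refl
          one false = refl

  fibre : Fin n → ℕ
  fibre x = ∑ Γ (λ π → ⟦ incident (x , π) ⟧ * ⟦ common π ⟧)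

  kept≡ : kept ≡ ∑ OL fibre
  kept≡ = trans (∑-filter incident (cartesianProduct OL Γ) _) (∑-product OL Γ _)

  1≤O : 1 ≤ lO
  1≤O = positive (third lO O-lower)

  abstract
    -- The vertex outside Z of the unbalanced tile: its link still contains an average share of the
    -- kept incidences.
    centre : ∃ λ x → x ∈ OL × ∑ OL fibre ≤ lO * fibre x
    centre = ∑-avg OL fibre 1≤O

  c : Fin n
  c = proj₁ centre

  good : Fin n → Fin n → Bool
  good p q = small (p , q) ∧ (edge H c p q ∧ common (p , q))

  fibre≡ : fibre c ≡ ∑ ZL (λ q → ∑ AL (λ p → ⟦ good p q ⟧))
  fibre≡ = trans (∑-filter small pairs _) (trans (∑-cong pairs (λ (p , q) → sym (trans (⟦∧⟧ (small (p , q)) _) (cong (⟦ small (p , q) ⟧ *_) (⟦∧⟧ (edge H c p q) (common (p , q)))))))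
    (trans (∑-product AL ZL _) (∑-swap AL ZL _)))

  degree : Fin n → ℕ
  degree q = ∑ AL (λ p → ⟦ good p q ⟧)

  -- The bipartite graph `good` between A and Z consists of pairs joined to c and to all of `S`. A
  -- copy of K(m,m) in it completes the tile, and its degrees from Z average about d, which is what
  -- `kst-count` requires.
  stars : 5 * d * lZ ≤ 6 * ∑ ZL (λ q → degree q ∸ m)
  stars = star-average 29 30 lZ d m (fibre c) (∑ ZL (λ q → degree q ∸ m)) (s≤s z≤n) (≤ᵇ⇒≤ (5 * (30 * 30 * 30 * 30) + 6 * (30 * 30 * 30)) (6 * (29 * 29 * 29 * 29)) tt)
    (chain-averages 29 30 lA lZ lO d (length Γ) (length Y) kept (fibre c) 1≤O Γ-large Y-large kept-large
      (≤-trans (≤-reflexive kept≡) (proj₂ (proj₂ centre))) (ratio lA lO 30 29 (≤ᵇ⇒≤ (121 * 29) (118 * 30) tt) A-lower O-upper))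
    (≤-trans (≤-reflexive fibre≡) (∑-∸ ZL degree m))
    (≤-trans (*-monoʳ-≤ 30 (m≤n+m m w)) d-big)

  Leaves : Set
  Leaves = Σ (List (Fin n)) λ Q → Σ (List (Fin n)) λ R → AL ↭ Q ++ R × length Q ≡ m ×
    ∑ ZL (λ q → (degree q ∸ m) ^ m) ≤ lA ^ m * ∑ ZL (λ q → ⟦ all (λ p → good p q) Q ⟧)

  abstract
    leaves : Leaves
    leaves = select m AL ZL good (m≤list lA A-lower)

  Ps : List (Fin n)
  Ps = proj₁ leaves

  joined : Fin n → Bool
  joined q = all (λ p → good p q) Ps

  many-joined : m ≤ length (filterᵇ joined ZL)
  many-joined = ≤-trans (kst-count ν n d lA lZ (∑ ZL (λ q → ⟦ joined q ⟧)) (proj₁ (proj₂ root))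
      (five-ninths lA n A-upper)
      (ratio lZ lA 5 4 (≤ᵇ⇒≤ (121 * 4) (118 * 5) tt) Z-lower A-upper)
      (≤-trans (s≤s z≤n) (m≤list lA A-lower))
      (begin
        (5 * d) ^ m * lZ                                      ≤⟨ ∑-power-≥ (suc ν) (5 * d) 6 ZL (λ q → degree q ∸ m) stars ⟩
        6 ^ m * ∑ ZL (λ q → (degree q ∸ m) ^ m)               ≤⟨ *-monoʳ-≤ (6 ^ m) (proj₂ (proj₂ (proj₂ (proj₂ leaves)))) ⟩
        6 ^ m * (lA ^ m * ∑ ZL (λ q → ⟦ joined q ⟧))          ∎))
    (≤-reflexive (sym (length-filter joined ZL)))

  Qs : List (Fin n)
  Qs = take m (filterᵇ joined ZL)

  Qs-in : ∀ {q} → q ∈ Qs → q ∈ ZL × joined q ≡ true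
  Qs-in q∈ = filter-∈ joined ZL (subst (_ ∈_) (take++drop≡id m (filterᵇ joined ZL)) (∈-++⁺ˡ q∈))

  Ps-in : ∀ {p} → p ∈ Ps → p ∈ AL
  Ps-in p∈ = ∈-resp-↭ (↭-sym (proj₁ (proj₂ (proj₂ leaves)))) (∈-++⁺ˡ p∈)

  S-in : ∀ {y} → y ∈ S → y ∈ ZL
  S-in y∈ = ∈-resp-↭ (↭-sym (proj₁ (proj₂ (proj₂ selection)))) (∈-++⁺ˡ y∈)

  complete : Complete (c ∷ S) Ps Qs
  complete {y = p} {q} x∈ p∈ q∈ = from-good x∈ (all-∈ (λ p → good p q) Ps (proj₂ (Qs-in q∈)) p∈)
    where
    from-good : ∀ {x} → x ∈ c ∷ S → good p q ≡ true → edge H x p q ≡ true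
    from-good (here refl) g = proj₁ (∧-true (proj₂ (∧-true {small (p , q)} g)))
    from-good (there y∈)  g = all-∈ (λ y → edge H y p q) S (proj₂ (∧-true {edge H c p q} (proj₂ (∧-true {small (p , q)} g)))) y∈

  rest-simple : Simple rest
  rest-simple = simple-sub W rest V↭ ∑δ≤1

  c∉S : ∀ {v} → v ∈ c ∷ [] → v ∈ S → ⊥
  c∉S (here refl) c∈ = clash (side c) ζ (proj₂ (filter-∈ out rest (proj₁ (proj₂ centre)))) (proj₂ (filter-∈ zb rest (S-in c∈)))
    where
    clash : ∀ s z → s xor z ≡ true → not (s xor z) ≡ true → ⊥
    clash s z e f with s xor z
    clash s z () f  | false
    clash s z e  () | true

  outer : List (Fin n)
  outer = (c ∷ S) ++ Ps ++ Qs

  lengths : length S ≡ j × length Ps ≡ m × length Qs ≡ m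
  lengths = proj₁ (proj₂ (proj₂ (proj₂ selection))) , proj₁ (proj₂ (proj₂ (proj₂ leaves))) ,
    trans (length-take m (filterᵇ joined ZL)) (m≤n⇒m⊓n≡m many-joined)

  the-tile : Tile outer
  the-tile = tile (c ∷ S) Ps Qs (cong suc (proj₁ lengths)) (proj₁ (proj₂ lengths)) (proj₂ (proj₂ lengths)) complete

  nonempty : ∀ {k} (xs : List (Fin n)) → length xs ≡ suc k → ∃ (_∈ xs)
  nonempty (x ∷ xs) _ = x , here refl

  outer-simple : Simple outer
  outer-simple = simple-complete H m complete (c , here refl) (nonempty Ps (proj₁ (proj₂ lengths))) (nonempty Qs (proj₂ (proj₂ lengths)))
    (simple-++ (c ∷ []) S (∑δ-single c) (simple-subˡ S _ (proj₁ (proj₂ (proj₂ selection))) (simple-filter zb {rest} rest-simple)) c∉S)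
    (simple-subˡ Ps _ (proj₁ (proj₂ (proj₂ leaves))) (simple-filter side {rest} rest-simple))
    (simple-take m {filterᵇ joined ZL} (simple-filter joined {ZL} (simple-filter zb {rest} rest-simple)))
    where
    ∑δ-single : ∀ x → Simple (x ∷ [])
    ∑δ-single x v = ≤-trans (≤-reflexive (+-identityʳ _)) (⟦⟧≤1 (does (v ≟ᶠ x)))

  outer-sub : ∀ {v} → v ∈ outer → v ∈ rest
  outer-sub v∈ with ∈-++⁻ (c ∷ S) v∈
  ... | inj₁ (here refl) = proj₁ (filter-∈ out rest (proj₁ (proj₂ centre)))
  ... | inj₁ (there y∈)  = proj₁ (filter-∈ zb rest (S-in y∈))
  ... | inj₂ v∈′ with ∈-++⁻ Ps v∈′
  ...   | inj₁ p∈ = proj₁ (filter-∈ side rest (Ps-in p∈))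
  ...   | inj₂ q∈ = proj₁ (filter-∈ zb rest (proj₁ (Qs-in q∈)))

  count-side : ∀ (xs : List (Fin n)) s → (∀ {v} → v ∈ xs → side v ≡ s) → ∑ xs (λ v → ⟦ not (side v) ⟧) ≡ length xs * ⟦ not s ⟧
  count-side []       s hs = refl
  count-side (x ∷ xs) s hs = cong₂ _+_ (cong (⟦_⟧ ∘ not) (hs (here refl))) (count-side xs s (hs ∘ there))

  outer-count : ∑ outer (λ v → ⟦ not (side v) ⟧) ≡ imbalance ν ζ
  outer-count = trans (∑-++ (c ∷ S) (Ps ++ Qs) _) (trans (cong₂ _+_ refl (∑-++ Ps Qs _)) (trans (cong₂ _+_
      (cong₂ _+_ (cong (⟦_⟧ ∘ not) (other (side c) ζ (proj₂ (filter-∈ out rest (proj₁ (proj₂ centre))))))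
        (trans (count-side S ζ (λ v∈ → same _ ζ (proj₂ (filter-∈ zb rest (S-in v∈))))) (cong (_* ⟦ not ζ ⟧) (proj₁ lengths))))
      (cong₂ _+_ (count-side Ps true (λ v∈ → proj₂ (filter-∈ side rest (Ps-in v∈))))
        (trans (count-side Qs ζ (λ v∈ → same _ ζ (proj₂ (filter-∈ zb rest (proj₁ (Qs-in v∈)))))) (cong (_* ⟦ not ζ ⟧) (proj₂ (proj₂ lengths))))))
    (evaluate ζ)))
    where
    other : ∀ s z → s xor z ≡ true → s ≡ not z
    other true  false _ = refl
    other false true  _ = refl
    same : ∀ s z → not (s xor z) ≡ true → s ≡ z
    same true  true  _ = refl
    same false false _ = refl
    evaluate : ∀ z → (⟦ not (not z) ⟧ + j * ⟦ not z ⟧) + (length Ps * 0 + m * ⟦ not z ⟧) ≡ imbalance ν z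
    evaluate true  = cong suc (trans (cong₂ _+_ (*-zeroʳ j) (cong₂ _+_ (*-zeroʳ (length Ps)) (*-zeroʳ m))) refl)
    evaluate false = cong₂ _+_ (*-identityʳ j) (cong₂ _+_ (*-zeroʳ (length Ps)) (*-identityʳ m))

  unbalanced-tile : Σ (List (Fin n)) λ t → Σ (List (Fin n)) λ R → Tile t × rest ↭ t ++ R × ∑ t (λ v → ⟦ not (side v) ⟧) ≡ imbalance ν ζ
  unbalanced-tile = let (R , p) = sub-permutation outer rest outer-simple outer-sub in outer , R , the-tile , p , outer-count

-- From tilings to factors

at : (xs : List A) {k : ℕ} → length xs ≡ k → Fin k → A
at xs refl i = lookup xs i

at-∈ : (xs : List A) {k : ℕ} (l : length xs ≡ k) (i : Fin k) → at xs l i ∈ xs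
at-∈ xs refl i = ∈-lookup i

at-index : (xs : List A) {k : ℕ} (l : length xs ≡ k) {v : A} → v ∈ xs → ∃ λ i → at xs l i ≡ v
at-index xs refl v∈ = index v∈ , sym (lookup-index v∈)

simple-disjoint : ∀ {n} (xs ys : List (Fin n)) → Simple (xs ++ ys) → ∀ {v} → v ∈ xs → v ∈ ys → ⊥
simple-disjoint xs ys h {v} v∈x v∈y = <⇒≱ (+-mono-≤ (∑δ-∈ v∈x) (∑δ-∈ v∈y)) (≤-trans (≤-reflexive (sym (∑-++ xs ys (δ v)))) (h v))

simple-left : ∀ {n} (xs ys : List (Fin n)) → Simple (xs ++ ys) → Simple xs
simple-left xs ys = simple-subˡ xs ys prefl

simple-right : ∀ {n} (xs ys : List (Fin n)) → Simple (xs ++ ys) → Simple ys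
simple-right xs ys = simple-sub xs ys prefl

lookup-injective : ∀ {n} (xs : List (Fin n)) → Simple xs → ∀ i j → lookup xs i ≡ lookup xs j → i ≡ j
lookup-injective (x ∷ xs) h Fin.zero    Fin.zero    e = refl
lookup-injective (x ∷ xs) h Fin.zero    (Fin.suc j) e = ⊥-elim (simple-disjoint (x ∷ []) xs h (here refl) (subst (_∈ xs) (sym e) (at-∈ xs refl j)))
lookup-injective (x ∷ xs) h (Fin.suc i) Fin.zero    e = ⊥-elim (simple-disjoint (x ∷ []) xs h (here refl) (subst (_∈ xs) e (at-∈ xs refl i)))
lookup-injective (x ∷ xs) h (Fin.suc i) (Fin.suc j) e = cong Fin.suc (lookup-injective xs (simple-right (x ∷ []) xs h) i j e)

at-injective : ∀ {n} (xs : List (Fin n)) {k} (l : length xs ≡ k) → Simple xs → ∀ i j → at xs l i ≡ at xs l j → i ≡ j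
at-injective xs refl = lookup-injective xs

module Factor {n : ℕ} (H : ThreeGraph n) (m : ℕ) where

  open Tiling H m

  place : ∀ {t} → Tile t → Fin 3 → Fin m → Fin n
  place (tile as bs cs la lb lc _) Fin.zero                      = at as la
  place (tile as bs cs la lb lc _) (Fin.suc Fin.zero)            = at bs lb
  place (tile as bs cs la lb lc _) (Fin.suc (Fin.suc Fin.zero))  = at cs lc

  place-∈ : ∀ {t} (T : Tile t) c a → place T c a ∈ t
  place-∈ (tile as bs cs la lb lc _) Fin.zero                     a = ∈-++⁺ˡ (at-∈ as la a)
  place-∈ (tile as bs cs la lb lc _) (Fin.suc Fin.zero)           a = ∈-++⁺ʳ as (∈-++⁺ˡ (at-∈ bs lb a))
  place-∈ (tile as bs cs la lb lc _) (Fin.suc (Fin.suc Fin.zero)) a = ∈-++⁺ʳ as (∈-++⁺ʳ bs (at-∈ cs lc a))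

  place-onto : ∀ {t} (T : Tile t) {v} → v ∈ t → ∃ λ c → ∃ λ a → place T c a ≡ v
  place-onto (tile as bs cs la lb lc _) v∈ with ∈-++⁻ as v∈
  ... | inj₁ v∈a = Fin.zero , at-index as la v∈a
  ... | inj₂ v∈′ with ∈-++⁻ bs v∈′
  ...   | inj₁ v∈b = Fin.suc Fin.zero , at-index bs lb v∈b
  ...   | inj₂ v∈c = Fin.suc (Fin.suc Fin.zero) , at-index cs lc v∈c

  place-edge : ∀ {t} (T : Tile t) a b c → edge H (place T c0 a) (place T c1 b) (place T c2 c) ≡ true
  place-edge (tile as bs cs la lb lc full) a b c = full (at-∈ as la a) (at-∈ bs lb b) (at-∈ cs lc c)

  place-injective : ∀ {t} (T : Tile t) → Simple t → ∀ c a c′ a′ → place T c a ≡ place T c′ a′ → c ≡ c′ × a ≡ a′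
  place-injective (tile as bs cs la lb lc _) h = inj
    where
    h′ = simple-right as (bs ++ cs) h
    ab : ∀ {x y} → x ∈ as → y ∈ bs ++ cs → x ≡ y → ⊥
    ab x∈ y∈ refl = simple-disjoint as (bs ++ cs) h x∈ y∈
    bc : ∀ {x y} → x ∈ bs → y ∈ cs → x ≡ y → ⊥
    bc x∈ y∈ refl = simple-disjoint bs cs h′ x∈ y∈
    inj : ∀ c a c′ a′ → place (tile as bs cs la lb lc _) c a ≡ place (tile as bs cs la lb lc _) c′ a′ → c ≡ c′ × a ≡ a′
    inj Fin.zero a Fin.zero a′ e = refl , at-injective as la (simple-left as (bs ++ cs) h) a a′ e
    inj (Fin.suc Fin.zero) a (Fin.suc Fin.zero) a′ e = refl , at-injective bs lb (simple-left bs cs h′) a a′ e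
    inj (Fin.suc (Fin.suc Fin.zero)) a (Fin.suc (Fin.suc Fin.zero)) a′ e = refl , at-injective cs lc (simple-right bs cs h′) a a′ e
    inj Fin.zero a (Fin.suc Fin.zero) a′ e = ⊥-elim (ab (at-∈ as la a) (∈-++⁺ˡ (at-∈ bs lb a′)) e)
    inj Fin.zero a (Fin.suc (Fin.suc Fin.zero)) a′ e = ⊥-elim (ab (at-∈ as la a) (∈-++⁺ʳ bs (at-∈ cs lc a′)) e)
    inj (Fin.suc Fin.zero) a Fin.zero a′ e = ⊥-elim (ab (at-∈ as la a′) (∈-++⁺ˡ (at-∈ bs lb a)) (sym e))
    inj (Fin.suc (Fin.suc Fin.zero)) a Fin.zero a′ e = ⊥-elim (ab (at-∈ as la a′) (∈-++⁺ʳ bs (at-∈ cs lc a)) (sym e))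
    inj (Fin.suc Fin.zero) a (Fin.suc (Fin.suc Fin.zero)) a′ e = ⊥-elim (bc (at-∈ bs lb a) (at-∈ cs lc a′) e)
    inj (Fin.suc (Fin.suc Fin.zero)) a (Fin.suc Fin.zero) a′ e = ⊥-elim (bc (at-∈ bs lb a′) (at-∈ cs lc a) (sym e))

  φ : ∀ {ts} → All Tile ts → Fin (length ts) → Fin 3 → Fin m → Fin n
  φ (T ∷ Ts) Fin.zero    = place T
  φ (T ∷ Ts) (Fin.suc i) = φ Ts i

  φ-∈ : ∀ {ts} (Ts : All Tile ts) i c a → φ Ts i c a ∈ concat ts
  φ-∈         (T ∷ Ts) Fin.zero    c a = ∈-++⁺ˡ (place-∈ T c a)
  φ-∈ {t ∷ _} (T ∷ Ts) (Fin.suc i) c a = ∈-++⁺ʳ t (φ-∈ Ts i c a)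

  φ-onto : ∀ {ts} (Ts : All Tile ts) {v} → v ∈ concat ts → ∃ λ i → ∃ λ c → ∃ λ a → φ Ts i c a ≡ v
  φ-onto {t ∷ _} (T ∷ Ts) v∈ with ∈-++⁻ t v∈
  ... | inj₁ v∈t  = Fin.zero , place-onto T v∈t
  ... | inj₂ v∈ts = let (i , r) = φ-onto Ts v∈ts in Fin.suc i , r

  φ-edge : ∀ {ts} (Ts : All Tile ts) i a b c → edge H (φ Ts i c0 a) (φ Ts i c1 b) (φ Ts i c2 c) ≡ true
  φ-edge (T ∷ Ts) Fin.zero    = place-edge T
  φ-edge (T ∷ Ts) (Fin.suc i) = φ-edge Ts i

  φ-injective : ∀ {ts} (Ts : All Tile ts) → Simple (concat ts) → ∀ i c a j c′ a′ → φ Ts i c a ≡ φ Ts j c′ a′ → i ≡ j × c ≡ c′ × a ≡ a′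
  φ-injective {t ∷ ts} (T ∷ Ts) h Fin.zero c a Fin.zero c′ a′ e = refl , place-injective T (simple-left t (concat ts) h) c a c′ a′ e
  φ-injective {t ∷ ts} (T ∷ Ts) h Fin.zero c a (Fin.suc j) c′ a′ e =
    ⊥-elim (simple-disjoint t (concat ts) h (place-∈ T c a) (subst (_∈ concat ts) (sym e) (φ-∈ Ts j c′ a′)))
  φ-injective {t ∷ ts} (T ∷ Ts) h (Fin.suc i) c a Fin.zero c′ a′ e =
    ⊥-elim (simple-disjoint t (concat ts) h (place-∈ T c′ a′) (subst (_∈ concat ts) e (φ-∈ Ts i c a)))
  φ-injective {t ∷ ts} (T ∷ Ts) h (Fin.suc i) c a (Fin.suc j) c′ a′ e =
    let (p , q) = φ-injective Ts (simple-right t (concat ts) h) i c a j c′ a′ e in cong Fin.suc p , q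

  factor : Tileable V → HasK3Factor m H
  factor (ts , Ts , ts↭) = length ts , φ Ts , φ-injective Ts (λ v → ≤-trans (≤-reflexive (∑-↭ (δ v) ts↭)) (∑δ≤1 v)) ,
    (λ v → φ-onto Ts (∈-resp-↭ (↭-sym ts↭) (∈-allFin v))) , φ-edge Ts

-- Cutting the leftover vertices into targets

module Chunks {n : ℕ} (H : ThreeGraph n) (ν E K : ℕ) (1≤E : 1 ≤ E) (1≤K : 1 ≤ K) where

  open AbsorberFamily H ν E K 1≤E 1≤K

  tileable-length : ∀ {L} → Tileable L → 3 * m ∣ length L
  tileable-length (ts , Ts , ts↭) = divides (length ts) (trans (sym (↭-length ts↭)) (length-concat (3 * m) ts (All.map length-tile Ts)))

  module _ {τ₀ τ₁ τ₂ : Fin n → Bool} (pattern-dense : length V ^ 3 ≤ E * pattern-count τ₀ τ₁ τ₂)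
    (closed₀ : ∀ x y → τ₀ x ≡ true → τ₀ y ≡ true → Close x y)
    (closed₁ : ∀ x y → τ₁ x ≡ true → τ₁ y ≡ true → Close x y)
    (closed₂ : ∀ x y → τ₂ x ≡ true → τ₂ y ≡ true → Close x y) where

    absorb-targets : ∀ (Ts : List Target) Zs → All (TargetOf τ₀ τ₁ τ₂) Ts → All (Absorbs pattern-dense closed₀ closed₁ closed₂) Zs →
      length Ts ≤ length Zs → Tileable (concat (map vertices Ts) ++ concat Zs)
    absorb-targets []       []       _        _        _       = tileable-[]
    absorb-targets []       (Z ∷ Zs) _        (a ∷ as) _       = tileable-++ (proj₁ a) (absorb-targets [] Zs [] as z≤n)
    absorb-targets (t ∷ Ts) (Z ∷ Zs) (h ∷ hs) (a ∷ as) (s≤s l) = tileable-↭ (++-exchange (vertices t) Z (concat (map vertices Ts)) (concat Zs))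
      (tileable-++ (proj₂ a t h) (absorb-targets Ts Zs hs as l))

  cut : ∀ k l (xs : List (Fin n)) → length xs ≡ k + l → Σ (List (Fin n)) λ ys → Σ (List (Fin n)) λ zs → xs ≡ ys ++ zs × length ys ≡ k × length zs ≡ l
  cut zero    l xs       e = [] , xs , refl , refl , e
  cut (suc k) l (x ∷ xs) e = let (ys , zs , p , q , r) = cut k l xs (suc-injective e) in x ∷ ys , zs , cong (x ∷_) p , cong suc q , r

  cut-all : ∀ {P : Fin n → Set} ys zs {xs} → xs ≡ ys ++ zs → All P xs → All P ys × All P zs
  cut-all ys zs refl a = AllP.++⁻ ys a

  targets-AAA : ∀ τ i (U : List (Fin n)) → length U ≡ i * (m + (m + m)) → All (λ v → τ v ≡ true) U →
    Σ (List Target) λ Ts → length Ts ≡ i × All (TargetOf τ τ τ) Ts × concat (map vertices Ts) ≡ U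
  targets-AAA τ zero    []  _ _ = [] , refl , [] , refl
  targets-AAA τ (suc i) U   l a =
    let (us , U₁ , e₁ , l₁ , r₁) = cut m (m + m + i * (m + (m + m))) U (trans l (+-assoc m (m + m) _))
        (vs , U₂ , e₂ , l₂ , r₂) = cut m (m + i * (m + (m + m))) U₁ (trans r₁ (+-assoc m m _))
        (ws , U₃ , e₃ , l₃ , r₃) = cut m (i * (m + (m + m))) U₂ r₂
        (a₁ , b₁) = cut-all us U₁ e₁ a
        (a₂ , b₂) = cut-all vs U₂ e₂ b₁
        (a₃ , b₃) = cut-all ws U₃ e₃ b₂
        (Ts , lT , ok , eq) = targets-AAA τ i U₃ r₃ b₃
    in (us , vs , ws) ∷ Ts , cong suc lT , ((l₁ , a₁) , (l₂ , a₂) , (l₃ , a₃)) ∷ ok ,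
       trans (++-assoc us (vs ++ ws) _) (trans (cong (us ++_) (trans (++-assoc vs ws _) (trans (cong (λ z → vs ++ (ws ++ z)) eq) (trans (cong (vs ++_) (sym e₃)) (sym e₂))))) (sym e₁))

  targets-ABB : ∀ τ σ i (U W : List (Fin n)) → length U ≡ i * m → length W ≡ i * (m + m) → All (λ v → τ v ≡ true) U → All (λ v → σ v ≡ true) W →
    Σ (List Target) λ Ts → length Ts ≡ i × All (TargetOf τ σ σ) Ts × concat (map vertices Ts) ↭ U ++ W
  targets-ABB τ σ zero    []  [] _ _ _ _ = [] , refl , [] , prefl
  targets-ABB τ σ (suc i) U W lU lW aU aW =
    let (us , U₁ , e₁ , l₁ , r₁) = cut m (i * m) U lU
        (vs , W₁ , e₂ , l₂ , r₂) = cut m (m + i * (m + m)) W (trans lW (+-assoc m m _))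
        (ws , W₂ , e₃ , l₃ , r₃) = cut m (i * (m + m)) W₁ r₂
        (a₁ , b₁) = cut-all us U₁ e₁ aU
        (a₂ , b₂) = cut-all vs W₁ e₂ aW
        (a₃ , b₃) = cut-all ws W₂ e₃ b₂
        (Ts , lT , ok , p) = targets-ABB τ σ i U₁ W₂ r₁ r₃ b₁ b₃
    in (us , vs , ws) ∷ Ts , cong suc lT , ((l₁ , a₁) , (l₂ , a₂) , (l₃ , a₃)) ∷ ok ,
       ptrans (++⁺ˡ (us ++ (vs ++ ws)) p) (ptrans (++-exchange us (vs ++ ws) U₁ W₂)
         (↭-reflexive (cong₂ _++_ (sym e₁) (trans (++-assoc vs ws W₂) (trans (cong (vs ++_) (sym e₃)) (sym e₂))))))

-- From common links and class sizes to absorbing densities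

module Bridge {n : ℕ} (H : ThreeGraph n) (half : HalfCodegree H) (ν E K : ℕ) (1≤E : 1 ≤ E) (1≤K : 1 ≤ K) where

  open AbsorberConstants ν E K
  open AbsorberFamily H ν E K 1≤E 1≤K
  open Links H half
  open ≤-Reasoning

  links : Fin n → Fin n → ℕ
  links x y = ∑ (configs triple-shape V) (λ t → ⟦ link x y t ⟧)

  links≡ : ∀ x y → links x y ≡ ∑ PP (λ π → e x π * e y π * N π)
  links≡ x y = trans (∑-product V PP _) (trans (∑-swap V PP _) (∑-cong PP (λ (p , q) → trans
    (∑-cong V (λ z → trans (⟦∧⟧ (edge H x p q) _) (trans (cong (⟦ edge H x p q ⟧ *_) (⟦∧⟧ (edge H y p q) (edge H z p q)))
      (sym (*-assoc ⟦ edge H x p q ⟧ ⟦ edge H y p q ⟧ ⟦ edge H z p q ⟧)))))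
    (∑-*ˡ V (e x (p , q) * e y (p , q)) (λ z → e z (p , q))))))

  -- The remaining coordinate z of a triple runs over all neighbours of the common pair, at least
  -- n/2 of them.
  links-≥ : ∀ x y → n * D x y ≤ 2 * links x y
  links-≥ x y = begin
    n * D x y                                         ≡⟨ sym (∑-*ˡ PP n _) ⟩
    ∑ PP (λ π → n * (e x π * e y π))                  ≤⟨ ∑-mono PP (λ π → ≤-trans (≤-reflexive (i₁ n (e x π) (e y π)))
                                                           (≤-trans (*-monoʳ-≤ (e y π) (e-half x π)) (≤-reflexive (i₂ (e x π) (e y π) (N π))))) ⟩
    ∑ PP (λ π → 2 * (e x π * e y π * N π))            ≡⟨ trans (∑-*ˡ PP 2 _) (cong (2 *_) (sym (links≡ x y))) ⟩
    2 * links x y                                     ∎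
    where
    i₁ : ∀ n a b → n * (a * b) ≡ b * (a * n)
    i₁ = solve-∀
    i₂ : ∀ a b c → b * (a * (2 * c)) ≡ 2 * (a * b * c)
    i₂ = solve-∀

  chain-count≡ : ∀ x y → chain-count x y ≡ ∑ V (λ w → ∑ V (λ w′ → links x w * (links w w′ * links w′ y)))
  chain-count≡ x y = trans (∑-product V _ _) (∑-cong V (λ w → trans (∑-product V _ _) (∑-cong V (λ w′ →
    trans (∑-product-∧ T₃ (cartesianProduct T₃ T₃) (link x w) (λ (t′ , t″) → link w w′ t′ ∧ link w′ y t″))
      (cong (links x w *_) (∑-product-∧ T₃ T₃ (link w w′) (link w′ y)))))))
    where T₃ = configs triple-shape V

  chain-count-≥ : ∀ x y → n * n * n * C₃ x y ≤ 8 * chain-count x y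
  chain-count-≥ x y = begin
    n * n * n * C₃ x y
      ≡⟨ sym (trans (∑-cong V (λ w → ∑-*ˡ V (n * n * n) _)) (∑-*ˡ V (n * n * n) _)) ⟩
    ∑ V (λ w → ∑ V (λ w′ → n * n * n * (D x w * D w w′ * D w′ y)))
      ≤⟨ ∑-mono V (λ w → ∑-mono V (λ w′ → ≤-trans (≤-reflexive (i₁ n (D x w) (D w w′) (D w′ y)))
           (≤-trans (*-mono-≤ (links-≥ x w) (*-mono-≤ (links-≥ w w′) (links-≥ w′ y))) (≤-reflexive (i₂ (links x w) (links w w′) (links w′ y)))))) ⟩
    ∑ V (λ w → ∑ V (λ w′ → 8 * (links x w * (links w w′ * links w′ y))))
      ≡⟨ trans (∑-cong V (λ w → ∑-*ˡ V 8 _)) (∑-*ˡ V 8 _) ⟩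
    8 * ∑ V (λ w → ∑ V (λ w′ → links x w * (links w w′ * links w′ y)))
      ≡⟨ cong (8 *_) (sym (chain-count≡ x y)) ⟩
    8 * chain-count x y ∎
    where
    i₁ : ∀ n a b c → n * n * n * (a * b * c) ≡ n * a * (n * b * (n * c))
    i₁ = solve-∀
    i₂ : ∀ a b c → 2 * a * (2 * b * (2 * c)) ≡ 8 * (a * (b * c))
    i₂ = solve-∀

  -- A chain has 11 coordinates: 8 are accounted for by `C₃`, and the three free vertices z
  -- contribute n³/8, whence the factor 8.
  close : ∀ κ → κ * 8 ≤ K → ∀ x y → n * n * (n * n) * (n * n * (n * n)) ≤ κ * C₃ x y → Close x y
  close κ κ≤ x y h = begin
    length V ^ 11                                          ≡⟨ cong (_^ 11) (length-allFin n) ⟩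
    n ^ 11                                                 ≡⟨ i₁ n ⟩
    n * n * n * (n * n * (n * n) * (n * n * (n * n)))      ≤⟨ *-monoʳ-≤ (n * n * n) h ⟩
    n * n * n * (κ * C₃ x y)                               ≡⟨ *-exchange (n * n * n) κ (C₃ x y) ⟩
    κ * (n * n * n * C₃ x y)                               ≤⟨ *-monoʳ-≤ κ (chain-count-≥ x y) ⟩
    κ * (8 * chain-count x y)                              ≡⟨ sym (*-assoc κ 8 _) ⟩
    κ * 8 * chain-count x y                                ≤⟨ *-monoˡ-≤ (chain-count x y) κ≤ ⟩
    K * chain-count x y                                    ∎
    where
    i₁ : ∀ n → n * (n * (n * (n * (n * (n * (n * (n * (n * (n * (n * 1)))))))))) ≡ n * n * n * (n * n * (n * n) * (n * n * (n * n)))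
    i₁ = solve-∀

  all-pattern : 54 ≤ E → 2 ≤ n → length V ^ 3 ≤ E * pattern-count (λ _ → true) (λ _ → true) (λ _ → true)
  all-pattern 54≤E 2≤n = begin
    length V ^ 3                   ≡⟨ trans (cong (_^ 3) (length-allFin n)) (i₁ n) ⟩
    n * (n * n)                    ≡⟨ sym (∑-V-const n (n * n)) ⟩
    ∑ V (λ _ → n * n)              ≤⟨ ∑-mono V (L-≥-quarter 2≤n) ⟩
    ∑ V (λ x → 4 * L x)            ≡⟨ trans (∑-*ˡ V 4 L) (cong (4 *_) (∑-cong V (λ x → ∑-product V V (e x)))) ⟩
    4 * pattern-count (λ _ → true) (λ _ → true) (λ _ → true) ≤⟨ *-monoˡ-≤ _ (≤-trans (≤ᵇ⇒≤ 4 54 tt) 54≤E) ⟩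
    E * pattern-count (λ _ → true) (λ _ → true) (λ _ → true) ∎
    where
    i₁ : ∀ n → n * (n * (n * 1)) ≡ n * (n * n)
    i₁ = solve-∀

  module _ {K′ k : ℕ} (P : Parity H half K′ k) where

    open Parity P

    -- At least n³/27 triples have the pattern and at most n³/54 deviate from parity, so n³/54 of
    -- them are edges.
    parity-pattern : 54 ≤ E → 54 ≤ k → ∀ τ₀ τ₁ τ₂ → n ≤ 3 * ∑ V (λ x → ⟦ τ₀ x ⟧) → n ≤ 3 * ∑ V (λ x → ⟦ τ₁ x ⟧) → n ≤ 3 * ∑ V (λ x → ⟦ τ₂ x ⟧) →
      (∀ x y z → τ₀ x ≡ true → τ₁ y ≡ true → τ₂ z ≡ true → side x xor (side y xor side z) ≡ true) →
      length V ^ 3 ≤ E * pattern-count τ₀ τ₁ τ₂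
    parity-pattern 54≤E 54≤k τ₀ τ₁ τ₂ h₀ h₁ h₂ odd = ≤-trans (≤-reflexive (trans (cong (_^ 3) (length-allFin n)) (i₁ n)))
      (≤-trans (by-slack 0 (+-mono-≤ (*-monoʳ-≤ 2 cube) (+-mono-≤ (*-monoʳ-≤ 54 cover) few)) (i₂ n (∑ V (λ x → ⟦ τ₀ x ⟧)) (∑ V (λ x → ⟦ τ₁ x ⟧)) (∑ V (λ x → ⟦ τ₂ x ⟧)) (pattern-count τ₀ τ₁ τ₂) mism))
        (*-monoˡ-≤ (pattern-count τ₀ τ₁ τ₂) 54≤E))
      where
      mism = ∑ V (λ x → ∑ V (λ y → ∑ V (λ z → ⟦ edge H x y z xor (side x xor (side y xor side z)) ⟧)))
      i₁ : ∀ n → n * (n * (n * 1)) ≡ n * (n * n)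
      i₁ = solve-∀
      cube : n * (n * n) ≤ 3 * ∑ V (λ x → ⟦ τ₀ x ⟧) * (3 * ∑ V (λ x → ⟦ τ₁ x ⟧) * (3 * ∑ V (λ x → ⟦ τ₂ x ⟧)))
      cube = *-mono-≤ h₀ (*-mono-≤ h₁ h₂)
      few : 54 * mism ≤ n * n * n
      few = ≤-trans (*-monoˡ-≤ mism 54≤k) parity-few
      bits : ∀ x y z → ⟦ τ₀ x ⟧ * (⟦ τ₁ y ⟧ * ⟦ τ₂ z ⟧) ≤ ⟦ τ₀ x ∧ (τ₁ y ∧ (τ₂ z ∧ edge H x y z)) ⟧ + ⟦ edge H x y z xor (side x xor (side y xor side z)) ⟧
      bits x y z = aux (τ₀ x) (τ₁ y) (τ₂ z) (edge H x y z) (odd x y z)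
        where
        aux : ∀ a b c e {s} → (a ≡ true → b ≡ true → c ≡ true → s ≡ true) → ⟦ a ⟧ * (⟦ b ⟧ * ⟦ c ⟧) ≤ ⟦ a ∧ (b ∧ (c ∧ e)) ⟧ + ⟦ e xor s ⟧
        aux false b     c     e     h = z≤n
        aux true  false c     e     h = z≤n
        aux true  true  false e     h = z≤n
        aux true  true  true  true  h = s≤s z≤n
        aux true  true  true  false h rewrite h refl refl refl = ≤-refl
      cover : ∑ V (λ x → ⟦ τ₀ x ⟧) * (∑ V (λ x → ⟦ τ₁ x ⟧) * ∑ V (λ x → ⟦ τ₂ x ⟧)) ≤ pattern-count τ₀ τ₁ τ₂ + mism
      cover = begin
        ∑ V (λ x → ⟦ τ₀ x ⟧) * (∑ V (λ x → ⟦ τ₁ x ⟧) * ∑ V (λ x → ⟦ τ₂ x ⟧))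
          ≡⟨ cong (∑ V (λ x → ⟦ τ₀ x ⟧) *_) (sym (∑-*-∑ V V _ _)) ⟩
        ∑ V (λ x → ⟦ τ₀ x ⟧) * ∑ V (λ y → ∑ V (λ z → ⟦ τ₁ y ⟧ * ⟦ τ₂ z ⟧))
          ≡⟨ trans (sym (∑-*-∑ V V _ _)) (∑-cong V (λ x → ∑-cong V (λ y → sym (∑-*ˡ V ⟦ τ₀ x ⟧ _)))) ⟩
        ∑ V (λ x → ∑ V (λ y → ∑ V (λ z → ⟦ τ₀ x ⟧ * (⟦ τ₁ y ⟧ * ⟦ τ₂ z ⟧))))
          ≤⟨ ∑-mono V (λ x → ∑-mono V (λ y → ∑-mono V (bits x y))) ⟩
        ∑ V (λ x → ∑ V (λ y → ∑ V (λ z → ⟦ τ₀ x ∧ (τ₁ y ∧ (τ₂ z ∧ edge H x y z)) ⟧ + ⟦ edge H x y z xor (side x xor (side y xor side z)) ⟧)))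
          ≡⟨ trans (∑-cong V (λ x → trans (∑-cong V (λ y → ∑-+ V _ _)) (∑-+ V _ _))) (∑-+ V _ _) ⟩
        pattern-count τ₀ τ₁ τ₂ + mism ∎
      i₂ : ∀ n a b c p s → n * (n * n) + (2 * (3 * a * (3 * b * (3 * c))) + (54 * (p + s) + n * n * n)) + 0
         ≡ 54 * p + (2 * (n * (n * n)) + (54 * (a * (b * c)) + 54 * s))
      i₂ = solve-∀

-- Constants and assembly

sum-bounds : ∀ a b c d e f g n → a + (b + (c + (d + (e + (f + g))))) ≤ n → a ≤ n × b ≤ n × c ≤ n × d ≤ n × e ≤ n × f ≤ n × g ≤ n
sum-bounds a b c d e f g n h₀ = m+n≤o⇒m≤o a h₀ , m+n≤o⇒m≤o b h₁ , m+n≤o⇒m≤o c h₂ , m+n≤o⇒m≤o d h₃ , m+n≤o⇒m≤o e h₄ , m+n≤o⇒m≤o f h₅ , m+n≤o⇒n≤o f h₅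
  where
  h₁ = m+n≤o⇒n≤o a h₀
  h₂ = m+n≤o⇒n≤o b h₁
  h₃ = m+n≤o⇒n≤o c h₂
  h₄ = m+n≤o⇒n≤o d h₃
  h₅ = m+n≤o⇒n≤o e h₄

-- Opaque, so that the astronomically large constants built from it are never computed.
abstract
  above : ∀ x → Σ ℕ λ y → x ≤ y
  above x = x , ≤-refl

  above₂ : ∀ x y → Σ ℕ λ z → x ≤ z × y ≤ z
  above₂ x y = x + y , m≤m+n x y , m≤n+m y x

module Constants (ν : ℕ) where

  m M tiles-room left : ℕ
  m = suc (suc ν)
  M = m + m
  tiles-room = M * (3 * m)
  left = Leftover.leftover (suc ν)

  -- `Z` is large enough both for the dichotomy and for a parity error of n³/k, the factor 20 being
  -- lost in `F-const`. `Kc` is absolute, from cliques; `κ` covers both alternatives of the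
  -- dichotomy, and 8 = 2³ is the price of the three exchanges.
  h k Z Kc κ K E : ℕ
  h  = proj₁ (above (180 * m))
  k  = proj₁ (above (270 * h))
  Z  = proj₁ (above₂ (48 * 60) (suc (40 * (20 * k) * 4)))
  Kc = proj₁ (above (12 * (120 * 120)))
  κ  = proj₁ (above₂ (Z * Z) Kc)
  K  = proj₁ (above (κ * 8))
  E  = proj₁ (above 54)

  h-big : 180 * m ≤ h
  h-big = proj₂ (above (180 * m))

  k-big : 270 * h ≤ k
  k-big = proj₂ (above (270 * h))

  Z-big : 48 * 60 ≤ Z
  Z-big = proj₁ (proj₂ (above₂ (48 * 60) (suc (40 * (20 * k) * 4))))

  Z-big′ : 40 * (20 * k) * 4 < Z
  Z-big′ = proj₂ (proj₂ (above₂ (48 * 60) (suc (40 * (20 * k) * 4))))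

  Kc-big : 12 * (120 * 120) ≤ Kc
  Kc-big = proj₂ (above (12 * (120 * 120)))

  κ₁ : Z * Z ≤ κ
  κ₁ = proj₁ (proj₂ (above₂ (Z * Z) Kc))

  κ₂ : Kc ≤ κ
  κ₂ = proj₂ (proj₂ (above₂ (Z * Z) Kc))

  κ-K : κ * 8 ≤ K
  κ-K = proj₂ (above (κ * 8))

  54≤E : 54 ≤ E
  54≤E = proj₂ (above 54)

  1≤Z : 1 ≤ Z
  1≤Z = ≤-trans (s≤s z≤n) Z-big′

  1≤K : 1 ≤ K
  1≤K = ≤-trans (*-mono-≤ (≤-trans (*-mono-≤ 1≤Z 1≤Z) κ₁) (s≤s (z≤n {7}))) κ-K

  1≤E : 1 ≤ E
  1≤E = ≤-trans (s≤s z≤n) 54≤E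

  54≤k : 54 ≤ k
  54≤k = ≤-trans (≤-trans (≤ᵇ⇒≤ 54 180 tt) (≤-trans (m≤m*n 180 m) h-big)) (≤-trans (m≤n*m h 270) k-big)

  open AbsorberConstants ν E K public using (hit-loss; room; size)

  -- `short` bounds the uncovered vertices together with those of the dismantled tiles, hence the
  -- B-vertices to absorb. Each target of pattern ABB also needs m vertices of A, which the reserve
  -- guarantees. `rounds` bounds all vertices to be absorbed, and so the number of targets.
  short reserve rounds : ℕ
  short   = left + tiles-room
  reserve = m * short
  rounds  = reserve + short

  -- Half of n pays for what grows with the number s of greedy steps, the other half for the fixed
  -- sizes. The inner factor 2 stands for the two absorbing families, and 72 is the ratio that
  -- `almost` requires between n and the vertices set aside.
  budget-factor fixed : ℕ
  budget-factor = proj₁ (above (2 * ((room + 72) * (2 * (rounds * size)))))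
  fixed = proj₁ (above (2 * ((room + 72) * (tiles-room + reserve))))

  budget : Σ ℕ λ n₀ → ∀ n → n₀ ≤ n → Σ ℕ λ s → n ^ suc (suc ν + (m + m)) * suc hit-loss ^ s < suc (suc hit-loss) ^ s × budget-factor * s ≤ n
  budget = greedy-budget (suc ν + (m + m)) hit-loss budget-factor

  fits-budget : ∀ a b r z q f s n → 2 * (a * (2 * (r * z))) ≤ q → 2 * (a * b) ≤ f → q * s ≤ n → f ≤ n → a * (b + 2 * (r * (s * z))) ≤ n
  fits-budget a b r z q f s n hq hf hs hn = *-cancelˡ-≤ 2 (by-slack 0
    (+-mono-≤ (≤-trans (*-monoˡ-≤ s hq) hs) (≤-trans hf hn)) (ident a b r z s n))
    where
    ident : ∀ a b r z s n → 2 * (a * (b + 2 * (r * (s * z)))) + (n + n) + 0 ≡ 2 * n + (2 * (a * (2 * (r * z))) * s + 2 * (a * b))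
    ident = solve-∀

  enough : ∀ s n → budget-factor * s ≤ n → fixed ≤ n → (room + 72) * (tiles-room + reserve + 2 * (rounds * (s * size))) ≤ n
  enough s n = fits-budget (room + 72) (tiles-room + reserve) rounds size budget-factor fixed s n
    (proj₂ (above (2 * ((room + 72) * (2 * (rounds * size)))))) (proj₂ (above (2 * ((room + 72) * (tiles-room + reserve)))))

  threshold : ℕ
  threshold = proj₁ (above (6 + (20 * k + (240 * tiles-room + ((30 * (tiles-room + m)) ^ m + (fixed + (3 * reserve + proj₁ budget)))))))

  threshold-bounds : ∀ n → threshold ≤ n → 6 ≤ n × 20 * k ≤ n × 240 * tiles-room ≤ n × (30 * (tiles-room + m)) ^ m ≤ n ×
    fixed ≤ n × 3 * reserve ≤ n × proj₁ budget ≤ n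
  threshold-bounds n big = sum-bounds 6 (20 * k) (240 * tiles-room) ((30 * (tiles-room + m)) ^ m) fixed (3 * reserve) (proj₁ budget) n
    (≤-trans (proj₂ (above (6 + (20 * k + (240 * tiles-room + ((30 * (tiles-room + m)) ^ m + (fixed + (3 * reserve + proj₁ budget)))))))) big)

  module Threshold (n : ℕ) (big : threshold ≤ n) where

    private bounds = threshold-bounds n big

    n≥6 : 6 ≤ n
    n≥6 = proj₁ bounds

    n≥20k : 20 * k ≤ n
    n≥20k = proj₁ (proj₂ bounds)

    n≥240 : 240 * tiles-room ≤ n
    n≥240 = proj₁ (proj₂ (proj₂ bounds))

    n≥power : (30 * (tiles-room + m)) ^ m ≤ n
    n≥power = proj₁ (proj₂ (proj₂ (proj₂ bounds)))

    n≥fixed : fixed ≤ n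
    n≥fixed = proj₁ (proj₂ (proj₂ (proj₂ (proj₂ bounds))))

    n≥reserve : 3 * reserve ≤ n
    n≥reserve = proj₁ (proj₂ (proj₂ (proj₂ (proj₂ (proj₂ bounds)))))

    n≥budget : proj₁ budget ≤ n
    n≥budget = proj₂ (proj₂ (proj₂ (proj₂ (proj₂ (proj₂ bounds)))))

-- Taking t of the unbalanced tiles apart corrects the residue modulo 2 m.
residue : ∀ ν ζ B → let M = suc (suc ν) + suc (suc ν) in ∃ λ t → t ≤ M × M ∣ B + t * imbalance ν ζ
residue ν true B = M ∸ r , m∸n≤m M r , divides (suc (B / M)) (trans (cong₂ _+_ (m≡m%n+[m/n]*n B M) (*-identityʳ (M ∸ r)))
    (trans (ident r (B / M * M) (M ∸ r)) (cong (_+ B / M * M) (m+[n∸m]≡n (<⇒≤ (m%n<n B M))))))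
  where
  M = suc (suc ν) + suc (suc ν)
  r = B % M
  ident : ∀ r q x → r + q + x ≡ r + x + q
  ident = solve-∀
residue ν false B = r , <⇒≤ (m%n<n B M) , divides (B / M + r) (trans (cong (_+ r * imbalance ν false) (m≡m%n+[m/n]*n B M)) (ident r (B / M) ν))
  where
  M = suc (suc ν) + suc (suc ν)
  r = B % M
  ident : ∀ r q ν → r + q * ((2 + ν) + (2 + ν)) + r * ((1 + ν) + (2 + ν)) ≡ (q + r) * ((2 + ν) + (2 + ν))
  ident = solve-∀

module Assembly (ν : ℕ) {n : ℕ} (H : ThreeGraph n) (cond : CodegCondition (suc (suc ν)) H)
  (big : Constants.threshold ν ≤ n) (divisible : 3 * suc (suc ν) ∣ n) where

  open Constants ν
  open Threshold n big

  half : HalfCodegree H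
  half x y x≢y = proj₁ (cond x y x≢y)

  open AbsorberFamily H ν E K 1≤E 1≤K hiding (m)
  open Chunks H ν E K 1≤E 1≤K
  open Bridge H half ν E K 1≤E 1≤K using (close; all-pattern; parity-pattern)
  open Almost H half (suc ν) using (almost)

  steps : Σ ℕ λ s → n ^ (m + (m + m)) * suc hit-loss ^ s < suc (suc hit-loss) ^ s × budget-factor * s ≤ n
  steps = proj₂ budget n n≥budget

  s : ℕ
  s = proj₁ steps

  spend : ℕ
  spend = rounds * (s * size)

  capacity : (room + 72) * (tiles-room + reserve + 2 * spend) ≤ n
  capacity = enough s n (proj₂ (proj₂ steps)) n≥fixed

  fits : ∀ u → u ≤ tiles-room + reserve + 2 * spend → room * u ≤ length V
  fits u hu = ≤-trans (*-mono-≤ (m≤m+n room 72) hu) (≤-trans capacity (≤-reflexive (sym (length-allFin n))))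

  fits-72 : ∀ u → u ≤ tiles-room + reserve + 2 * spend → 72 * u ≤ n
  fits-72 u hu = ≤-trans (*-mono-≤ (m≤n+m 72 room) hu) capacity

  divisible-left : ∀ {T L} → V ↭ T ++ L → Tileable T → 3 * m ∣ length L
  divisible-left {T} {L} p tT = ∣m+n∣m⇒∣n (subst (3 * m ∣_) (trans (sym (length-allFin n)) (trans (↭-length p) (length-++ T))) divisible) (tileable-length tT)

  3m : ∀ m → 3 * m ≡ m + (m + m)
  3m = solve-∀

  closed-case : (∀ x y → n * n * (n * n) * (n * n * (n * n)) ≤ Z * Z * Links.C₃ H half x y) → Tileable V
  closed-case closed = from-absorbers (absorbers pattern-dense cl cl cl s (proj₁ (proj₂ steps)) rounds [] V prefl (fits spend spend≤))
    where
    any : Fin n → Bool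
    any _ = true
    cl : ∀ x y → any x ≡ true → any y ≡ true → Close x y
    cl x y _ _ = close κ κ-K x y (≤-trans (closed x y) (*-monoˡ-≤ (Links.C₃ H half x y) κ₁))
    pattern-dense : length V ^ 3 ≤ E * pattern-count any any any
    pattern-dense = all-pattern 54≤E (≤-trans (s≤s (s≤s z≤n)) n≥6)
    spend≤ : spend ≤ tiles-room + reserve + 2 * spend
    spend≤ = ≤-trans (m≤m+n spend (spend + 0)) (m≤n+m (2 * spend) (tiles-room + reserve))
    Good : List (Fin n) → Set
    Good = Absorbs pattern-dense cl cl cl
    shuffle : (u z t : List (Fin n)) → t ++ (u ++ z) ↭ z ++ (t ++ u)
    shuffle = solve 3 (λ u z t → t ⊕ (u ⊕ z) ⊜ z ⊕ (t ⊕ u)) prefl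
      where open import Algebra.Solver.CommutativeMonoid (++-commutativeMonoid {A = Fin n})
    finish : ∀ Zs ts U i → All Good Zs → length Zs ≡ rounds → All Tile ts → V ↭ concat Zs ++ (concat ts ++ U) → length U < left → length U ≡ i * (3 * m) →
      (Σ (List Target) λ Ts → length Ts ≡ i × All (TargetOf any any any) Ts × concat (map vertices Ts) ≡ U) → Tileable V
    finish Zs ts .(concat (map vertices Ts)) i aZ lZ tiles p small lU (Ts , lT , ok , refl) = tileable-↭ (ptrans (shuffle _ (concat Zs) (concat ts)) (↭-sym p))
      (tileable-++ (ts , tiles , prefl) (absorb-targets pattern-dense cl cl cl Ts Zs ok aZ (≤-trans (≤-reflexive lT) (≤-trans i≤ (≤-reflexive (sym lZ))))))
      where
      i≤ : i ≤ rounds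
      i≤ = ≤-trans (m≤m*n i (3 * m)) (≤-trans (≤-reflexive (sym lU)) (≤-trans (<⇒≤ small) (≤-trans (m≤m+n left tiles-room) (m≤n+m short reserve))))
    from-almost : ∀ Zs → All Good Zs → length Zs ≡ rounds →
      (Σ (List (List (Fin n))) λ ts → Σ (List (Fin n)) λ U → All Tile ts × V ↭ concat Zs ++ (concat ts ++ U) × length U < left) → Tileable V
    from-almost Zs aZ lZ (ts , U , tiles , p , small) = with-quotient (divisible-left {concat Zs ++ concat ts} {U}
        (ptrans p (↭-reflexive (sym (++-assoc (concat Zs) (concat ts) U)))) (tileable-++ (absorb-targets pattern-dense cl cl cl [] Zs [] aZ z≤n) (ts , tiles , prefl)))
      where
      with-quotient : 3 * m ∣ length U → Tileable V
      with-quotient (divides i lU) = finish Zs ts U i aZ lZ tiles p small lU (targets-AAA any i U (trans lU (cong (i *_) (3m m))) (All.tabulate (λ _ → refl)))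
    from-absorbers : (Σ (List (List (Fin n))) λ Zs → Σ (List (Fin n)) λ R → V ↭ concat Zs ++ R × length Zs ≡ rounds × All Good Zs × length (concat Zs) ≤ spend) → Tileable V
    from-absorbers (Zs , R , p , lZ , aZ , cost) = from-almost Zs aZ lZ
      (almost (length R) [] R (concat Zs) [] p (fits-72 (length (concat Zs)) (≤-trans cost spend≤)) ≤-refl)

-- Assembly in the two-class case

third-of : ∀ n c → 119 * n ≤ 240 * c → n ≤ 3 * c
third-of n c h = *-cancelˡ-≤ 119 (by-slack (117 * c) h (ident n c))
  where
  ident : ∀ n c → 119 * n + 240 * c + 117 * c ≡ 119 * (3 * c) + 119 * n
  ident = solve-∀

module Extremal (ν : ℕ) {n : ℕ} (H : ThreeGraph n) (cond : CodegCondition (suc (suc ν)) H)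
  (big : Constants.threshold ν ≤ n) (divisible : 3 * suc (suc ν) ∣ n)
  (P : Parity H (Assembly.half ν H cond big divisible) (Constants.Kc ν) (Constants.k ν)) where

  open Constants ν
  open Threshold n big
  open Assembly ν H cond big divisible
  open AbsorberFamily H ν E K 1≤E 1≤K hiding (m)
  open Chunks H ν E K 1≤E 1≤K
  open Bridge H half ν E K 1≤E 1≤K using (close; parity-pattern)
  open Almost H half (suc ν) using (almost)
  open Parity P

  outside : Fin n → Bool
  outside x = not (side x)

  cnt : List (Fin n) → ℕ
  cnt xs = ∑ xs (λ v → ⟦ outside v ⟧)

  closed-side : ∀ x y → side x ≡ true → side y ≡ true → Close x y
  closed-side x y hx hy = close κ κ-K x y (≤-trans (closed x y (trans hx (sym hy))) (*-monoˡ-≤ (Links.C₃ H half x y) κ₂))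

  closed-outside : ∀ x y → outside x ≡ true → outside y ≡ true → Close x y
  closed-outside x y hx hy = close κ κ-K x y (≤-trans (closed x y (not-injective (trans hx (sym hy)))) (*-monoˡ-≤ (Links.C₃ H half x y) κ₂))

  240≤k : 240 ≤ k
  240≤k = ≤-trans (≤ᵇ⇒≤ 240 270 tt) (≤-trans (m≤m*n 270 h {{>-nonZero (≤-trans (≤-trans (≤ᵇ⇒≤ 1 180 tt) (m≤m*n 180 m)) h-big)}}) k-big)

  third-side : n ≤ 3 * ∑ V (λ x → ⟦ side x ⟧)
  third-side = third-of n sz (class-lower k n sz 240≤k half₁)
    where sz = ∑ V (λ x → ⟦ side x ⟧)

  third-outside : n ≤ 3 * ∑ V (λ x → ⟦ outside x ⟧)
  third-outside = third-of n sz (class-lower k n sz 240≤k half₂)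
    where sz = ∑ V (λ x → ⟦ outside x ⟧)

  dense-AAA : length V ^ 3 ≤ E * pattern-count side side side
  dense-AAA = parity-pattern P 54≤E 54≤k side side side third-side third-side third-side odd
    where
    odd : ∀ x y z → side x ≡ true → side y ≡ true → side z ≡ true → side x xor (side y xor side z) ≡ true
    odd x y z hx hy hz rewrite hx | hy | hz = refl

  dense-ABB : length V ^ 3 ≤ E * pattern-count side outside outside
  dense-ABB = parity-pattern P 54≤E 54≤k side outside outside third-side third-outside third-outside
    (λ x y z → odd (side x) (side y) (side z))
    where
    odd : ∀ a b c → a ≡ true → not b ≡ true → not c ≡ true → a xor (b xor c) ≡ true
    odd true false false _ _ _ = refl

  GoodA GoodB : List (Fin n) → Set
  GoodA = Absorbs dense-AAA closed-side closed-side closed-side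
  GoodB = Absorbs dense-ABB closed-side closed-outside closed-outside

  -- The B-vertices are used up by i targets of pattern ABB, for which A has enough vertices. What
  -- then remains of A is a multiple of 3m because the total is one, and it is cut into targets of
  -- pattern AAA.
  absorb-L : ∀ ZsA ZsB → All GoodA ZsA → length ZsA ≡ rounds → All GoodB ZsB → length ZsB ≡ rounds →
    ∀ LA LB i q → length LB ≡ i * M → length LA + length LB ≡ q * (3 * m) → reserve ≤ length LA → length LB ≤ short → length LA + length LB ≤ rounds →
    All (λ v → side v ≡ true) LA → All (λ v → outside v ≡ true) LB → Tileable ((LA ++ LB) ++ (concat ZsA ++ concat ZsB))
  absorb-L ZsA ZsB aA lA aB lB LA LB i q lLB lL big-A small-B small-L allA allB = from-cut (cut (i * m) (l * (m + (m + m))) LA LA-length)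
    where
    i≤short : i ≤ short
    i≤short = ≤-trans (m≤m*n i M) (≤-trans (≤-reflexive (sym lLB)) small-B)
    im≤A : i * m ≤ length LA
    im≤A = ≤-trans (≤-trans (*-monoˡ-≤ m i≤short) (≤-reflexive (*-comm short m))) big-A
    triple : ∀ i m → i * (3 * m) ≡ i * m + i * (m + m)
    triple = solve-∀
    i≤q : i ≤ q
    i≤q = *-cancelʳ-≤ i q (3 * m) (≤-trans (≤-reflexive (triple i m)) (≤-trans (+-mono-≤ im≤A (≤-reflexive (sym lLB))) (≤-reflexive lL)))
    l : ℕ
    l = q ∸ i
    LA-length : length LA ≡ i * m + l * (m + (m + m))
    LA-length = +-cancelʳ-≡ (i * M) (length LA) _ (trans (cong (length LA +_) (sym lLB)) (trans lL (trans (cong (_* (3 * m)) (sym (m+[n∸m]≡n i≤q))) (ident i l m))))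
      where
      ident : ∀ i l m → (i + l) * (3 * m) ≡ i * m + l * (m + (m + m)) + i * (m + m)
      ident = solve-∀
    l≤ : l ≤ rounds
    l≤ = ≤-trans (m∸n≤m q i) (≤-trans (m≤m*n q (3 * m)) (≤-trans (≤-reflexive (sym lL)) small-L))
    combine : ∀ L₁ L₂ → LA ≡ L₁ ++ L₂ →
      (Σ (List Target) λ Ts → length Ts ≡ i × All (TargetOf side outside outside) Ts × concat (map vertices Ts) ↭ L₁ ++ LB) →
      (Σ (List Target) λ Ts → length Ts ≡ l × All (TargetOf side side side) Ts × concat (map vertices Ts) ≡ L₂) →
      Tileable ((LA ++ LB) ++ (concat ZsA ++ concat ZsB))
    combine L₁ .(concat (map vertices Us)) refl (Ts , lT , okT , p) (Us , lU , okU , refl) =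
      tileable-↭ (ptrans (++⁺ˡ (concat (map vertices Us) ++ concat ZsA) (++⁺ʳ (concat ZsB) p)) (shuffle L₁ (concat (map vertices Us)) LB (concat ZsA) (concat ZsB)))
        (tileable-++ (absorb-targets dense-AAA closed-side closed-side closed-side Us ZsA okU aA (≤-trans (≤-reflexive lU) (≤-trans l≤ (≤-reflexive (sym lA)))))
          (absorb-targets dense-ABB closed-side closed-outside closed-outside Ts ZsB okT aB (≤-trans (≤-reflexive lT) (≤-trans (≤-trans i≤short (m≤n+m short reserve)) (≤-reflexive (sym lB))))))
      where
      shuffle : (a b c x y : List (Fin n)) → (b ++ x) ++ ((a ++ c) ++ y) ↭ ((a ++ b) ++ c) ++ (x ++ y)
      shuffle = solve 5 (λ a b c x y → (b ⊕ x) ⊕ ((a ⊕ c) ⊕ y) ⊜ ((a ⊕ b) ⊕ c) ⊕ (x ⊕ y)) prefl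
        where open import Algebra.Solver.CommutativeMonoid (++-commutativeMonoid {A = Fin n})
    from-cut : (Σ (List (Fin n)) λ L₁ → Σ (List (Fin n)) λ L₂ → LA ≡ L₁ ++ L₂ × length L₁ ≡ i * m × length L₂ ≡ l * (m + (m + m))) →
      Tileable ((LA ++ LB) ++ (concat ZsA ++ concat ZsB))
    from-cut (L₁ , L₂ , e , l₁ , l₂) = let (a₁ , a₂) = cut-all L₁ L₂ e allA in
      combine L₁ L₂ e (targets-ABB side outside i L₁ LB l₁ lLB a₁ allB) (targets-AAA side l L₂ l₂ a₂)

  module Weighted (ζ : Bool) (ζ-small : 2 * ∑ (allFin n) (λ x → ⟦ not (side x xor ζ) ⟧) ≤ n) where

    β : ℕ
    β = imbalance ν ζ

    Fix : List (Fin n) → Set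
    Fix t = Tile t × cnt t ≡ β

    fix-length : ∀ {Xs} → All Fix Xs → length (concat Xs) ≡ length Xs * (3 * m)
    fix-length {Xs} a = length-concat (3 * m) Xs (All.map (length-tile ∘ proj₁) a)

    fix-count : ∀ Xs → All Fix Xs → cnt (concat Xs) ≡ length Xs * β
    fix-count []       []            = refl
    fix-count (t ∷ Xs) ((_ , e) ∷ a) = trans (∑-++ t (concat Xs) _) (cong₂ _+_ e (fix-count Xs a))

    small-enough : ∀ {u} → u ≤ tiles-room → 240 * u ≤ n × (30 * (u + m)) ^ m ≤ n
    small-enough hu = ≤-trans (*-monoʳ-≤ 240 hu) n≥240 , ≤-trans (^-monoˡ-≤ m (*-monoʳ-≤ 30 (+-monoˡ-≤ m hu))) n≥power

    Fixes : ℕ → Set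
    Fixes j = Σ (List (List (Fin n))) λ Xs → Σ (List (Fin n)) λ R → V ↭ concat Xs ++ R × length Xs ≡ j × All Fix Xs

    fixes-room : ∀ {Xs j} → length Xs ≡ j → j ≤ M → All Fix Xs → length (concat Xs) ≤ tiles-room
    fixes-room {Xs} lX hj a = ≤-trans (≤-reflexive (fix-length a)) (*-monoˡ-≤ (3 * m) (≤-trans (≤-reflexive lX) hj))

    fixes : ∀ j → j ≤ M → Fixes j
    fixes zero    _  = [] , V , prefl , refl , []
    fixes (suc j) hj = extend (fixes j (≤-trans (n≤1+n j) hj))
      where
      extend : Fixes j → Fixes (suc j)
      extend (Xs , R , p , lX , a) = add (Unbalanced.unbalanced-tile H half ν Kc k P cond ζ ζ-small h h-big k-big (concat Xs) R p
          (proj₁ (small-enough within)) (proj₂ (small-enough within)))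
        where
        within = fixes-room lX (≤-trans (n≤1+n j) hj) a
        add : (Σ (List (Fin n)) λ t → Σ (List (Fin n)) λ R′ → Tile t × R ↭ t ++ R′ × cnt t ≡ β) → Fixes (suc j)
        add (t , R′ , T , q , e) = t ∷ Xs , R′ , ptrans p (ptrans (++⁺ˡ (concat Xs) q) (ptrans (↭-reflexive (sym (++-assoc (concat Xs) t R′)))
          (++⁺ʳ R′ (++-comm (concat Xs) t)))) , cong suc lX , (T , e) ∷ a

    -- The first t reserved tiles are dissolved into the leftover and the others remain tiles. Each
    -- dissolved tile adds `β` vertices of B and the reserve adds none, so the given t makes the
    -- B-part of the leftover divisible by 2m.
    finish : ∀ Xs Rz ZsA ZsB ts U → All Fix Xs → length Xs ≡ M → All (λ v → side v ≡ true) Rz → length Rz ≡ reserve →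
      All GoodA ZsA → length ZsA ≡ rounds → All GoodB ZsB → length ZsB ≡ rounds → All Tile ts → length U < left →
      V ↭ (((concat Xs ++ Rz) ++ concat ZsA) ++ concat ZsB) ++ (concat ts ++ U) →
      (∃ λ t → t ≤ M × M ∣ cnt U + t * β) → Tileable V
    finish Xs Rz ZsA ZsB ts U aX lX allRz lRz aA lA aB lB tiles small p (t , t≤M , divides i di) = with-quotient (divisible-left {Tl ++ Zl} {L} V↭ (tileable-++ tileT tileZ))
      where
      X₁ X₂ : List (List (Fin n))
      X₁ = take t Xs
      X₂ = drop t Xs
      a₁ : All Fix X₁
      a₁ = AllP.take⁺ t aX
      lX₁ : length X₁ ≡ t
      lX₁ = trans (length-take t Xs) (m≤n⇒m⊓n≡m (≤-trans t≤M (≤-reflexive (sym lX))))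
      L Tl Zl : List (Fin n)
      L  = U ++ (Rz ++ concat X₁)
      Tl = concat X₂ ++ concat ts
      Zl = concat ZsA ++ concat ZsB
      tileT : Tileable Tl
      tileT = tileable-++ (X₂ , All.map proj₁ (AllP.drop⁺ t aX) , prefl) (ts , tiles , prefl)
      tileZ : Tileable Zl
      tileZ = tileable-++ (absorb-targets dense-AAA closed-side closed-side closed-side [] ZsA [] aA z≤n)
                          (absorb-targets dense-ABB closed-side closed-outside closed-outside [] ZsB [] aB z≤n)
      shuffle : (x y r a b t u : List (Fin n)) → ((((x ++ y) ++ r) ++ a) ++ b) ++ (t ++ u) ↭ ((y ++ t) ++ (a ++ b)) ++ (u ++ (r ++ x))
      shuffle = solve 7 (λ x y r a b t u → ((((x ⊕ y) ⊕ r) ⊕ a) ⊕ b) ⊕ (t ⊕ u) ⊜ ((y ⊕ t) ⊕ (a ⊕ b)) ⊕ (u ⊕ (r ⊕ x))) prefl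
        where open import Algebra.Solver.CommutativeMonoid (++-commutativeMonoid {A = Fin n})
      V↭ : V ↭ (Tl ++ Zl) ++ L
      V↭ = ptrans p (ptrans (↭-reflexive (cong (λ z → (((z ++ Rz) ++ concat ZsA) ++ concat ZsB) ++ (concat ts ++ U))
             (trans (cong concat (sym (take++drop≡id t Xs))) (concat-++ X₁ X₂))))
           (shuffle (concat X₁) (concat X₂) Rz (concat ZsA) (concat ZsB) (concat ts) U))
      LA LB : List (Fin n)
      LA = filterᵇ side L
      LB = filterᵇ outside L
      L↭ : L ↭ LA ++ LB
      L↭ = filter-split side L
      lL : length L ≡ length LA + length LB
      lL = trans (↭-length L↭) (length-++ LA)
      cnt-Rz : cnt Rz ≡ 0
      cnt-Rz = zeros Rz allRz
        where
        zeros : ∀ xs → All (λ v → side v ≡ true) xs → cnt xs ≡ 0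
        zeros []       []       = refl
        zeros (x ∷ xs) (e ∷ es) = cong₂ _+_ (cong (⟦_⟧ ∘ not) e) (zeros xs es)
      lLB′ : length LB ≡ cnt U + cnt (concat X₁)
      lLB′ = trans (length-filter outside L) (trans (∑-++ U (Rz ++ concat X₁) _) (cong (cnt U +_) (trans (∑-++ Rz (concat X₁) _) (cong (_+ cnt (concat X₁)) cnt-Rz))))
      lLB : length LB ≡ i * M
      lLB = trans lLB′ (trans (cong (cnt U +_) (trans (fix-count X₁ a₁) (cong (_* β) lX₁))) di)
      X₁-small : length (concat X₁) ≤ tiles-room
      X₁-small = fixes-room lX₁ t≤M a₁
      small-B : length LB ≤ short
      small-B = ≤-trans (≤-reflexive lLB′) (+-mono-≤ (≤-trans (count≤length U outside) (<⇒≤ small)) (≤-trans (count≤length (concat X₁) outside) X₁-small))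
      big-A : reserve ≤ length LA
      big-A = begin
        reserve                                   ≡⟨ sym lRz ⟩
        length Rz                                 ≡⟨ sym (ones Rz allRz) ⟩
        ∑ Rz (λ v → ⟦ side v ⟧)                   ≤⟨ m≤m+n _ _ ⟩
        ∑ Rz (λ v → ⟦ side v ⟧) + ∑ (concat X₁) (λ v → ⟦ side v ⟧) ≡⟨ sym (∑-++ Rz (concat X₁) _) ⟩
        ∑ (Rz ++ concat X₁) (λ v → ⟦ side v ⟧)    ≤⟨ m≤n+m _ _ ⟩
        ∑ U (λ v → ⟦ side v ⟧) + ∑ (Rz ++ concat X₁) (λ v → ⟦ side v ⟧) ≡⟨ sym (trans (length-filter side L) (∑-++ U (Rz ++ concat X₁) _)) ⟩
        length LA                                 ∎
        where
        open ≤-Reasoning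
        ones : ∀ xs → All (λ v → side v ≡ true) xs → ∑ xs (λ v → ⟦ side v ⟧) ≡ length xs
        ones []       []       = refl
        ones (x ∷ xs) (e ∷ es) = cong₂ _+_ (cong ⟦_⟧ e) (ones xs es)
      small-L : length LA + length LB ≤ rounds
      small-L = ≤-trans (≤-reflexive (trans (sym lL) (trans (length-++ U) (cong (length U +_) (length-++ Rz)))))
        (≤-trans (+-mono-≤ (<⇒≤ small) (+-mono-≤ (≤-reflexive lRz) X₁-small)) (≤-reflexive (exch left reserve tiles-room)))
        where
        exch : ∀ a b c → a + (b + c) ≡ b + (a + c)
        exch = solve-∀
      with-quotient : 3 * m ∣ length L → Tileable V
      with-quotient (divides q lq) = tileable-↭ (ptrans (++⁺ˡ Tl (ptrans (++⁺ʳ Zl (↭-sym L↭)) (++-comm L Zl))) (ptrans (↭-reflexive (sym (++-assoc Tl Zl L))) (↭-sym V↭)))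
        (tileable-++ tileT (absorb-L ZsA ZsB aA lA aB lB LA LB i q lLB (trans (sym lL) lq) big-A small-B small-L
          (All.tabulate (λ v∈ → proj₂ (filter-∈ side L v∈))) (All.tabulate (λ v∈ → proj₂ (filter-∈ outside L v∈)))))

    module Stages (Xs : List (List (Fin n))) (R : List (Fin n)) (p : V ↭ concat Xs ++ R) (lX : length Xs ≡ M) (aX : All Fix Xs) where

      -- Instantiated for its lower bound on the part of A outside the reserved tiles, from which
      -- the reserve is drawn.
      module U = Unbalanced H half ν Kc k P cond ζ ζ-small h h-big k-big (concat Xs) R p
        (proj₁ (small-enough (fixes-room lX ≤-refl aX))) (proj₂ (small-enough (fixes-room lX ≤-refl aX)))

      Rz R₂ : List (Fin n)
      Rz = take reserve (filterᵇ side R)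
      R₂ = drop reserve (filterᵇ side R) ++ filterᵇ outside R

      R↭ : R ↭ Rz ++ R₂
      R↭ = ptrans (filter-split side R) (ptrans (++⁺ʳ (filterᵇ outside R) (↭-reflexive (sym (take++drop≡id reserve (filterᵇ side R)))))
             (↭-reflexive (++-assoc Rz _ _)))

      lRz : length Rz ≡ reserve
      lRz = trans (length-take reserve (filterᵇ side R)) (m≤n⇒m⊓n≡m (*-cancelˡ-≤ 3 (≤-trans n≥reserve (U.third (length (filterᵇ side R)) U.A-lower))))

      allRz : All (λ v → side v ≡ true) Rz
      allRz = AllP.take⁺ reserve (All.tabulate (λ v∈ → proj₂ (filter-∈ side R v∈)))

      used : List (Fin n)
      used = concat Xs ++ Rz

      used-length : length used ≤ tiles-room + reserve
      used-length = ≤-trans (≤-reflexive (length-++ (concat Xs))) (+-mono-≤ (fixes-room lX ≤-refl aX) (≤-reflexive lRz))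

      p₂ : V ↭ used ++ R₂
      p₂ = ptrans p (ptrans (++⁺ˡ (concat Xs) R↭) (↭-reflexive (sym (++-assoc (concat Xs) Rz R₂))))

      Family : (List (Fin n) → Set) → List (Fin n) → Set
      Family Good R = Σ (List (List (Fin n))) λ Zs → Σ (List (Fin n)) λ R′ → R ↭ concat Zs ++ R′ × length Zs ≡ rounds × All Good Zs × length (concat Zs) ≤ spend

      last-stage : ∀ ZsA ZsB → All GoodA ZsA → length ZsA ≡ rounds → All GoodB ZsB → length ZsB ≡ rounds →
        (Σ (List (List (Fin n))) λ ts → Σ (List (Fin n)) λ U → All Tile ts × V ↭ ((used ++ concat ZsA) ++ concat ZsB) ++ (concat ts ++ U) × length U < left) → Tileable V
      last-stage ZsA ZsB aA lA aB lB (ts , U , tiles , q , small) = finish Xs Rz ZsA ZsB ts U aX lX allRz lRz aA lA aB lB tiles small q (residue ν ζ (cnt U))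

      stage-B : ∀ ZsA R₃ → V ↭ (used ++ concat ZsA) ++ R₃ → length ZsA ≡ rounds → All GoodA ZsA → length (concat ZsA) ≤ spend → Family GoodB R₃ → Tileable V
      stage-B ZsA R₃ p₃ lA aA costA (ZsB , R₄ , q , lB , aB , costB) = last-stage ZsA ZsB aA lA aB lB
        (almost (length R₄) [] R₄ ((used ++ concat ZsA) ++ concat ZsB) [] p₄ (fits-72 _ total) ≤-refl)
        where
        p₄ : V ↭ ((used ++ concat ZsA) ++ concat ZsB) ++ R₄
        p₄ = ptrans p₃ (ptrans (++⁺ˡ (used ++ concat ZsA) q) (↭-reflexive (sym (++-assoc (used ++ concat ZsA) (concat ZsB) R₄))))
        total : length ((used ++ concat ZsA) ++ concat ZsB) ≤ tiles-room + reserve + 2 * spend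
        total = ≤-trans (≤-reflexive (trans (length-++ (used ++ concat ZsA)) (cong (_+ length (concat ZsB)) (length-++ used))))
          (≤-trans (+-mono-≤ (+-mono-≤ used-length costA) costB) (≤-reflexive (ident (tiles-room + reserve) spend)))
          where
          ident : ∀ a b → a + b + b ≡ a + 2 * b
          ident = solve-∀

      stage-A : Family GoodA R₂ → Tileable V
      stage-A (ZsA , R₃ , q , lA , aA , costA) = stage-B ZsA R₃ p₃ lA aA costA
        (absorbers dense-ABB closed-side closed-outside closed-outside s (proj₁ (proj₂ steps)) rounds (used ++ concat ZsA) R₃ p₃
          (fits _ (≤-trans (+-monoˡ-≤ spend (≤-trans (≤-reflexive (length-++ used)) (+-mono-≤ used-length costA))) (≤-reflexive (ident (tiles-room + reserve) spend)))))
        where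
        p₃ : V ↭ (used ++ concat ZsA) ++ R₃
        p₃ = ptrans p₂ (ptrans (++⁺ˡ used q) (↭-reflexive (sym (++-assoc used (concat ZsA) R₃))))
        ident : ∀ a b → a + b + b ≡ a + 2 * b
        ident = solve-∀

      tileable : Tileable V
      tileable = stage-A (absorbers dense-AAA closed-side closed-side closed-side s (proj₁ (proj₂ steps)) rounds used R₂ p₂
        (fits _ (+-mono-≤ used-length (m≤m+n spend (spend + 0)))))

    extremal : Tileable V
    extremal = from-fixes (fixes M ≤-refl)
      where
      from-fixes : Fixes M → Tileable V
      from-fixes (Xs , R , p , lX , aX) = Stages.tileable Xs R p lX aX

  extremal-case : Tileable V
  -- The value true of `ζ` makes A the class Z; if A has more than n/2 vertices, B has fewer.
  extremal-case with 2 * ∑ V (λ x → ⟦ not (side x xor true) ⟧) ≤? n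
  ... | yes small = Weighted.extremal true small
  ... | no ¬small = Weighted.extremal false (+-cancelˡ-≤ n _ _ (≤-trans (+-monoˡ-≤ (2 * b) (<⇒≤ (≰⇒> ¬small)))
        (≤-reflexive (trans (sym (*-distribˡ-+ 2 a b)) (trans (cong (2 *_) total) (cong (n +_) (+-identityʳ n)))))))
    where
    a = ∑ V (λ x → ⟦ not (side x xor true) ⟧)
    b = ∑ V (λ x → ⟦ not (side x xor false) ⟧)
    total : a + b ≡ n
    total = trans (sym (∑-+ V _ _)) (trans (∑-cong V (λ x → one (side x))) (trans (∑-1 V) (length-allFin n)))
      where
      one : ∀ c → ⟦ not (c xor true) ⟧ + ⟦ not (c xor false) ⟧ ≡ 1
      one true  = refl
      one false = refl

theorem1p3 : (m : ℕ) → 2 ≤ m →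
    Σ ℕ (λ n₀ → (n : ℕ) → n₀ ≤ n → 3 * m ∣ n → (H : ThreeGraph n) →
    CodegCondition m H → HasK3Factor m H)
theorem1p3 (suc (suc ν)) (s≤s (s≤s z≤n)) = threshold , factor-of
  where
  open Constants ν
  factor-of : (n : ℕ) → threshold ≤ n → 3 * suc (suc ν) ∣ n → (H : ThreeGraph n) →
    CodegCondition (suc (suc ν)) H → HasK3Factor (suc (suc ν)) H
  factor-of n big divisible H cond = Factor.factor H m (by-case (Dichotomy.dichotomy H half n≥6 Kc Kc-big Z Z-big))
    where
    open Threshold n big
    open Assembly ν H cond big divisible using (half; closed-case)
    by-case : (∀ x y → n * n * (n * n) * (n * n * (n * n)) ≤ Z * Z * Links.C₃ H half x y) ⊎ Split H half Kc Z → Tiling.Tileable H m (allFin n)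
    by-case (inj₁ closed) = closed-case closed
    by-case (inj₂ split)  = Extremal.extremal-case ν H cond big divisible
      (ParityOf.parity-structure H half Kc Z (20 * k) (≤-trans (≤-trans (s≤s z≤n) 54≤k) (m≤n*m k 20)) n≥6 n≥20k Z-big′ split k refl)
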